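{- Let $H$ be a rational symmetric matrix indexed by a finite set $V$, let $a\in V$, and suppose $0\in\operatorname{supp}_H(e_a)$. For any $b\in V$ with $b\ne a$, either no positive even power of $H$ has PST from $a$ to $b$, or every positive even power of $H$ has PST from $a$ to $b$. If some positive even power of $H$ has PST from $a$ to $b$, then $\lambda^2\in\mathbb Q$ for every $\lambda\in\operatorname{supp}_H(e_a)$.
   Context: For a finite set $V$ (elements are called vertices), $e_v$ denotes the standard basis vector indexed by $v\in V$. For a real symmetric matrix $H$ indexed by $V$ with spectral decomposition $H=\sum_{\lambda\in\operatorname{Spec}(H)}\lambda E_\lambda$ ($E_\lambda$ the orthogonal projection onto the $\lambda$-eigenspace), and a vector $x$, put $\operatorname{supp}_H(x)=\{\lambda\in\operatorname{Spec}(H):E_\lambda x\neq 0\}$. A rational symmetric matrix is a symmetric matrix with entries in $\mathbb Q$. A positive even power of $H$ is $H^k$ with $k$ a positive even integer. A real symmetric matrix $K$ has perfect state transfer (PST) from $a$ to $b$ if $\exp(-\mathrm i\tau K)e_a=\gamma e_b$ for some $\tau>0$ and some $\gamma\in\mathbb C$ with $|\gamma|=1$. -}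

module Defs where

open import Level using (0ℓ)
open import Algebra.Bundles using (CommutativeRing)
open import Algebra.Bundles.Raw using (RawRing)
import Algebra.Definitions.RawMonoid as RawMonoidDefs
import Algebra.Definitions.RawSemiring as RawSemiringDefs
open import Data.Bool.Base using (if_then_else_)
open import Data.Fin.Base using (Fin; toℕ)
import Data.Fin.Properties as Fin
open import Data.Integer.Base as ℤ using (ℤ; +_; -[1+_])
open import Data.Nat.Base as ℕ using (ℕ; suc; _!)
open import Data.Nat.Divisibility using (_∣_)
open import Data.Product.Base using (∃; ∃-syntax; _×_; _,_; proj₁; proj₂)
open import Data.Rational.Base using (ℚ; ↥_; ↧ₙ_)
open import Data.Vec.Functional using (Vector)
open import Relation.Binary.Core using (Rel)
open import Relation.Binary.PropositionalEquality.Core using (_≡_)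
open import Relation.Binary.Structures using (IsTotalOrder)
import Relation.Binary.Construct.NonStrictToStrict as NonStrictToStrict
open import Relation.Nullary.Decidable.Core using (does)
open import Relation.Nullary.Negation.Core using (¬_)

-- The real numbers, characterised (up to unique isomorphism) as a
-- complete ordered field.  The inverse is a total function whose value
-- at 0# is left unspecified.

record CompleteOrderedField : Set₁ where
  field
    commutativeRing : CommutativeRing 0ℓ 0ℓ

  open CommutativeRing commutativeRing public

  infix 4 _≤_
  infix 8 _⁻¹

  field
    _≤_          : Rel Carrier 0ℓ
    isTotalOrder : IsTotalOrder _≈_ _≤_
    _⁻¹          : Carrier → Carrier
    0≉1          : ¬ (0# ≈ 1#)
    *-inverseʳ   : ∀ x → ¬ (x ≈ 0#) → x * x ⁻¹ ≈ 1#
    +-monoˡ-≤    : ∀ z {x y} → x ≤ y → x + z ≤ y + z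
    *-nonNeg     : ∀ {x y} → 0# ≤ x → 0# ≤ y → 0# ≤ x * y

  IsUpperBound : (Carrier → Set) → Carrier → Set
  IsUpperBound P u = ∀ x → P x → x ≤ u

  field
    supremum : (P : Carrier → Set) → ∃ P → ∃ (IsUpperBound P) →
               ∃[ s ] IsUpperBound P s × (∀ u → IsUpperBound P u → s ≤ u)

  open NonStrictToStrict _≈_ _≤_ public using (_<_)

Matrix : Set → ℕ → Set
Matrix A n = Fin n → Fin n → A

Symmetric : ∀ {n} → Matrix ℚ n → Set
Symmetric H = ∀ u v → H u v ≡ H v u

module LinearAlgebra (R : RawRing 0ℓ 0ℓ) where
  open RawRing R
  open RawMonoidDefs +-rawMonoid using (sum)

  infix 4 _≈ᵥ_
  _≈ᵥ_ : ∀ {n} → Rel (Vector Carrier n) 0ℓ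
  x ≈ᵥ y = ∀ u → x u ≈ y u

  𝟎 : ∀ {n} → Vector Carrier n
  𝟎 u = 0#

  basis : ∀ {n} → Fin n → Vector Carrier n
  basis v u = if does (v Fin.≟ u) then 1# else 0#

  infixr 7 _·_
  _·_ : ∀ {n} → Carrier → Vector Carrier n → Vector Carrier n
  (c · x) u = c * x u

  infixl 6 _-ᵥ_
  _-ᵥ_ : ∀ {n} → Vector Carrier n → Vector Carrier n → Vector Carrier n
  (x -ᵥ y) u = x u + - y u

  dot : ∀ {n} → Vector Carrier n → Vector Carrier n → Carrier
  dot x y = sum (λ u → x u * y u)

  infixr 7 _*ᵥ_
  _*ᵥ_ : ∀ {n} → Matrix Carrier n → Vector Carrier n → Vector Carrier n
  (M *ᵥ x) u = dot (M u) x

  infixr 7 _·ₘ_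
  _·ₘ_ : ∀ {n} → Carrier → Matrix Carrier n → Matrix Carrier n
  (c ·ₘ M) u v = c * M u v

  matrixRing : ℕ → RawRing 0ℓ 0ℓ
  matrixRing n = record
    { Carrier = Matrix Carrier n
    ; _≈_     = λ M N → ∀ u v → M u v ≈ N u v
    ; _+_     = λ M N u v → M u v + N u v
    ; _*_     = λ M N u v → sum (λ w → M u w * N w v)
    ; -_      = λ M u v → - M u v
    ; 0#      = λ u v → 0#
    ; 1#      = basis
    }

  infixr 8 _^ₘ_
  _^ₘ_ : ∀ {n} → Matrix Carrier n → ℕ → Matrix Carrier n
  _^ₘ_ {n} = RawSemiringDefs._^_ (RawRing.rawSemiring (matrixRing n))

module Real (R : CompleteOrderedField) where

  open CompleteOrderedField R public
    using ( _≈_; _+_; _*_; -_; 0#; 1#; _⁻¹; _≤_; _<_; rawRing; +-rawMonoid )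
    renaming (Carrier to ℝ)
  open LinearAlgebra (CompleteOrderedField.rawRing R) public

  fromℕ : ℕ → ℝ
  fromℕ n = RawMonoidDefs._×_ +-rawMonoid n 1#

  fromℤ : ℤ → ℝ
  fromℤ (+ n)    = fromℕ n
  fromℤ -[1+ n ] = - fromℕ (suc n)

  fromℚ : ℚ → ℝ
  fromℚ q = fromℤ (↥ q) * fromℕ (↧ₙ q) ⁻¹

  toReal : ∀ {n} → Matrix ℚ n → Matrix ℝ n
  toReal H u v = fromℚ (H u v)

  IsRational : ℝ → Set
  IsRational x = ∃[ q ] x ≈ fromℚ q

  ConvergesTo : (ℕ → ℝ) → ℝ → Set
  ConvergesTo s l = ∀ ε → 0# < ε →
    ∃[ N ] ∀ m → N ℕ.≤ m → (- ε < s m + - l) × (s m + - l < ε)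

  module _ {n : ℕ} (H : Matrix ℝ n) where

    InEigenspace : ℝ → Vector ℝ n → Set
    InEigenspace θ x = H *ᵥ x ≈ᵥ θ · x

    Spec : ℝ → Set
    Spec θ = ∃[ x ] ¬ (x ≈ᵥ 𝟎) × InEigenspace θ x

    IsEigenprojection : ℝ → Matrix ℝ n → Set
    IsEigenprojection θ E = ∀ x →
      InEigenspace θ (E *ᵥ x) ×
      (∀ y → InEigenspace θ y → dot (x -ᵥ E *ᵥ x) y ≈ 0#)

    -- The orthogonal projection E onto the θ-eigenspace is unique, and it
    -- exists for symmetric H, so ∃ may equally be read as ∀ here.
    Supp : Vector ℝ n → ℝ → Set
    Supp x θ = Spec θ × ∃[ E ] IsEigenprojection θ E × ¬ (E *ᵥ x ≈ᵥ 𝟎)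

module Complex (R : CompleteOrderedField) where

  open Real R using (ℝ; _≈_; _+_; _*_; -_; 0#; 1#; _⁻¹; _≤_; _<_; fromℕ; ConvergesTo)

  ℂ : Set
  ℂ = ℝ × ℝ

  re im : ℂ → ℝ
  re = proj₁
  im = proj₂

  ℂ-rawRing : RawRing 0ℓ 0ℓ
  ℂ-rawRing = record
    { Carrier = ℂ
    ; _≈_     = λ z w → (re z ≈ re w) × (im z ≈ im w)
    ; _+_     = λ z w → re z + re w , im z + im w
    ; _*_     = λ z w → re z * re w + - (im z * im w) , re z * im w + im z * re w
    ; -_      = λ z → - re z , - im z
    ; 0#      = 0# , 0#
    ; 1#      = 1# , 0#
    }

  open RawRing ℂ-rawRing using () renaming (_*_ to _*ᶜ_; -_ to -ᶜ_; +-rawMonoid to +ᶜ-rawMonoid)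
  open LinearAlgebra ℂ-rawRing

  ofℝ : ℝ → ℂ
  ofℝ x = x , 0#

  𝕚 : ℂ
  𝕚 = 0# , 1#

  -- HasModulus z r : r is the nonnegative square root of re² + im².
  HasModulus : ℂ → ℝ → Set
  HasModulus z r = 0# ≤ r × r * r ≈ re z * re z + im z * im z

  expPartialSum : ∀ {n} → Matrix ℂ n → ℕ → Matrix ℂ n
  expPartialSum A m u v =
    RawMonoidDefs.sum +ᶜ-rawMonoid {m}
      (λ j → ofℝ (fromℕ (toℕ j !) ⁻¹) *ᶜ (A ^ₘ toℕ j) u v)

  -- IsExp A U : U is exp A, the entrywise limit of Σ Aʲ / j!.
  IsExp : ∀ {n} → Matrix ℂ n → Matrix ℂ n → Set
  IsExp A U = ∀ u v →
    ConvergesTo (λ m → re (expPartialSum A m u v)) (re (U u v)) ×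
    ConvergesTo (λ m → im (expPartialSum A m u v)) (im (U u v))

  PST : ∀ {n} → Matrix ℝ n → Fin n → Fin n → Set
  PST K a b = ∃[ τ ] 0# < τ × ∃[ γ ] HasModulus γ 1# ×
    ∃[ U ] IsExp ((-ᶜ (𝕚 *ᶜ ofℝ τ)) ·ₘ (λ u v → ofℝ (K u v))) U ×
           U *ᵥ basis a ≈ᵥ γ · basis b

PositiveEven : ℕ → Set
PositiveEven k = 0 ℕ.< k × 2 ∣ k

{-# OPTIONS --safe #-}

-- Let K = H^k with k even, and suppose exp(-i τ K) e_a = γ e_b.  Testing against a kernel vector of H with
-- nonzero a-entry shows that γ is real, hence exp(-i τ μ) = ±1 for every eigenvalue μ of K in the support of
-- e_a.  The zeros of the sine form a discrete group gℤ, so τ μ is a natural multiple of g; as the sum of the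
-- μ is a coefficient of the minimal polynomial of e_a, it is rational, and so is every μ.  A rational
-- eigenvector of K for μ = θ^k is an eigenvector of H² for θ², so θ² is rational.  Write θ² = σ r with
-- naturals r, not all even.  Then τ θ^k / g ≡ r (mod 2) for every such k, and at the time g / σ^(l/2) the
-- power H^l produces the same signs as H^k at τ.

module Submission where

open import Defs
open import Level using (0ℓ)
open import Algebra.Bundles using (AbelianGroup; CommutativeRing; Semiring)
open import Algebra.Bundles.Raw using (RawRing)
import Algebra.Construct.DirectProduct as DirectProduct
import Algebra.Definitions.RawSemiring as RawSemiringDefs
import Algebra.Properties.CommutativeSemiring.Exp as Exp
import Algebra.Properties.Ring as RingProperties
import Algebra.Properties.Semiring.Mult as Mult
import Algebra.Properties.Semiring.Mult.TCOptimised as OptMult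
import Algebra.Properties.Semiring.Sum as SemiringSum
import Algebra.Solver.Ring
open import Algebra.Solver.Ring.AlmostCommutativeRing
  using (_-Raw-AlmostCommutative⟶_; fromCommutativeRing)
open import Axiom.ExcludedMiddle using (ExcludedMiddle)
open import Data.Empty using (⊥; ⊥-elim)
open import Data.Fin.Base as Fin using (Fin; toℕ; punchIn; punchOut)
import Data.Fin.Properties as Fin
open import Data.Integer.Base as ℤ using (ℤ; 0ℤ; 1ℤ; +_; -[1+_])
import Data.Integer.GCD as ℤ
import Data.Integer.Properties as ℤ
open import Data.Maybe.Base using (Maybe; just; nothing)
open import Data.Nat.Base as ℕ using (ℕ; zero; suc; parity; _!)
open import Data.Nat.Divisibility using (divides)
import Data.Nat.Induction as ℕ
import Data.Nat.Properties as ℕ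
open import Data.Parity.Base as Parity using (Parity; 0ℙ; 1ℙ)
import Data.Parity.Properties as Parity
open import Data.Product.Base using (Σ-syntax; ∃; ∃-syntax; _×_; _,_; proj₁; proj₂)
open import Data.Rational.Base as ℚ using (ℚ; ↥_; ↧_)
import Data.Rational.Properties as ℚ
open import Data.Sum.Base as Sum using (_⊎_; inj₁; inj₂; [_,_]′; fromInj₂)
open import Data.Vec.Base using (Vec; []; _∷_)
open import Data.Vec.Functional as Vector using (Vector)
open import Data.Vec.Relation.Unary.All using (All; []; _∷_)
open import Function.Base using (_∘_)
open import Relation.Binary.Bundles using (Poset)
open import Relation.Binary.PropositionalEquality as ≡ using (_≡_; _≢_)
import Relation.Binary.Reasoning.PartialOrder as PartialOrderReasoning
import Relation.Binary.Reasoning.Setoid as SetoidReasoning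
open import Relation.Binary.Structures using (IsTotalOrder)
open import Relation.Nullary using (¬_; yes; no; contradiction)

-- Real eigenvalues and the period are extracted from the situation itself. If p is the minimal
-- polynomial of `e_a`, a real root of p is the supremum of the Rayleigh quotient on ker p(K);
-- splitting off roots one at a time yields a decomposition of `e_a` into eigenvectors and, by
-- Vieta, the sum of the eigenvalues. The polynomial belongs to the vector and not to the matrix
-- because only then does every root lie in the support of `e_a`, so that every summand of the trace
-- is a known multiple of g / τ. The number g is π. A positive zero of the sine is supplied by the
-- transfer: since b differs from a, not all phases can be 1, as the exponential would then fix
-- `e_a`. Evenness enters through positivity. H^(2q) is positive semidefinite, so the multiples of g
-- are natural numbers and their sum is positive as soon as one phase is nontrivial; with mixed
-- signs the sum could vanish and the trace would say nothing. The same positivity leads from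
-- eigenvectors of K back to eigenvectors of H². A kernel vector y of H is fixed by the exponential
-- of every positive power, so y_a = γ y_b with y real; this is what makes γ real.

-- Integers in a commutative ring, as coefficients for the ring solver.

module IntegerCoefficients (S : CommutativeRing 0ℓ 0ℓ) where
  open CommutativeRing S hiding (zero)
  open RingProperties ring
  open Mult semiring using (×-homo-+) renaming (_×_ to _×ₙ_)
  open OptMult semiring using (×ᵤ≈×) renaming (_×_ to _×′_)
  open SetoidReasoning setoid

  ι : ℤ → Carrier
  ι (+ n)    = n ×ₙ 1#
  ι -[1+ n ] = - (suc n ×ₙ 1#)

  ι-⊖ : ∀ m n → ι (m ℤ.⊖ n) ≈ m ×ₙ 1# + - (n ×ₙ 1#)
  ι-⊖ zero    zero    = sym (-‿inverseʳ 0#)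
  ι-⊖ zero    (suc n) = sym (+-identityˡ _)
  ι-⊖ (suc m) zero    = sym (trans (+-congˡ -0#≈0#) (+-identityʳ _))
  ι-⊖ (suc m) (suc n) = begin
    ι (suc m ℤ.⊖ suc n) ≡⟨ ≡.cong ι (ℤ.[1+m]⊖[1+n]≡m⊖n m n) ⟩
    ι (m ℤ.⊖ n) ≈⟨ ι-⊖ m n ⟩
    a + - b ≈⟨ +-congˡ (+-identityˡ _) ⟨
    a + (0# + - b) ≈⟨ +-congˡ (+-congʳ (-‿inverseʳ 1#)) ⟨
    a + (1# + - 1# + - b) ≈⟨ +-congˡ (trans (+-assoc _ _ _) (+-congˡ (-‿+-comm 1# b))) ⟩
    a + (1# + - (1# + b)) ≈⟨ +-assoc _ _ _ ⟨
    a + 1# + - (1# + b) ≈⟨ +-congʳ (+-comm a 1#) ⟩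
    1# + a + - (1# + b) ∎
    where a = m ×ₙ 1#
          b = n ×ₙ 1#

  ι-+ : ∀ i j → ι (i ℤ.+ j) ≈ ι i + ι j
  ι-+ (+ m)    (+ n)    = ×-homo-+ 1# m n
  ι-+ (+ m)    -[1+ n ] = ι-⊖ m (suc n)
  ι-+ -[1+ m ] (+ n)    = trans (ι-⊖ n (suc m)) (+-comm _ _)
  ι-+ -[1+ m ] -[1+ n ] = begin
    - (suc (suc (m ℕ.+ n)) ×ₙ 1#)       ≡⟨ ≡.cong (λ k → - (k ×ₙ 1#)) (≡.cong suc (ℕ.+-suc m n)) ⟨
    - ((suc m ℕ.+ suc n) ×ₙ 1#)         ≈⟨ -‿cong (×-homo-+ 1# (suc m) (suc n)) ⟩
    - (suc m ×ₙ 1# + suc n ×ₙ 1#)        ≈⟨ -‿+-comm _ _ ⟨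
    - (suc m ×ₙ 1#) + - (suc n ×ₙ 1#)    ∎

  ι-neg : ∀ i → ι (ℤ.- i) ≈ - ι i
  ι-neg (+ zero)    = sym -0#≈0#
  ι-neg (+ (suc n)) = refl
  ι-neg -[1+ n ]    = sym (-‿involutive _)

  ι-*⁺ : ∀ m j → ι (+ m ℤ.* j) ≈ m ×ₙ 1# * ι j
  ι-*⁺ zero    j = trans (reflexive (≡.cong ι (ℤ.*-zeroˡ j))) (sym (zeroˡ _))
  ι-*⁺ (suc m) j = begin
    ι (+ suc m ℤ.* j) ≡⟨ ≡.cong ι (ℤ.*-distribʳ-+ j (+ 1) (+ m)) ⟩
    ι (+ 1 ℤ.* j ℤ.+ + m ℤ.* j) ≈⟨ ι-+ (+ 1 ℤ.* j) (+ m ℤ.* j) ⟩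
    ι (+ 1 ℤ.* j) + ι (+ m ℤ.* j) ≈⟨ +-cong (trans (reflexive (≡.cong ι (ℤ.*-identityˡ j))) (sym (*-identityˡ _))) (ι-*⁺ m j) ⟩
    1# * ι j + m ×ₙ 1# * ι j ≈⟨ distribʳ _ _ _ ⟨
    suc m ×ₙ 1# * ι j ∎

  ι-* : ∀ i j → ι (i ℤ.* j) ≈ ι i * ι j
  ι-* (+ m)    j = ι-*⁺ m j
  ι-* -[1+ m ] j = begin
    ι (-[1+ m ] ℤ.* j) ≡⟨ ≡.cong ι (ℤ.neg-distribˡ-* (+ suc m) j) ⟨
    ι (ℤ.- (+ suc m ℤ.* j)) ≈⟨ ι-neg (+ suc m ℤ.* j) ⟩
    - ι (+ suc m ℤ.* j) ≈⟨ -‿cong (ι-*⁺ (suc m) j) ⟩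
    - (suc m ×ₙ 1# * ι j) ≈⟨ -‿distribˡ-* _ _ ⟩
    - (suc m ×ₙ 1#) * ι j ∎

  private
    -- The optimised multiple has no trailing `0#`: `con 1ℤ` evaluates to `1#` and `con (+ 2)` to
    -- `1# + 1#`, which is how these constants appear in goals. The plain multiple in `ι` agrees
    -- with `fromℕ` instead.
    ι′ : ℤ → Carrier
    ι′ (+ n)    = n ×′ 1#
    ι′ -[1+ n ] = - (suc n ×′ 1#)

    ι≈ι′ : ∀ i → ι i ≈ ι′ i
    ι≈ι′ (+ n)    = ×ᵤ≈× n 1#
    ι≈ι′ -[1+ n ] = -‿cong (×ᵤ≈× (suc n) 1#)

    morphism : ℤ.+-*-rawRing -Raw-AlmostCommutative⟶ fromCommutativeRing S
    morphism = record
      { ⟦_⟧    = ι′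
      ; +-homo = λ i j → trans (sym (ι≈ι′ (i ℤ.+ j))) (trans (ι-+ i j) (+-cong (ι≈ι′ i) (ι≈ι′ j)))
      ; *-homo = λ i j → trans (sym (ι≈ι′ (i ℤ.* j))) (trans (ι-* i j) (*-cong (ι≈ι′ i) (ι≈ι′ j)))
      ; -‿homo = λ i → trans (sym (ι≈ι′ (ℤ.- i))) (trans (ι-neg i) (-‿cong (ι≈ι′ i)))
      ; 0-homo = refl
      ; 1-homo = refl
      }

    weaklyDecide : ∀ i j → Maybe (ι′ i ≈ ι′ j)
    weaklyDecide i j with i ℤ.≟ j
    ... | yes ≡.refl = just refl
    ... | no _       = nothing

  module Solver = Algebra.Solver.Ring ℤ.+-*-rawRing (fromCommutativeRing S) morphism weaklyDecide

-- Vectors, matrices and polynomials in a matrix over a commutative ring.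

module RingLinearAlgebra (S : CommutativeRing 0ℓ 0ℓ) where
  open CommutativeRing S hiding (zero)
  open RingProperties ring public using (-0#≈0#; -‿distribˡ-*; -‿distribʳ-*; -‿involutive; -‿+-comm)
  open SemiringSum semiring public using (sum; sum-cong-≋; ∑-distrib-+; ∑-comm; *-distribˡ-sum; *-distribʳ-sum; sum-replicate-zero)
  open RawSemiringDefs (Semiring.rawSemiring semiring) public using (_^_)
  open LinearAlgebra rawRing
  open SetoidReasoning setoid
  open IntegerCoefficients S using (module Solver)
  open Solver using (solve; _:=_; _:+_; _:*_; :-_; _:-_; con)

  sum-zero : ∀ {n} (f : Vector Carrier n) → (∀ i → f i ≈ 0#) → sum f ≈ 0#
  sum-zero {n} f f≈0 = trans (sum-cong-≋ f≈0) (sum-replicate-zero n)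

  infixl 6 _+ᵥ_
  _+ᵥ_ : ∀ {n} → Vector Carrier n → Vector Carrier n → Vector Carrier n
  (x +ᵥ y) u = x u + y u

  dot-cong : ∀ {n} {x x′ y y′ : Vector Carrier n} → x ≈ᵥ x′ → y ≈ᵥ y′ → dot x y ≈ dot x′ y′
  dot-cong p q = sum-cong-≋ (λ u → *-cong (p u) (q u))

  dot-congʳ : ∀ {n} (x : Vector Carrier n) {y y′} → y ≈ᵥ y′ → dot x y ≈ dot x y′
  dot-congʳ x = dot-cong {x = x} (λ _ → refl)

  dot-comm : ∀ {n} (x y : Vector Carrier n) → dot x y ≈ dot y x
  dot-comm x y = sum-cong-≋ (λ u → *-comm (x u) (y u))

  dot-+ʳ : ∀ {n} (x y z : Vector Carrier n) → dot x (y +ᵥ z) ≈ dot x y + dot x z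
  dot-+ʳ x y z = trans (sum-cong-≋ (λ u → distribˡ (x u) (y u) (z u))) (∑-distrib-+ (λ u → x u * y u) (λ u → x u * z u))

  dot-·ʳ : ∀ {n} c (x y : Vector Carrier n) → dot x (c · y) ≈ c * dot x y
  dot-·ʳ c x y = trans (sum-cong-≋ (λ u → solve 3 (λ a b d → a :* (b :* d) := b :* (a :* d)) refl (x u) c (y u)))
                       (sym (*-distribˡ-sum c (λ u → x u * y u)))

  dot-zeroʳ : ∀ {n} (x y : Vector Carrier n) → y ≈ᵥ 𝟎 → dot x y ≈ 0#
  dot-zeroʳ x y y≈0 = sum-zero (λ u → x u * y u) (λ u → trans (*-congˡ (y≈0 u)) (zeroʳ _))

  dot-+ˡ : ∀ {n} (x y z : Vector Carrier n) → dot (x +ᵥ y) z ≈ dot x z + dot y z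
  dot-+ˡ x y z = trans (dot-comm (x +ᵥ y) z) (trans (dot-+ʳ z x y) (+-cong (dot-comm z x) (dot-comm z y)))

  dot-·ˡ : ∀ {n} c (x y : Vector Carrier n) → dot (c · x) y ≈ c * dot x y
  dot-·ˡ c x y = trans (dot-comm (c · x) y) (trans (dot-·ʳ c y x) (*-congˡ (dot-comm y x)))

  dot-sumʳ : ∀ {n m} (x : Vector Carrier n) (y : Fin m → Vector Carrier n) →
             dot x (λ u → sum (λ i → y i u)) ≈ sum (λ i → dot x (y i))
  dot-sumʳ x y = trans (sum-cong-≋ (λ u → *-distribˡ-sum (x u) (λ i → y i u))) (∑-comm (λ u i → x u * y i u))

  basis-zero : ∀ {n} (v u : Fin n) → ¬ (v ≡ u) → basis v u ≈ 0#
  basis-zero v u v≢u with v Fin.≟ u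
  ... | yes v≡u = contradiction v≡u v≢u
  ... | no _    = refl

  basis-one : ∀ {n} (v : Fin n) → basis v v ≈ 1#
  basis-one v with v Fin.≟ v
  ... | yes _  = refl
  ... | no v≢v = contradiction ≡.refl v≢v

  basis-suc : ∀ {n} (v u : Fin n) → basis (Fin.suc v) (Fin.suc u) ≈ basis v u
  basis-suc v u with v Fin.≟ u
  ... | yes _ = refl
  ... | no _  = refl

  dot-basis : ∀ {n} (x : Vector Carrier n) v → dot x (basis v) ≈ x v
  dot-basis {suc n} x Fin.zero = begin
    x Fin.zero * 1# + sum (λ u → x (Fin.suc u) * 0#) ≈⟨ +-cong (*-identityʳ _) (sum-zero (λ u → x (Fin.suc u) * 0#) (λ u → zeroʳ _)) ⟩
    x Fin.zero + 0# ≈⟨ +-identityʳ _ ⟩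
    x Fin.zero ∎
  dot-basis {suc n} x (Fin.suc v) = begin
    x Fin.zero * 0# + sum (λ u → x (Fin.suc u) * basis (Fin.suc v) (Fin.suc u))
      ≈⟨ +-cong (zeroʳ _) (sum-cong-≋ (λ u → *-congˡ (basis-suc v u))) ⟩
    0# + dot (x ∘ Fin.suc) (basis v)
      ≈⟨ trans (+-identityˡ _) (dot-basis (x ∘ Fin.suc) v) ⟩
    x (Fin.suc v) ∎

  module _ {n : ℕ} (M : Matrix Carrier n) where

    *ᵥ-cong : ∀ {x y} → x ≈ᵥ y → M *ᵥ x ≈ᵥ M *ᵥ y
    *ᵥ-cong x≈y u = dot-cong (λ _ → refl) x≈y

    *ᵥ-+ : ∀ x y → M *ᵥ (x +ᵥ y) ≈ᵥ (M *ᵥ x) +ᵥ (M *ᵥ y)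
    *ᵥ-+ x y u = dot-+ʳ (M u) x y

    *ᵥ-· : ∀ c x → M *ᵥ (c · x) ≈ᵥ c · (M *ᵥ x)
    *ᵥ-· c x u = dot-·ʳ c (M u) x

    *ᵥ-sub : ∀ c x y → M *ᵥ (x -ᵥ c · y) ≈ᵥ M *ᵥ x -ᵥ c · M *ᵥ y
    *ᵥ-sub c x y u = begin
      (M *ᵥ (x -ᵥ c · y)) u ≈⟨ *ᵥ-cong (λ v → +-congˡ (-‿distribˡ-* c (y v))) u ⟩
      (M *ᵥ (x +ᵥ - c · y)) u ≈⟨ *ᵥ-+ x (- c · y) u ⟩
      (M *ᵥ x) u + (M *ᵥ (- c · y)) u ≈⟨ +-congˡ (trans (*ᵥ-· (- c) y u) (sym (-‿distribˡ-* c _))) ⟩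
      (M *ᵥ x) u + - (c * (M *ᵥ y) u) ∎

    *ᵥ-zero : ∀ x → x ≈ᵥ 𝟎 → M *ᵥ x ≈ᵥ 𝟎
    *ᵥ-zero x x≈0 u = dot-zeroʳ (M u) x x≈0

    *ᵥ-sum : ∀ {m} (y : Fin m → Vector Carrier n) →
             M *ᵥ (λ u → sum (λ i → y i u)) ≈ᵥ λ u → sum (λ i → (M *ᵥ y i) u)
    *ᵥ-sum y u = dot-sumʳ (M u) y

    ^ₘ-zero : ∀ x → (M ^ₘ 0) *ᵥ x ≈ᵥ x
    ^ₘ-zero x u = trans (dot-comm (basis u) x) (dot-basis x u)

    ^ₘ-suc : ∀ k x → (M ^ₘ suc k) *ᵥ x ≈ᵥ M *ᵥ ((M ^ₘ k) *ᵥ x)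
    ^ₘ-suc k x u = begin
      sum (λ v → sum (λ w → M u w * (M ^ₘ k) w v) * x v)
        ≈⟨ sum-cong-≋ (λ v → *-distribʳ-sum (x v) (λ w → M u w * (M ^ₘ k) w v)) ⟩
      sum (λ v → sum (λ w → M u w * (M ^ₘ k) w v * x v))
        ≈⟨ ∑-comm (λ v w → M u w * (M ^ₘ k) w v * x v) ⟩
      sum (λ w → sum (λ v → M u w * (M ^ₘ k) w v * x v))
        ≈⟨ sum-cong-≋ (λ w → sum-cong-≋ (λ v → *-assoc (M u w) ((M ^ₘ k) w v) (x v))) ⟩
      sum (λ w → sum (λ v → M u w * ((M ^ₘ k) w v * x v)))
        ≈⟨ sum-cong-≋ (λ w → sym (*-distribˡ-sum (M u w) (λ v → (M ^ₘ k) w v * x v))) ⟩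
      (M *ᵥ ((M ^ₘ k) *ᵥ x)) u ∎

    ^ₘ-+ : ∀ j k x → (M ^ₘ (j ℕ.+ k)) *ᵥ x ≈ᵥ (M ^ₘ j) *ᵥ ((M ^ₘ k) *ᵥ x)
    ^ₘ-+ zero    k x u = sym (^ₘ-zero ((M ^ₘ k) *ᵥ x) u)
    ^ₘ-+ (suc j) k x u = begin
      ((M ^ₘ suc (j ℕ.+ k)) *ᵥ x) u          ≈⟨ ^ₘ-suc (j ℕ.+ k) x u ⟩
      (M *ᵥ ((M ^ₘ (j ℕ.+ k)) *ᵥ x)) u       ≈⟨ *ᵥ-cong (^ₘ-+ j k x) u ⟩
      (M *ᵥ ((M ^ₘ j) *ᵥ ((M ^ₘ k) *ᵥ x))) u ≈⟨ ^ₘ-suc j ((M ^ₘ k) *ᵥ x) u ⟨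
      ((M ^ₘ suc j) *ᵥ ((M ^ₘ k) *ᵥ x)) u    ∎

    ^ₘ-eigen : ∀ θ x → M *ᵥ x ≈ᵥ θ · x → ∀ k → (M ^ₘ k) *ᵥ x ≈ᵥ θ ^ k · x
    ^ₘ-eigen θ x Mx≈θx zero    u = trans (^ₘ-zero x u) (sym (*-identityˡ _))
    ^ₘ-eigen θ x Mx≈θx (suc k) u = begin
      ((M ^ₘ suc k) *ᵥ x) u     ≈⟨ ^ₘ-suc k x u ⟩
      (M *ᵥ ((M ^ₘ k) *ᵥ x)) u  ≈⟨ *ᵥ-cong (^ₘ-eigen θ x Mx≈θx k) u ⟩
      (M *ᵥ (θ ^ k · x)) u      ≈⟨ *ᵥ-· (θ ^ k) x u ⟩
      θ ^ k * (M *ᵥ x) u        ≈⟨ *-congˡ (Mx≈θx u) ⟩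
      θ ^ k * (θ * x u)         ≈⟨ solve 3 (λ a b c → a :* (b :* c) := b :* a :* c) refl (θ ^ k) θ (x u) ⟩
      θ * θ ^ k * x u           ∎

    column : ∀ v u → (M *ᵥ basis v) u ≈ M u v
    column v u = dot-basis (M u) v

    SelfAdjoint : Set
    SelfAdjoint = ∀ x y → dot (M *ᵥ x) y ≈ dot x (M *ᵥ y)

    symmetric⇒selfAdjoint : (∀ u v → M u v ≈ M v u) → SelfAdjoint
    symmetric⇒selfAdjoint M-sym x y = begin
      sum (λ u → sum (λ v → M u v * x v) * y u)
        ≈⟨ sum-cong-≋ (λ u → *-distribʳ-sum (y u) (λ v → M u v * x v)) ⟩
      sum (λ u → sum (λ v → M u v * x v * y u))
        ≈⟨ ∑-comm (λ u v → M u v * x v * y u) ⟩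
      sum (λ v → sum (λ u → M u v * x v * y u))
        ≈⟨ sum-cong-≋ (λ v → sum-cong-≋ (λ u → trans (*-congʳ (*-congʳ (M-sym u v)))
             (solve 3 (λ a b c → a :* b :* c := b :* (a :* c)) refl (M v u) (x v) (y u)))) ⟩
      sum (λ v → sum (λ u → x v * (M v u * y u)))
        ≈⟨ sum-cong-≋ (λ v → sym (*-distribˡ-sum (x v) (λ u → M v u * y u))) ⟩
      dot x (M *ᵥ y) ∎

  ^ₘ-selfAdjoint : ∀ {n} (M : Matrix Carrier n) → SelfAdjoint M → ∀ k → SelfAdjoint (M ^ₘ k)
  ^ₘ-selfAdjoint M M-sa zero    x y = trans (dot-cong (^ₘ-zero M x) (λ _ → refl))
                                            (dot-cong (λ _ → refl) (λ u → sym (^ₘ-zero M y u)))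
  ^ₘ-selfAdjoint M M-sa (suc k) x y = begin
    dot ((M ^ₘ suc k) *ᵥ x) y      ≈⟨ dot-cong (^ₘ-suc M k x) (λ _ → refl) ⟩
    dot (M *ᵥ ((M ^ₘ k) *ᵥ x)) y   ≈⟨ M-sa ((M ^ₘ k) *ᵥ x) y ⟩
    dot ((M ^ₘ k) *ᵥ x) (M *ᵥ y)   ≈⟨ ^ₘ-selfAdjoint M M-sa k x (M *ᵥ y) ⟩
    dot x ((M ^ₘ k) *ᵥ (M *ᵥ y))   ≈⟨ dot-congʳ x (^ₘ-comm k) ⟩
    dot x ((M ^ₘ suc k) *ᵥ y)      ∎
    where
    ^ₘ-comm : ∀ k → (M ^ₘ k) *ᵥ (M *ᵥ y) ≈ᵥ (M ^ₘ suc k) *ᵥ y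
    ^ₘ-comm zero    u = trans (^ₘ-zero M (M *ᵥ y) u) (trans (*ᵥ-cong M (λ v → sym (^ₘ-zero M y v)) u) (sym (^ₘ-suc M 0 y u)))
    ^ₘ-comm (suc k) u = trans (^ₘ-suc M k (M *ᵥ y) u) (trans (*ᵥ-cong M (^ₘ-comm k) u) (sym (^ₘ-suc M (suc k) y u)))

  -- The coefficients of a polynomial are listed by increasing degree, without the leading one b.

  evalₛ : ∀ {d} → Carrier → Vec Carrier d → Carrier → Carrier
  evalₛ b []       t = b
  evalₛ b (c ∷ cs) t = c + t * evalₛ b cs t

  -- Horner's scheme: the coefficients of (p - p(t)) / (X - t), whose leading coefficient is again
  -- `b`.
  quotient : ∀ {d} → Carrier → Vec Carrier (suc d) → Carrier → Vec Carrier d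
  quotient b (c ∷ [])      t = []
  quotient b (c ∷ c′ ∷ cs) t = evalₛ b (c′ ∷ cs) t ∷ quotient b (c′ ∷ cs) t

  -- The product (X - t) p for monic p; writing p = c + X q, it is - t c + X (c + (X - t) q).
  timesLinear : ∀ {d} → Carrier → Vec Carrier d → Vec Carrier (suc d)
  timesLinear t []       = - t ∷ []
  timesLinear t (c ∷ cs) with timesLinear t cs
  ... | m ∷ ms = - t * c ∷ (c + m) ∷ ms

  subleading : ∀ {d} → Vec Carrier d → Carrier
  subleading []            = 0#
  subleading (c ∷ [])      = c
  subleading (c ∷ c′ ∷ cs) = subleading (c′ ∷ cs)

  -- Vieta's formula for one root: iterated, it makes `- subleading p` the sum of all roots. In
  -- degree at least two the new top coefficient in Horner's scheme is the old one plus t; in degree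
  -- one the convention `subleading [] = 0#` turns the claim into the root equation.
  subleading-quotient : ∀ {d} (p : Vec Carrier (suc d)) t → evalₛ 1# p t ≈ 0# →
                        subleading (quotient 1# p t) ≈ subleading p + t
  subleading-quotient (c ∷ [])       t p[t]≈0 = sym (trans (+-congˡ (sym (*-identityʳ t))) p[t]≈0)
  subleading-quotient (c ∷ c′ ∷ cs)  t _ = go c′ cs
    where
    go : ∀ {d} c (cs : Vec Carrier d) →
         subleading (evalₛ 1# (c ∷ cs) t ∷ quotient 1# (c ∷ cs) t) ≈ subleading (c ∷ cs) + t
    go c []        = +-congˡ (*-identityʳ t)
    go c (c′ ∷ cs) = go c′ cs

  quotient-eval : ∀ {d} b (p : Vec Carrier (suc d)) s t →
                  evalₛ b p s ≈ evalₛ b p t + (s + - t) * evalₛ b (quotient b p t) s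
  quotient-eval b (c ∷ []) s t =
    solve 4 (λ b c s t → c :+ s :* b := c :+ t :* b :+ (s :- t) :* b) refl b c s t
  quotient-eval b (c ∷ p@(c′ ∷ cs)) s t = begin
    c + s * evalₛ b p s
      ≈⟨ +-congˡ (*-congˡ (quotient-eval b p s t)) ⟩
    c + s * (evalₛ b p t + (s + - t) * evalₛ b (quotient b p t) s)
      ≈⟨ solve 5 (λ c s t e f → c :+ s :* (e :+ (s :- t) :* f) := c :+ t :* e :+ (s :- t) :* (e :+ s :* f))
           refl c s t (evalₛ b p t) (evalₛ b (quotient b p t) s) ⟩
    c + t * evalₛ b p t + (s + - t) * (evalₛ b p t + s * evalₛ b (quotient b p t) s) ∎

  module _ {n : ℕ} (M : Matrix Carrier n) where

    -- The vector p(M) x in Horner form, so that p(M) is never formed as a matrix.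
    eval : ∀ {d} → Carrier → Vec Carrier d → Vector Carrier n → Vector Carrier n
    eval b []       x = b · x
    eval b (c ∷ cs) x = c · x +ᵥ M *ᵥ eval b cs x

    shift : Carrier → Vector Carrier n → Vector Carrier n
    shift t x = M *ᵥ x -ᵥ t · x

    shift-cong : ∀ t {x y} → x ≈ᵥ y → shift t x ≈ᵥ shift t y
    shift-cong t x≈y u = +-cong (*ᵥ-cong M x≈y u) (-‿cong (*-congˡ (x≈y u)))

    shift-+ : ∀ t x y → shift t (x +ᵥ y) ≈ᵥ shift t x +ᵥ shift t y
    shift-+ t x y u = trans (+-congʳ (*ᵥ-+ M x y u))
      (solve 5 (λ a b t x y → a :+ b :- t :* (x :+ y) := a :- t :* x :+ (b :- t :* y)) refl _ _ t (x u) (y u))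

    shift-· : ∀ t c x → shift t (c · x) ≈ᵥ c · shift t x
    shift-· t c x u = trans (+-congʳ (*ᵥ-· M c x u))
      (solve 4 (λ a c t x → c :* a :- t :* (c :* x) := c :* (a :- t :* x)) refl _ c t (x u))

    eval-cong : ∀ {d} b (p : Vec Carrier d) {x y} → x ≈ᵥ y → eval b p x ≈ᵥ eval b p y
    eval-cong b []       x≈y u = *-congˡ (x≈y u)
    eval-cong b (c ∷ cs) x≈y u = +-cong (*-congˡ (x≈y u)) (*ᵥ-cong M (eval-cong b cs x≈y) u)

    eval-+ : ∀ {d} b (p : Vec Carrier d) x y → eval b p (x +ᵥ y) ≈ᵥ eval b p x +ᵥ eval b p y
    eval-+ b []       x y u = distribˡ _ _ _
    eval-+ b (c ∷ cs) x y u = trans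
      (+-congˡ (trans (*ᵥ-cong M (eval-+ b cs x y) u) (*ᵥ-+ M _ _ u)))
      (solve 5 (λ c x y z w → c :* (x :+ y) :+ (z :+ w) := c :* x :+ z :+ (c :* y :+ w)) refl c (x u) (y u) _ _)

    eval-· : ∀ {d} b (p : Vec Carrier d) t x → eval b p (t · x) ≈ᵥ t · eval b p x
    eval-· b []       t x u = solve 3 (λ b t x → b :* (t :* x) := t :* (b :* x)) refl b t (x u)
    eval-· b (c ∷ cs) t x u = trans
      (+-congˡ (trans (*ᵥ-cong M (eval-· b cs t x) u) (*ᵥ-· M t _ u)))
      (solve 4 (λ c t x y → c :* (t :* x) :+ t :* y := t :* (c :* x :+ y)) refl c t (x u) _)

    eval-*ᵥ : ∀ {d} b (p : Vec Carrier d) x → eval b p (M *ᵥ x) ≈ᵥ M *ᵥ eval b p x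
    eval-*ᵥ b []       x u = sym (*ᵥ-· M b x u)
    eval-*ᵥ b (c ∷ cs) x u = begin
      c * (M *ᵥ x) u + (M *ᵥ eval b cs (M *ᵥ x)) u
        ≈⟨ +-cong (sym (*ᵥ-· M c x u)) (*ᵥ-cong M (eval-*ᵥ b cs x) u) ⟩
      (M *ᵥ (c · x)) u + (M *ᵥ (M *ᵥ eval b cs x)) u
        ≈⟨ *ᵥ-+ M (c · x) (M *ᵥ eval b cs x) u ⟨
      (M *ᵥ eval b (c ∷ cs) x) u ∎

    eval-shift : ∀ {d} b (p : Vec Carrier d) t x → eval b p (shift t x) ≈ᵥ shift t (eval b p x)
    eval-shift b p t x u = begin
      eval b p (shift t x) u
        ≈⟨ eval-cong b p (λ v → +-congˡ (-‿distribˡ-* t (x v))) u ⟩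
      eval b p (M *ᵥ x +ᵥ - t · x) u
        ≈⟨ eval-+ b p (M *ᵥ x) (- t · x) u ⟩
      eval b p (M *ᵥ x) u + eval b p (- t · x) u
        ≈⟨ +-cong (eval-*ᵥ b p x u) (eval-· b p (- t) x u) ⟩
      (M *ᵥ eval b p x) u + - t * eval b p x u
        ≈⟨ +-congˡ (-‿distribˡ-* t (eval b p x u)) ⟨
      shift t (eval b p x) u ∎

    eval-eigen : ∀ {d} b (p : Vec Carrier d) θ x → M *ᵥ x ≈ᵥ θ · x → eval b p x ≈ᵥ evalₛ b p θ · x
    eval-eigen b []       θ x Mx≈θx u = refl
    eval-eigen b (c ∷ cs) θ x Mx≈θx u = begin
      c * x u + (M *ᵥ eval b cs x) u ≈⟨ +-congˡ (*ᵥ-cong M (eval-eigen b cs θ x Mx≈θx) u) ⟩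
      c * x u + (M *ᵥ (evalₛ b cs θ · x)) u ≈⟨ +-congˡ (*ᵥ-· M (evalₛ b cs θ) x u) ⟩
      c * x u + evalₛ b cs θ * (M *ᵥ x) u ≈⟨ +-congˡ (*-congˡ (Mx≈θx u)) ⟩
      c * x u + evalₛ b cs θ * (θ * x u) ≈⟨ solve 4 (λ c x e t → c :* x :+ e :* (t :* x) := (c :+ t :* e) :* x) refl c (x u) (evalₛ b cs θ) θ ⟩
      (c + θ * evalₛ b cs θ) * x u ∎

    eval-selfAdjoint : SelfAdjoint M → ∀ {d} b (p : Vec Carrier d) x y → dot (eval b p x) y ≈ dot x (eval b p y)
    eval-selfAdjoint M-sa b []       x y = trans (dot-·ˡ b x y) (sym (dot-·ʳ b x y))
    eval-selfAdjoint M-sa b (c ∷ cs) x y = begin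
      dot (c · x +ᵥ M *ᵥ eval b cs x) y ≈⟨ dot-+ˡ (c · x) (M *ᵥ eval b cs x) y ⟩
      dot (c · x) y + dot (M *ᵥ eval b cs x) y ≈⟨ +-cong (dot-·ˡ c x y) (M-sa (eval b cs x) y) ⟩
      c * dot x y + dot (eval b cs x) (M *ᵥ y) ≈⟨ +-cong (sym (dot-·ʳ c x y)) (eval-selfAdjoint M-sa b cs x (M *ᵥ y)) ⟩
      dot x (c · y) + dot x (eval b cs (M *ᵥ y)) ≈⟨ dot-+ʳ x (c · y) (eval b cs (M *ᵥ y)) ⟨
      dot x (c · y +ᵥ eval b cs (M *ᵥ y)) ≈⟨ dot-congʳ x (λ u → +-congˡ (eval-*ᵥ b cs y u)) ⟩
      dot x (eval b (c ∷ cs) y) ∎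

    eval-quotient : ∀ {d} b (p : Vec Carrier (suc d)) t x →
                    eval b p x ≈ᵥ evalₛ b p t · x +ᵥ shift t (eval b (quotient b p t) x)
    eval-quotient b (c ∷ []) t x u =
      solve 5 (λ b c t x y → c :* x :+ y := (c :+ t :* b) :* x :+ (y :- t :* (b :* x))) refl b c t (x u) _
    eval-quotient b (c ∷ p@(c′ ∷ cs)) t x u = begin
      c * x u + (M *ᵥ eval b p x) u
        ≈⟨ +-congˡ (*ᵥ-cong M (eval-quotient b p t x) u) ⟩
      c * x u + (M *ᵥ (evalₛ b p t · x +ᵥ shift t q)) u
        ≈⟨ +-congˡ (*ᵥ-+ M (evalₛ b p t · x) (shift t q) u) ⟩
      c * x u + ((M *ᵥ (evalₛ b p t · x)) u + (M *ᵥ shift t q) u)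
        ≈⟨ +-congˡ (+-congˡ (*ᵥ-sub M t (M *ᵥ q) q u)) ⟩
      c * x u + ((M *ᵥ (evalₛ b p t · x)) u + shift t (M *ᵥ q) u)
        ≈⟨ solve 6 (λ c x e f t z → c :* x :+ (f :+ z) := (c :+ t :* e) :* x :+ (f :- t :* (e :* x) :+ z))
             refl c (x u) (evalₛ b p t) _ t _ ⟩
      evalₛ b (c ∷ p) t * x u + (shift t (evalₛ b p t · x) u + shift t (M *ᵥ q) u)
        ≈⟨ +-congˡ (sym (shift-+ t (evalₛ b p t · x) (M *ᵥ q) u)) ⟩
      evalₛ b (c ∷ p) t * x u + shift t (evalₛ b p t · x +ᵥ M *ᵥ q) u ∎
      where
      q = eval b (quotient b p t) x

    -- Carries minimality downwards: a monic polynomial of degree j killing (M - t) x gives one of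
    -- degree j + 1 killing x.
    eval-timesLinear : ∀ {d} (p : Vec Carrier d) t x →
                       eval 1# (timesLinear t p) x ≈ᵥ eval 1# p (shift t x)
    eval-timesLinear [] t x u = trans (+-congˡ (*ᵥ-· M 1# x u))
      (solve 3 (λ t x y → :- t :* x :+ con 1ℤ :* y := con 1ℤ :* (y :- t :* x)) refl t (x u) _)
    eval-timesLinear (c ∷ cs) t x u with timesLinear t cs | eval-timesLinear cs t x
    ... | m ∷ ms | ih = begin
      - t * c * x u + (M *ᵥ ((c + m) · x +ᵥ M *ᵥ eval 1# ms x)) u
        ≈⟨ +-congˡ (*ᵥ-cong M (λ v → trans (+-congʳ (distribʳ (x v) c m)) (trans (+-assoc _ _ _) (+-congˡ (ih v)))) u) ⟩
      - t * c * x u + (M *ᵥ (c · x +ᵥ eval 1# cs (shift t x))) u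
        ≈⟨ +-congˡ (trans (*ᵥ-+ M (c · x) (eval 1# cs (shift t x)) u) (+-congʳ (*ᵥ-· M c x u))) ⟩
      - t * c * x u + (c * (M *ᵥ x) u + (M *ᵥ eval 1# cs (shift t x)) u)
        ≈⟨ solve 5 (λ t c x y z → :- t :* c :* x :+ (c :* y :+ z) := c :* (y :- t :* x) :+ z) refl t c (x u) _ _ ⟩
      c * shift t x u + (M *ᵥ eval 1# cs (shift t x)) u ∎

-- Cauchy products and the formal exponential series.

module CauchyProduct (S : CommutativeRing 0ℓ 0ℓ) where
  open CommutativeRing S hiding (zero)
  open Mult semiring using () renaming (_×_ to _×ₙ_)
  open RingLinearAlgebra S
  open SetoidReasoning setoid
  open IntegerCoefficients S using (module Solver)
  open Solver using (solve; _:=_; _:+_; _:*_; :-_; _:-_)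

  partialSum : (ℕ → Carrier) → ℕ → Carrier
  partialSum f N = sum {N} (λ j → f (toℕ j))

  partialSum-suc : ∀ f N → partialSum f (suc N) ≈ partialSum f N + f N
  partialSum-suc f zero    = +-comm (f 0) 0#
  partialSum-suc f (suc N) = trans (+-congˡ (partialSum-suc (f ∘ suc) N)) (sym (+-assoc _ _ _))

  partialSum-cong : ∀ {f g} → (∀ n → f n ≈ g n) → ∀ N → partialSum f N ≈ partialSum g N
  partialSum-cong f≈g N = sum-cong-≋ {N} (λ j → f≈g (toℕ j))

  conv : (ℕ → Carrier) → (ℕ → Carrier) → ℕ → Carrier
  conv f g zero    = f 0 * g 0
  conv f g (suc n) = f 0 * g (suc n) + conv (f ∘ suc) g n

  -- Σ f i * g j over i + j < N
  triangle : (ℕ → Carrier) → (ℕ → Carrier) → ℕ → Carrier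
  triangle f g zero    = 0#
  triangle f g (suc N) = f 0 * partialSum g (suc N) + triangle (f ∘ suc) g N

  partialSum-conv : ∀ f g N → partialSum (conv f g) N ≈ triangle f g N
  partialSum-conv f g zero    = refl
  partialSum-conv f g (suc N) = begin
    f 0 * g 0 + sum {N} (λ j → f 0 * g (suc (toℕ j)) + conv (f ∘ suc) g (toℕ j))
      ≈⟨ +-congˡ (∑-distrib-+ {N} (λ j → f 0 * g (suc (toℕ j))) (λ j → conv (f ∘ suc) g (toℕ j))) ⟩
    f 0 * g 0 + (sum {N} (λ j → f 0 * g (suc (toℕ j))) + partialSum (conv (f ∘ suc) g) N)
      ≈⟨ +-congˡ (+-cong (sym (*-distribˡ-sum {N} (f 0) (λ j → g (suc (toℕ j))))) (partialSum-conv (f ∘ suc) g N)) ⟩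
    f 0 * g 0 + (f 0 * partialSum (g ∘ suc) N + triangle (f ∘ suc) g N)
      ≈⟨ +-assoc _ _ _ ⟨
    f 0 * g 0 + f 0 * partialSum (g ∘ suc) N + triangle (f ∘ suc) g N
      ≈⟨ +-congʳ (distribˡ _ _ _) ⟨
    triangle f g (suc N) ∎

  partialSum-tail : ∀ f M N → partialSum f (suc M) + - partialSum f N ≈ f M + (partialSum f M + - partialSum f N)
  partialSum-tail f M N = trans (+-congʳ (partialSum-suc f M))
    (solve 3 (λ a b c → a :+ b :- c := b :+ (a :- c)) refl (partialSum f M) (f M) (partialSum f N))

  -- Peels off the first term of f in (product of partial sums) - (partial sum of the product). Read
  -- over ℂ and over ℝ, it lets the complex defect be compared with the real one by induction.
  defect-step : ∀ f g N G → partialSum f (suc N) * G + - triangle f g (suc N) ≈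
                f 0 * (G + - partialSum g (suc N)) + (partialSum (f ∘ suc) N * G + - triangle (f ∘ suc) g N)
  defect-step f g N G = solve 5 (λ a b c d e → (a :+ b) :* c :- (a :* d :+ e) := a :* (c :- d) :+ (b :* c :- e)) refl
    (f 0) (partialSum (f ∘ suc) N) G (partialSum g (suc N)) (triangle (f ∘ suc) g N)

  conv-cong : ∀ {f f′ g g′} → (∀ n → f n ≈ f′ n) → (∀ n → g n ≈ g′ n) → ∀ n → conv f g n ≈ conv f′ g′ n
  conv-cong p q zero    = *-cong (p 0) (q 0)
  conv-cong p q (suc n) = +-cong (*-cong (p 0) (q (suc n))) (conv-cong (p ∘ suc) q n)

  conv-+ˡ : ∀ f f′ g n → conv (λ j → f j + f′ j) g n ≈ conv f g n + conv f′ g n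
  conv-+ˡ f f′ g zero    = distribʳ _ _ _
  conv-+ˡ f f′ g (suc n) = trans (+-congˡ (conv-+ˡ (f ∘ suc) (f′ ∘ suc) g n))
    (solve 5 (λ a b c d e → (a :+ b) :* c :+ (d :+ e) := a :* c :+ d :+ (b :* c :+ e)) refl (f 0) (f′ 0) (g (suc n)) _ _)

  conv-*ˡ : ∀ c f g n → conv (λ j → c * f j) g n ≈ c * conv f g n
  conv-*ˡ c f g zero    = *-assoc _ _ _
  conv-*ˡ c f g (suc n) = trans (+-cong (*-assoc _ _ _) (conv-*ˡ c (f ∘ suc) g n)) (sym (distribˡ _ _ _))

  conv-*ʳ : ∀ c f g n → conv f (λ j → c * g j) n ≈ c * conv f g n
  conv-*ʳ c f g zero    = solve 3 (λ a b c → a :* (c :* b) := c :* (a :* b)) refl (f 0) (g 0) c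
  conv-*ʳ c f g (suc n) = trans (+-congˡ (conv-*ʳ c (f ∘ suc) g n))
    (solve 4 (λ a b c d → a :* (c :* b) :+ c :* d := c :* (a :* b :+ d)) refl (f 0) (g (suc n)) c _)

  private
    -- Coefficients of the formal derivative.
    D : (ℕ → Carrier) → ℕ → Carrier
    D f j = suc j ×ₙ 1# * f (suc j)

  -- The product rule (F G)' = F' G + F G' for formal power series, compared at degree n.
  leibniz : ∀ f g n → suc n ×ₙ 1# * conv f g (suc n) ≈ conv (D f) g n + conv f (D g) n
  leibniz f g zero = solve 5 (λ o a b c d → o :* (a :* b :+ c :* d) := o :* c :* d :+ a :* (o :* b)) refl
    (1 ×ₙ 1#) (f 0) (g 1) (f 1) (g 0)
  leibniz f g (suc m) = begin
    (1# + μ) * (f 0 * g (suc (suc m)) + conv (f ∘ suc) g (suc m))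
      ≈⟨ solve 5 (λ o μ a b c → (o :+ μ) :* (a :* b :+ c) := a :* ((o :+ μ) :* b) :+ (o :* c :+ μ :* c)) refl
           1# μ (f 0) (g (suc (suc m))) (conv (f ∘ suc) g (suc m)) ⟩
    f 0 * D g (suc m) + (1# * conv (f ∘ suc) g (suc m) + μ * conv (f ∘ suc) g (suc m))
      ≈⟨ +-congˡ (+-cong (*-identityˡ _) (leibniz (f ∘ suc) g m)) ⟩
    f 0 * D g (suc m) + (f 1 * g (suc m) + conv (λ j → f (2 ℕ.+ j)) g m + (conv (D (f ∘ suc)) g m + conv (f ∘ suc) (D g) m))
      ≈⟨ solve 5 (λ a b c d e → a :+ (b :+ c :+ (d :+ e)) := b :+ (c :+ d) :+ (a :+ e)) refl _ _ _ _ _ ⟩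
    f 1 * g (suc m) + (conv (λ j → f (2 ℕ.+ j)) g m + conv (D (f ∘ suc)) g m) + conv f (D g) (suc m)
      ≈⟨ +-congʳ (+-cong (*-congʳ (trans (sym (*-identityˡ _)) (*-congʳ (sym (+-identityʳ 1#)))))
           (trans (sym (conv-+ˡ (λ j → f (2 ℕ.+ j)) (D (f ∘ suc)) g m))
             (conv-cong (λ j → trans (+-congʳ (sym (*-identityˡ _))) (sym (distribʳ _ _ _))) (λ _ → refl) m))) ⟩
    conv (D f) g (suc m) + conv f (D g) (suc m) ∎
    where μ = suc m ×ₙ 1#

  -- Abstract in the reciprocals, `inv n` being that of n + 1, so that one development serves ℝ and
  -- ℂ.
  module ExponentialTerms (inv : ℕ → Carrier) (inv-inverse : ∀ n → suc n ×ₙ 1# * inv n ≈ 1#) where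

    term : Carrier → ℕ → Carrier
    term z zero    = 1#
    term z (suc n) = inv n * (z * term z n)

    term-cong : ∀ {z w} → z ≈ w → ∀ n → term z n ≈ term w n
    term-cong z≈w zero    = refl
    term-cong z≈w (suc n) = *-congˡ (*-cong z≈w (term-cong z≈w n))

    private
      D-term : ∀ z n → D (term z) n ≈ z * term z n
      D-term z n = trans (sym (*-assoc _ _ _)) (trans (*-congʳ (inv-inverse n)) (*-identityˡ _))

    -- The series of `term z` solves F' = z F with F(0) = 1. By the product rule the Cauchy product
    -- solves F' = (z + w) F, and this equation determines the coefficients one after the other; it
    -- takes the place of a computation with binomial coefficients.
    term-+ : ∀ z w n → conv (term z) (term w) n ≈ term (z + w) n
    term-+ z w zero    = *-identityˡ 1#
    term-+ z w (suc n) = begin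
      c ≈⟨ *-identityˡ _ ⟨
      1# * c ≈⟨ *-congʳ (inv-inverse n) ⟨
      suc n ×ₙ 1# * inv n * c ≈⟨ solve 3 (λ a b c → a :* b :* c := b :* (a :* c)) refl (suc n ×ₙ 1#) (inv n) c ⟩
      inv n * (suc n ×ₙ 1# * c) ≈⟨ *-congˡ (leibniz (term z) (term w) n) ⟩
      inv n * (conv (D (term z)) (term w) n + conv (term z) (D (term w)) n)
        ≈⟨ *-congˡ (+-cong (conv-cong (D-term z) (λ _ → refl) n) (conv-cong (λ _ → refl) (D-term w) n)) ⟩
      inv n * (conv (λ j → z * term z j) (term w) n + conv (term z) (λ j → w * term w j) n)
        ≈⟨ *-congˡ (+-cong (conv-*ˡ z (term z) (term w) n) (conv-*ʳ w (term z) (term w) n)) ⟩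
      inv n * (z * conv (term z) (term w) n + w * conv (term z) (term w) n)
        ≈⟨ *-congˡ (trans (sym (distribʳ _ _ _)) (*-congˡ (term-+ z w n))) ⟩
      term (z + w) (suc n) ∎
      where c = conv (term z) (term w) (suc n)

    term-unique : ∀ (c : ℕ → Carrier) → c 0 ≈ 1# → (∀ j → c (suc j) ≈ inv j * c j) → ∀ z j → c j * z ^ j ≈ term z j
    term-unique c c₀≈1 c-suc z zero    = trans (*-identityʳ _) c₀≈1
    term-unique c c₀≈1 c-suc z (suc j) = trans (*-congʳ (c-suc j)) (trans
      (solve 4 (λ i c z p → i :* c :* (z :* p) := i :* (z :* (c :* p))) refl (inv j) (c j) z (z ^ j))
      (*-congˡ (*-congˡ (term-unique c c₀≈1 c-suc z j))))

    expSum : Carrier → ℕ → Carrier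
    expSum z = partialSum (term z)

    expSum-+ : ∀ z w N → expSum (z + w) N ≈ triangle (term z) (term w) N
    expSum-+ z w N = trans (sym (partialSum-cong (term-+ z w) N)) (partialSum-conv (term z) (term w) N)

-- Arithmetic of the complete ordered field, absolute values and limits.

module OrderedField (em : ExcludedMiddle 0ℓ) (R : CompleteOrderedField) where
  open CompleteOrderedField R hiding (zero) public
  open Real R public using (ℝ; fromℕ; fromℤ; fromℚ; IsRational; ConvergesTo)
  open Mult semiring public using (×1-homo-*)
  open LinearAlgebra rawRing public
  open RingLinearAlgebra commutativeRing public
  open CauchyProduct commutativeRing public using (partialSum; partialSum-suc)
  open IntegerCoefficients commutativeRing public using (ι; ι-+; ι-*; module Solver)
  open Solver public using (solve; _:=_; _:+_; _:*_; :-_; _:-_; con)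
  private module ≤ = IsTotalOrder isTotalOrder

  poset : Poset 0ℓ 0ℓ 0ℓ
  poset = record { isPartialOrder = ≤.isPartialOrder }

  open PartialOrderReasoning poset

  by-contradiction : ∀ {A : Set} → (¬ A → ⊥) → A
  by-contradiction {A} ¬¬a with em {A}
  ... | yes a = a
  ... | no ¬a = ⊥-elim (¬¬a ¬a)

  by-cases : ∀ {A B : Set} → (A → B) → (¬ A → B) → B
  by-cases {A} f g with em {A}
  ... | yes a = f a
  ... | no ¬a = g ¬a

  ≤-refl : ∀ {x} → x ≤ x
  ≤-refl = ≤.reflexive refl

  ≤-reflexive : ∀ {x y} → x ≈ y → x ≤ y
  ≤-reflexive = ≤.reflexive

  ≤-trans : ∀ {x y z} → x ≤ y → y ≤ z → x ≤ z
  ≤-trans = ≤.trans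

  ≤-antisym : ∀ {x y} → x ≤ y → y ≤ x → x ≈ y
  ≤-antisym = ≤.antisym

  ≰⇒> : ∀ {x y} → ¬ (x ≤ y) → y < x
  ≰⇒> {x} {y} x≰y with ≤.total x y
  ... | inj₁ x≤y = contradiction x≤y x≰y
  ... | inj₂ y≤x = y≤x , λ y≈x → x≰y (≤-reflexive (sym y≈x))

  <⇒≱ : ∀ {x y} → x < y → ¬ (y ≤ x)
  <⇒≱ (x≤y , x≉y) y≤x = x≉y (≤-antisym x≤y y≤x)

  <⇒≤ : ∀ {x y} → x < y → x ≤ y
  <⇒≤ = proj₁

  pos⇒≉0 : ∀ {x} → 0# < x → ¬ (x ≈ 0#)
  pos⇒≉0 0<x x≈0 = proj₂ 0<x (sym x≈0)

  nonneg∧≉0⇒pos : ∀ {x} → 0# ≤ x → ¬ (x ≈ 0#) → 0# < x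
  nonneg∧≉0⇒pos 0≤x x≉0 = 0≤x , λ 0≈x → x≉0 (sym 0≈x)

  <-≤-trans : ∀ {x y z} → x < y → y ≤ z → x < z
  <-≤-trans {x} {y} {z} x<y y≤z = begin-strict x <⟨ x<y ⟩ y ≤⟨ y≤z ⟩ z ∎

  x-y≈0⇒x≈y : ∀ {x y} → x + - y ≈ 0# → x ≈ y
  x-y≈0⇒x≈y {x} {y} x-y≈0 = trans (solve 2 (λ x y → x := x :- y :+ y) refl x y) (trans (+-congʳ x-y≈0) (+-identityˡ y))

  x≈y⇒x-y≈0 : ∀ {x y} → x ≈ y → x + - y ≈ 0#
  x≈y⇒x-y≈0 {x} {y} x≈y = trans (+-congʳ x≈y) (-‿inverseʳ y)

  ≤-diff : ∀ {x y d} → 0# ≤ d → y ≈ x + d → x ≤ y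
  ≤-diff {x} {y} {d} 0≤d y≈x+d = begin
    x       ≈⟨ +-identityˡ x ⟨
    0# + x  ≤⟨ +-monoˡ-≤ x 0≤d ⟩
    d + x   ≈⟨ +-comm d x ⟩
    x + d   ≈⟨ y≈x+d ⟨
    y       ∎

  diff-nonneg : ∀ {x y} → x ≤ y → 0# ≤ y + - x
  diff-nonneg {x} {y} x≤y = begin
    0#        ≈⟨ -‿inverseʳ x ⟨
    x + - x   ≤⟨ +-monoˡ-≤ (- x) x≤y ⟩
    y + - x   ∎

  diff-pos : ∀ {x y} → x < y → 0# < y + - x
  diff-pos {x} {y} (x≤y , x≉y) = nonneg∧≉0⇒pos (diff-nonneg x≤y) λ y-x≈0 →
    x≉y (sym (trans (solve 2 (λ x y → y := y :- x :+ x) refl x y) (trans (+-congʳ y-x≈0) (+-identityˡ x))))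

  <-diff : ∀ {x y d} → 0# < d → y ≈ x + d → x < y
  <-diff {x} {y} {d} 0<d y≈x+d = ≤-diff (<⇒≤ 0<d) y≈x+d , λ x≈y → pos⇒≉0 0<d (begin-equality
    d ≈⟨ solve 2 (λ x d → d := x :+ d :- x) refl x d ⟩
    x + d + - x ≈⟨ +-congʳ (trans (sym y≈x+d) (sym x≈y)) ⟩
    x + - x ≈⟨ -‿inverseʳ x ⟩
    0# ∎)

  +-nonneg : ∀ {x y} → 0# ≤ x → 0# ≤ y → 0# ≤ x + y
  +-nonneg 0≤x 0≤y = ≤-trans 0≤x (≤-diff 0≤y refl)

  +-mono-≤ : ∀ {x y z w} → x ≤ y → z ≤ w → x + z ≤ y + w
  +-mono-≤ {x} {y} {z} {w} x≤y z≤w = ≤-diff (+-nonneg (diff-nonneg x≤y) (diff-nonneg z≤w))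
    (solve 4 (λ x y z w → y :+ w := x :+ z :+ (y :- x :+ (w :- z))) refl x y z w)

  +-monoʳ-≤ : ∀ x {y z} → y ≤ z → x + y ≤ x + z
  +-monoʳ-≤ x y≤z = +-mono-≤ ≤-refl y≤z

  +-mono-<-≤ : ∀ {x y z w} → x < y → z ≤ w → x + z < y + w
  +-mono-<-≤ {x} {y} {z} {w} x<y z≤w = <-diff (<-≤-trans (diff-pos x<y) (≤-diff (diff-nonneg z≤w) refl))
    (solve 4 (λ x y z w → y :+ w := x :+ z :+ (y :- x :+ (w :- z))) refl x y z w)

  neg-mono-≤ : ∀ {x y} → x ≤ y → - y ≤ - x
  neg-mono-≤ {x} {y} x≤y = ≤-diff (diff-nonneg x≤y) (solve 2 (λ x y → :- x := :- y :+ (y :- x)) refl x y)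

  *-monoˡ-≤ : ∀ {z x y} → 0# ≤ z → x ≤ y → z * x ≤ z * y
  *-monoˡ-≤ {z} {x} {y} 0≤z x≤y = ≤-diff (*-nonNeg 0≤z (diff-nonneg x≤y))
    (solve 3 (λ x y z → z :* y := z :* x :+ z :* (y :- x)) refl x y z)

  *-monoʳ-≤ : ∀ {z x y} → 0# ≤ z → x ≤ y → x * z ≤ y * z
  *-monoʳ-≤ 0≤z x≤y = ≤-trans (≤-reflexive (*-comm _ _)) (≤-trans (*-monoˡ-≤ 0≤z x≤y) (≤-reflexive (*-comm _ _)))

  *-mono-≤ : ∀ {x y z w} → 0# ≤ x → x ≤ y → 0# ≤ z → z ≤ w → x * z ≤ y * w
  *-mono-≤ 0≤x x≤y 0≤z z≤w = ≤-trans (*-monoˡ-≤ 0≤x z≤w) (*-monoʳ-≤ (≤-trans 0≤z z≤w) x≤y)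

  neg-nonneg : ∀ {x} → x ≤ 0# → 0# ≤ - x
  neg-nonneg {x} x≤0 = ≤-trans (≤-reflexive (sym -0#≈0#)) (neg-mono-≤ x≤0)

  square-nonneg : ∀ x → 0# ≤ x * x
  square-nonneg x with ≤.total 0# x
  ... | inj₁ 0≤x = *-nonNeg 0≤x 0≤x
  ... | inj₂ x≤0 = ≤-trans (*-nonNeg (neg-nonneg x≤0) (neg-nonneg x≤0))
                     (≤-reflexive (solve 1 (λ x → :- x :* :- x := x :* x) refl x))

  ⁻¹-cancelˡ : ∀ {z} x → ¬ (z ≈ 0#) → z ⁻¹ * (z * x) ≈ x
  ⁻¹-cancelˡ {z} x z≉0 = trans (sym (*-assoc _ _ _)) (trans (*-congʳ (trans (*-comm _ _) (*-inverseʳ z z≉0))) (*-identityˡ x))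

  *-cancelˡ : ∀ z {x y} → ¬ (z ≈ 0#) → z * x ≈ z * y → x ≈ y
  *-cancelˡ z {x} {y} z≉0 zx≈zy = trans (sym (⁻¹-cancelˡ x z≉0)) (trans (*-congˡ zx≈zy) (⁻¹-cancelˡ y z≉0))

  *≈0 : ∀ {x y} → x * y ≈ 0# → ¬ (x ≈ 0#) → y ≈ 0#
  *≈0 {x} xy≈0 x≉0 = *-cancelˡ x x≉0 (trans xy≈0 (sym (zeroʳ x)))

  *≉0 : ∀ {x y} → ¬ (x ≈ 0#) → ¬ (y ≈ 0#) → ¬ (x * y ≈ 0#)
  *≉0 x≉0 y≉0 xy≈0 = y≉0 (*≈0 xy≈0 x≉0)

  square≈0 : ∀ {x} → x * x ≈ 0# → x ≈ 0#
  square≈0 xx≈0 = by-contradiction λ x≉0 → x≉0 (*≈0 xx≈0 x≉0)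

  *-pos : ∀ {x y} → 0# < x → 0# < y → 0# < x * y
  *-pos 0<x 0<y = nonneg∧≉0⇒pos (*-nonNeg (<⇒≤ 0<x) (<⇒≤ 0<y)) (*≉0 (pos⇒≉0 0<x) (pos⇒≉0 0<y))

  +-pos : ∀ {x y} → 0# < x → 0# ≤ y → 0# < x + y
  +-pos 0<x 0≤y = <-≤-trans 0<x (≤-diff 0≤y refl)

  1≉0 : ¬ (1# ≈ 0#)
  1≉0 1≈0 = 0≉1 (sym 1≈0)

  0<1 : 0# < 1#
  0<1 = nonneg∧≉0⇒pos (≤-trans (square-nonneg 1#) (≤-reflexive (*-identityˡ 1#))) 1≉0

  *-cancelˡ-nonneg : ∀ {z x} → 0# < z → 0# ≤ z * x → 0# ≤ x
  *-cancelˡ-nonneg {z} {x} 0<z 0≤zx with ≤.total 0# x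
  ... | inj₁ 0≤x = 0≤x
  ... | inj₂ x≤0 = ≤-reflexive (sym (*≈0 (≤-antisym (≤-trans (*-monoˡ-≤ (<⇒≤ 0<z) x≤0) (≤-reflexive (zeroʳ z))) 0≤zx) (pos⇒≉0 0<z)))

  *-cancelˡ-≤ : ∀ {z x y} → 0# < z → z * x ≤ z * y → x ≤ y
  *-cancelˡ-≤ {z} {x} {y} 0<z zx≤zy = ≤-diff
    (*-cancelˡ-nonneg 0<z (≤-trans (diff-nonneg zx≤zy)
      (≤-reflexive (solve 3 (λ x y z → z :* y :- z :* x := z :* (y :- x)) refl x y z))))
    (solve 2 (λ x y → y := x :+ (y :- x)) refl x y)

  ⁻¹-pos : ∀ {x} → 0# < x → 0# < x ⁻¹
  ⁻¹-pos {x} 0<x = nonneg∧≉0⇒pos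
    (*-cancelˡ-nonneg 0<x (≤-trans (<⇒≤ 0<1) (≤-reflexive (sym xx⁻¹≈1))))
    (λ x⁻¹≈0 → 1≉0 (trans (sym xx⁻¹≈1) (trans (*-congˡ x⁻¹≈0) (zeroʳ x))))
    where xx⁻¹≈1 = *-inverseʳ x (pos⇒≉0 0<x)

  ½ : ℝ
  ½ = (1# + 1#) ⁻¹

  0<2 : 0# < 1# + 1#
  0<2 = +-pos 0<1 (<⇒≤ 0<1)

  ½+½ : ∀ x → ½ * x + ½ * x ≈ x
  ½+½ x = trans (solve 3 (λ h x o → h :* x :+ h :* x := (con (+ 2) :* h) :* x) refl ½ x 1#)
    (trans (*-congʳ (*-inverseʳ (1# + 1#) (pos⇒≉0 0<2))) (*-identityˡ x))

  half-pos : ∀ {x} → 0# < x → 0# < ½ * x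
  half-pos 0<x = *-pos (⁻¹-pos 0<2) 0<x

  fromℕ-nonneg : ∀ n → 0# ≤ fromℕ n
  fromℕ-nonneg zero = ≤-refl
  fromℕ-nonneg (suc n) = +-nonneg (<⇒≤ 0<1) (fromℕ-nonneg n)

  fromℕ-suc-pos : ∀ n → 0# < fromℕ (suc n)
  fromℕ-suc-pos n = +-pos 0<1 (fromℕ-nonneg n)

  fromℕ-pos : ∀ {n} → 0 ℕ.< n → 0# < fromℕ n
  fromℕ-pos {suc n} _ = fromℕ-suc-pos n

  fromℕ-mono-≤ : ∀ {m n} → m ℕ.≤ n → fromℕ m ≤ fromℕ n
  fromℕ-mono-≤ {n = n} ℕ.z≤n = fromℕ-nonneg n
  fromℕ-mono-≤ (ℕ.s≤s m≤n) = +-monoʳ-≤ 1# (fromℕ-mono-≤ m≤n)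

  fromℕ-injective : ∀ {m n} → fromℕ m ≈ fromℕ n → m ≡ n
  fromℕ-injective {m} {n} m≈n = ℕ.≤-antisym (ℕ.≮⇒≥ λ n<m → lemma n<m m≈n) (ℕ.≮⇒≥ λ m<n → lemma m<n (sym m≈n))
    where
    lemma : ∀ {m n} → n ℕ.< m → ¬ (fromℕ m ≈ fromℕ n)
    lemma {m} {n} n<m m≈n = <⇒≱ (<-diff 0<1 (+-comm 1# (fromℕ n))) (≤-trans (fromℕ-mono-≤ n<m) (≤-reflexive m≈n))

  supremum-approx : ∀ (P : ℝ → Set) s → (∀ u → IsUpperBound P u → s ≤ u) →
                    ∀ {ε} → 0# < ε → ∃[ x ] P x × s + - ε < x
  supremum-approx P s s-least {ε} 0<ε = by-contradiction λ none →
    <⇒≱ (<-diff 0<ε (solve 2 (λ s e → s := s :- e :+ e) refl s ε))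
      (s-least (s + - ε) λ x Px → by-contradiction λ x≰ → none (x , Px , ≰⇒> x≰))

  -- Otherwise the naturals have a supremum s; some natural exceeds s - 1, and its successor exceeds
  -- s.
  archimedean : ∀ x → ∃[ n ] x ≤ fromℕ n
  archimedean x with em {∃[ n ] x ≤ fromℕ n}
  ... | yes found = found
  ... | no none   = ⊥-elim (<⇒≱ (proj₂ (proj₂ near)) n≤s-1)
    where
    P : ℝ → Set
    P y = ∃[ n ] y ≈ fromℕ n
    sup = supremum P (0# , 0 , refl) (x , λ { y (n , y≈n) → ≤-trans (≤-reflexive y≈n) (<⇒≤ (≰⇒> λ x≤n → none (n , x≤n))) })
    s = proj₁ sup
    near = supremum-approx P s (proj₂ (proj₂ sup)) 0<1
    n = proj₁ (proj₁ (proj₂ near))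
    n≤s-1 : proj₁ near ≤ s + - 1#
    n≤s-1 = begin
      proj₁ near ≈⟨ proj₂ (proj₁ (proj₂ near)) ⟩
      fromℕ n ≈⟨ solve 2 (λ o x → x := o :+ x :- o) refl 1# (fromℕ n) ⟩
      fromℕ (suc n) + - 1# ≤⟨ +-monoˡ-≤ (- 1#) (proj₁ (proj₂ sup) (fromℕ (suc n)) (suc n , refl)) ⟩
      s + - 1# ∎

  abstract
    ∣_∣ : ℝ → ℝ
    ∣ x ∣ with ≤.total 0# x
    ... | inj₁ _ = x
    ... | inj₂ _ = - x

    abs-cases : ∀ x → (0# ≤ x × ∣ x ∣ ≈ x) ⊎ (0# ≤ - x × ∣ x ∣ ≈ - x)
    abs-cases x with ≤.total 0# x
    ... | inj₁ 0≤x = inj₁ (0≤x , refl)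
    ... | inj₂ x≤0 = inj₂ (neg-nonneg x≤0 , refl)

  abs-nonneg : ∀ x → 0# ≤ ∣ x ∣
  abs-nonneg x with abs-cases x
  ... | inj₁ (0≤x , eq)  = ≤-trans 0≤x (≤-reflexive (sym eq))
  ... | inj₂ (0≤-x , eq) = ≤-trans 0≤-x (≤-reflexive (sym eq))

  x≤-x : ∀ {x} → 0# ≤ - x → x ≤ - x
  x≤-x {x} 0≤-x = ≤-diff (+-nonneg 0≤-x 0≤-x) (solve 1 (λ x → :- x := x :+ (:- x :+ :- x)) refl x)

  x≤∣x∣ : ∀ x → x ≤ ∣ x ∣
  x≤∣x∣ x with abs-cases x
  ... | inj₁ (_ , eq)    = ≤-reflexive (sym eq)
  ... | inj₂ (0≤-x , eq) = ≤-trans (x≤-x 0≤-x) (≤-reflexive (sym eq))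

  -x≤∣x∣ : ∀ x → - x ≤ ∣ x ∣
  -x≤∣x∣ x with abs-cases x
  ... | inj₁ (0≤x , eq) = ≤-trans (≤-diff (+-nonneg 0≤x 0≤x) (solve 1 (λ x → x := :- x :+ (x :+ x)) refl x)) (≤-reflexive (sym eq))
  ... | inj₂ (_ , eq)   = ≤-reflexive (sym eq)

  abs-≤ : ∀ {x r} → x ≤ r → - x ≤ r → ∣ x ∣ ≤ r
  abs-≤ {x} x≤r -x≤r with abs-cases x
  ... | inj₁ (_ , eq) = ≤-trans (≤-reflexive eq) x≤r
  ... | inj₂ (_ , eq) = ≤-trans (≤-reflexive eq) -x≤r

  abs-cong : ∀ {x y} → x ≈ y → ∣ x ∣ ≈ ∣ y ∣
  abs-cong {x} {y} x≈y = ≤-antisym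
    (abs-≤ (≤-trans (≤-reflexive x≈y) (x≤∣x∣ y)) (≤-trans (≤-reflexive (-‿cong x≈y)) (-x≤∣x∣ y)))
    (abs-≤ (≤-trans (≤-reflexive (sym x≈y)) (x≤∣x∣ x)) (≤-trans (≤-reflexive (-‿cong (sym x≈y))) (-x≤∣x∣ x)))

  abs-neg : ∀ x → ∣ - x ∣ ≈ ∣ x ∣
  abs-neg x = ≤-antisym
    (abs-≤ (-x≤∣x∣ x) (≤-trans (≤-reflexive (-‿involutive x)) (x≤∣x∣ x)))
    (abs-≤ (≤-trans (≤-reflexive (sym (-‿involutive x))) (-x≤∣x∣ (- x))) (x≤∣x∣ (- x)))

  abs-+ : ∀ x y → ∣ x + y ∣ ≤ ∣ x ∣ + ∣ y ∣
  abs-+ x y = abs-≤ (+-mono-≤ (x≤∣x∣ x) (x≤∣x∣ y))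
    (≤-trans (≤-reflexive (sym (-‿+-comm x y))) (+-mono-≤ (-x≤∣x∣ x) (-x≤∣x∣ y)))

  abs-of-nonneg : ∀ {x} → 0# ≤ x → ∣ x ∣ ≈ x
  abs-of-nonneg {x} 0≤x = ≤-antisym
    (abs-≤ ≤-refl (≤-diff (+-nonneg 0≤x 0≤x) (solve 1 (λ x → x := :- x :+ (x :+ x)) refl x))) (x≤∣x∣ x)

  abs-* : ∀ x y → ∣ x * y ∣ ≈ ∣ x ∣ * ∣ y ∣
  abs-* x y with abs-cases x | abs-cases y
  ... | inj₁ (0≤x , p) | inj₁ (0≤y , q) = trans (abs-of-nonneg (*-nonNeg 0≤x 0≤y)) (sym (*-cong p q))
  ... | inj₁ (0≤x , p) | inj₂ (0≤y , q) = trans (sym (abs-neg (x * y))) (trans (abs-cong (-‿distribʳ-* x y))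
    (trans (abs-of-nonneg (*-nonNeg 0≤x 0≤y)) (sym (*-cong p q))))
  ... | inj₂ (0≤x , p) | inj₁ (0≤y , q) = trans (sym (abs-neg (x * y))) (trans (abs-cong (-‿distribˡ-* x y))
    (trans (abs-of-nonneg (*-nonNeg 0≤x 0≤y)) (sym (*-cong p q))))
  ... | inj₂ (0≤x , p) | inj₂ (0≤y , q) = trans (abs-cong (solve 2 (λ x y → x :* y := :- x :* :- y) refl x y))
    (trans (abs-of-nonneg (*-nonNeg 0≤x 0≤y)) (sym (*-cong p q)))

  abs≈0 : ∀ {x} → ∣ x ∣ ≈ 0# → x ≈ 0#
  abs≈0 {x} ∣x∣≈0 with abs-cases x
  ... | inj₁ (_ , eq) = trans (sym eq) ∣x∣≈0
  ... | inj₂ (_ , eq) = trans (sym (-‿involutive x)) (trans (-‿cong (trans (sym eq) ∣x∣≈0)) -0#≈0#)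

  small⇒0 : ∀ {x} → (∀ ε → 0# < ε → ∣ x ∣ ≤ ε) → x ≈ 0#
  small⇒0 {x} x-small = by-contradiction λ x≉0 →
    let 0<∣x∣ = nonneg∧≉0⇒pos (abs-nonneg x) (λ ∣x∣≈0 → x≉0 (abs≈0 ∣x∣≈0))
    in <⇒≱ (<-diff (half-pos 0<∣x∣) (sym (½+½ ∣ x ∣))) (x-small _ (half-pos 0<∣x∣))

  infix 4 _⟶_
  -- Equivalent to `ConvergesTo`, strictness costing half of `ε`; a single weak inequality on an
  -- absolute value suits the triangle inequality better.
  _⟶_ : (ℕ → ℝ) → ℝ → Set
  s ⟶ l = ∀ ε → 0# < ε → ∃[ N ] (∀ m → N ℕ.≤ m → ∣ s m + - l ∣ ≤ ε)

  ⟶⇒ConvergesTo : ∀ {s l} → s ⟶ l → ConvergesTo s l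
  ⟶⇒ConvergesTo {s} {l} s⟶l ε 0<ε =
    let N , close = s⟶l (½ * ε) (half-pos 0<ε) in N , λ m N≤m →
    (begin-strict
      - ε <⟨ <-diff (half-pos 0<ε) (trans (solve 1 (λ x → :- x := :- (x :+ x) :+ x) refl (½ * ε)) (+-congʳ (-‿cong (½+½ ε)))) ⟩
      - (½ * ε) ≤⟨ neg-mono-≤ (close m N≤m) ⟩
      - ∣ s m + - l ∣ ≤⟨ neg-mono-≤ (-x≤∣x∣ (s m + - l)) ⟩
      - - (s m + - l) ≈⟨ -‿involutive _ ⟩
      s m + - l ∎) ,
    (begin-strict
      s m + - l ≤⟨ x≤∣x∣ _ ⟩
      ∣ s m + - l ∣ ≤⟨ close m N≤m ⟩
      ½ * ε <⟨ <-diff (half-pos 0<ε) (sym (½+½ ε)) ⟩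
      ε ∎)

  ConvergesTo⇒⟶ : ∀ {s l} → ConvergesTo s l → s ⟶ l
  ConvergesTo⇒⟶ {s} {l} conv ε 0<ε =
    let N , close = conv ε 0<ε in N , λ m N≤m → abs-≤ (<⇒≤ (proj₂ (close m N≤m)))
    (≤-trans (neg-mono-≤ (<⇒≤ (proj₁ (close m N≤m)))) (≤-reflexive (-‿involutive ε)))

  ⟶-cong : ∀ {s t l k} → (∀ n → s n ≈ t n) → l ≈ k → s ⟶ l → t ⟶ k
  ⟶-cong s≈t l≈k s⟶l ε 0<ε =
    let N , close = s⟶l ε 0<ε in N , λ m N≤m → ≤-trans
    (≤-reflexive (abs-cong (+-cong (sym (s≈t m)) (-‿cong (sym l≈k))))) (close m N≤m)

  ⟶-const : ∀ c → (λ _ → c) ⟶ c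
  ⟶-const c ε 0<ε = 0 , λ m _ → ≤-trans
    (≤-reflexive (trans (abs-cong (-‿inverseʳ c)) (abs-of-nonneg ≤-refl))) (<⇒≤ 0<ε)

  ⟶-+ : ∀ {s t l k} → s ⟶ l → t ⟶ k → (λ n → s n + t n) ⟶ l + k
  ⟶-+ {s} {t} {l} {k} s⟶l t⟶k ε 0<ε =
    let N , close = s⟶l (½ * ε) (half-pos 0<ε)
        N′ , close′ = t⟶k (½ * ε) (half-pos 0<ε)
    in N ℕ.⊔ N′ , λ m N≤m → begin
    ∣ s m + t m + - (l + k) ∣ ≈⟨ abs-cong (solve 4 (λ a b c d → a :+ b :- (c :+ d) := a :- c :+ (b :- d)) refl (s m) (t m) l k) ⟩
    ∣ s m + - l + (t m + - k) ∣ ≤⟨ abs-+ _ _ ⟩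
    ∣ s m + - l ∣ + ∣ t m + - k ∣ ≤⟨ +-mono-≤ (close m (ℕ.m⊔n≤o⇒m≤o N N′ N≤m)) (close′ m (ℕ.m⊔n≤o⇒n≤o N N′ N≤m)) ⟩
    ½ * ε + ½ * ε ≈⟨ ½+½ ε ⟩
    ε ∎

  ⟶-squeeze : ∀ {s l a} → (∀ n → ∣ s n + - l ∣ ≤ a n) → a ⟶ 0# → s ⟶ l
  ⟶-squeeze {s} {l} {a} bound a⟶0 ε 0<ε =
    let N , close = a⟶0 ε 0<ε in N , λ m N≤m → begin
    ∣ s m + - l ∣ ≤⟨ bound m ⟩
    a m ≤⟨ x≤∣x∣ (a m) ⟩
    ∣ a m ∣ ≈⟨ abs-cong (trans (sym (+-identityʳ _)) (+-congˡ (sym -0#≈0#))) ⟩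
    ∣ a m + - 0# ∣ ≤⟨ close m N≤m ⟩
    ε              ∎

  ⟶-*ˡ : ∀ c {s l} → s ⟶ l → (λ n → c * s n) ⟶ c * l
  ⟶-*ˡ c {s} {l} s⟶l ε 0<ε =
    -- The factor `1# + ∣ c ∣` dominates `∣ c ∣` and stays invertible when c is zero.
    let N , close = s⟶l ((1# + ∣ c ∣) ⁻¹ * ε) (*-pos (⁻¹-pos (+-pos 0<1 (abs-nonneg c))) 0<ε)
    in N , λ m N≤m → begin
    ∣ c * s m + - (c * l) ∣ ≈⟨ abs-cong (solve 3 (λ c s l → c :* s :- c :* l := c :* (s :- l)) refl c (s m) l) ⟩
    ∣ c * (s m + - l) ∣ ≈⟨ abs-* _ _ ⟩
    ∣ c ∣ * ∣ s m + - l ∣ ≤⟨ *-mono-≤ (abs-nonneg c) (≤-diff (<⇒≤ 0<1) (+-comm 1# ∣ c ∣)) (abs-nonneg _) (close m N≤m) ⟩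
    (1# + ∣ c ∣) * ((1# + ∣ c ∣) ⁻¹ * ε) ≈⟨ *-assoc _ _ _ ⟨
    (1# + ∣ c ∣) * (1# + ∣ c ∣) ⁻¹ * ε ≈⟨ *-congʳ (*-inverseʳ _ (pos⇒≉0 (+-pos 0<1 (abs-nonneg c)))) ⟩
    1# * ε ≈⟨ *-identityˡ ε ⟩
    ε ∎

  ⟶-neg : ∀ {s l} → s ⟶ l → (λ n → - s n) ⟶ - l
  ⟶-neg {s} {l} s⟶l ε 0<ε =
    let N , close = s⟶l ε 0<ε in N , λ m N≤m → ≤-trans (≤-reflexive
    (trans (abs-cong (-‿+-comm (s m) (- l))) (abs-neg (s m + - l)))) (close m N≤m)

  ⟶-null-* : ∀ {s t} → s ⟶ 0# → t ⟶ 0# → (λ n → s n * t n) ⟶ 0#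
  ⟶-null-* {s} {t} s⟶0 t⟶0 ε 0<ε =
    let N , close = s⟶0 ε 0<ε
        -- It is enough that the second factor is eventually at most 1 in absolute value.
        N′ , close′ = t⟶0 1# 0<1
    in N ℕ.⊔ N′ , λ m N≤m → begin
    ∣ s m * t m + - 0# ∣ ≈⟨ abs-cong (minus-0 (s m * t m)) ⟩
    ∣ s m * t m ∣ ≈⟨ abs-* _ _ ⟩
    ∣ s m ∣ * ∣ t m ∣ ≈⟨ *-cong (abs-cong (minus-0 (s m))) (abs-cong (minus-0 (t m))) ⟨
    ∣ s m + - 0# ∣ * ∣ t m + - 0# ∣ ≤⟨ *-mono-≤ (abs-nonneg _) (close m (ℕ.m⊔n≤o⇒m≤o N N′ N≤m)) (abs-nonneg _) (close′ m (ℕ.m⊔n≤o⇒n≤o N N′ N≤m)) ⟩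
    ε * 1# ≈⟨ *-identityʳ ε ⟩
    ε ∎
    where
    minus-0 : ∀ x → x + - 0# ≈ x
    minus-0 x = trans (+-congˡ -0#≈0#) (+-identityʳ x)

  ⟶-diff : ∀ {s l} → s ⟶ l → (λ n → s n + - l) ⟶ 0#
  ⟶-diff {s} {l} s⟶l = ⟶-cong (λ _ → refl) (-‿inverseʳ l) (⟶-+ s⟶l (⟶-const (- l)))

  ⟶-* : ∀ {s t l k} → s ⟶ l → t ⟶ k → (λ n → s n * t n) ⟶ l * k
  ⟶-* {s} {t} {l} {k} s⟶l t⟶k = ⟶-cong
    (λ n → solve 4 (λ s t l k → (s :- l) :* (t :- k) :+ (l :* (t :- k) :+ k :* (s :- l)) :+ l :* k := s :* t) refl (s n) (t n) l k)
    (trans (+-congʳ (trans (+-identityˡ _) (trans (+-cong (zeroʳ l) (zeroʳ k)) (+-identityˡ 0#)))) (+-identityˡ (l * k)))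
    (⟶-+ (⟶-+ (⟶-null-* (⟶-diff s⟶l) (⟶-diff t⟶k)) (⟶-+ (⟶-*ˡ l (⟶-diff t⟶k)) (⟶-*ˡ k (⟶-diff s⟶l)))) (⟶-const (l * k)))

  ⟶-sum : ∀ {m} (s : Fin m → ℕ → ℝ) (l : Fin m → ℝ) → (∀ i → s i ⟶ l i) → (λ n → sum (λ i → s i n)) ⟶ sum l
  ⟶-sum {zero} s l s⟶l = ⟶-const 0#
  ⟶-sum {suc m} s l s⟶l = ⟶-+ (s⟶l Fin.zero) (⟶-sum (s ∘ Fin.suc) (l ∘ Fin.suc) (s⟶l ∘ Fin.suc))

  ⟶-unique : ∀ {s l k} → s ⟶ l → s ⟶ k → l ≈ k
  ⟶-unique {s} {l} {k} s⟶l s⟶k = begin-equality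
    l                ≈⟨ solve 2 (λ l k → l := l :- k :+ k) refl l k ⟩
    l + - k + k      ≈⟨ +-congʳ (small⇒0 small) ⟩
    0# + k           ≈⟨ +-identityˡ k ⟩
    k                ∎
    where
    small : ∀ ε → 0# < ε → ∣ l + - k ∣ ≤ ε
    small ε 0<ε = let N , close = ⟶-+ (⟶-neg s⟶l) s⟶k ε 0<ε in
      ≤-trans (≤-reflexive (abs-cong (solve 3 (λ s l k → l :- k := :- s :+ s :- (:- l :+ k)) refl (s N) l k)))
        (close N ℕ.≤-refl)

  ⟶-≤ : ∀ {s l c} M → (∀ m → M ℕ.≤ m → s m ≤ c) → s ⟶ l → l ≤ c
  ⟶-≤ {s} {l} {c} M s≤c s⟶l = by-contradiction λ l≰c →
    let 0<δ = half-pos (diff-pos (≰⇒> l≰c))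
        N , close = s⟶l δ 0<δ
        m = N ℕ.⊔ M
    in <⇒≱ 0<δ (begin
      δ ≈⟨ solve 1 (λ x → x := x :+ x :- x) refl δ ⟩
      δ + δ + - δ ≈⟨ +-congʳ (½+½ (l + - c)) ⟩
      l + - c + - δ ≤⟨ +-mono-≤ (+-monoʳ-≤ l (neg-mono-≤ (s≤c m (ℕ.m≤n⊔m N M)))) (neg-mono-≤ (close m (ℕ.m≤m⊔n N M))) ⟩
      l + - s m + - ∣ s m + - l ∣ ≤⟨ +-monoʳ-≤ (l + - s m) (neg-mono-≤ (-x≤∣x∣ (s m + - l))) ⟩
      l + - s m + - - (s m + - l) ≈⟨ solve 2 (λ l s → l :- s :- :- (s :- l) := con 0ℤ) refl l (s m) ⟩
      0# ∎)
    where δ = ½ * (l + - c)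

  ⟶-subsequence : ∀ {s l} (f : ℕ → ℕ) → (∀ n → n ℕ.≤ f n) → s ⟶ l → (λ n → s (f n)) ⟶ l
  ⟶-subsequence f n≤f[n] s⟶l ε 0<ε =
    let N , close = s⟶l ε 0<ε in N , λ m N≤m → close (f m) (ℕ.≤-trans N≤m (n≤f[n] m))

  increasing⇒mono : ∀ {s : ℕ → ℝ} → (∀ n → s n ≤ s (suc n)) → ∀ {m n} → m ℕ.≤ n → s m ≤ s n
  increasing⇒mono {s} s-inc {m} m≤n = go (ℕ.≤⇒≤′ m≤n)
    where
    go : ∀ {n} → m ℕ.≤′ n → s m ≤ s n
    go ℕ.≤′-refl       = ≤-refl
    go (ℕ.≤′-step m≤n) = ≤-trans (go m≤n) (s-inc _)

  monotone-convergence : ∀ s B → (∀ n → s n ≤ s (suc n)) → (∀ n → s n ≤ B) → ∃[ l ] s ⟶ l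
  monotone-convergence s B s-inc s≤B = l , λ ε 0<ε → approx ε (supremum-approx P l (proj₂ (proj₂ sup)) 0<ε)
    where
    P : ℝ → Set
    P x = ∃[ n ] x ≈ s n
    sup = supremum P (s 0 , 0 , refl) (B , λ { x (n , x≈sn) → ≤-trans (≤-reflexive x≈sn) (s≤B n) })
    l = proj₁ sup
    approx : ∀ ε → ∃[ x ] P x × l + - ε < x → ∃[ N ] (∀ m → N ℕ.≤ m → ∣ s m + - l ∣ ≤ ε)
    approx ε (x , (N , x≈sN) , l-ε<x) = N , λ m N≤m → abs-≤
      (begin
        s m + - l   ≤⟨ +-monoˡ-≤ (- l) (proj₁ (proj₂ sup) (s m) (m , refl)) ⟩
        l + - l     ≈⟨ trans (-‿inverseʳ l) (sym (-‿inverseʳ ε)) ⟩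
        ε + - ε     ≤⟨ +-monoʳ-≤ ε (neg-mono-≤ (0≤ε)) ⟩
        ε + - 0#    ≈⟨ trans (+-congˡ -0#≈0#) (+-identityʳ ε) ⟩
        ε           ∎)
      (begin
        - (s m + - l)          ≤⟨ neg-mono-≤ (+-monoˡ-≤ (- l) (≤-trans (<⇒≤ l-ε<x) (≤-trans (≤-reflexive x≈sN) (increasing⇒mono s-inc N≤m)))) ⟩
        - (l + - ε + - l)      ≈⟨ solve 2 (λ l e → :- (l :- e :- l) := e) refl l ε ⟩
        ε                      ∎)
      where
      0≤ε : 0# ≤ ε
      0≤ε = ≤-trans (diff-nonneg (≤-trans (<⇒≤ l-ε<x) (proj₁ (proj₂ sup) x (N , x≈sN))))
        (≤-reflexive (solve 2 (λ l e → l :- (l :- e) := e) refl l ε))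

  sum-nonneg : ∀ {n} (f : Fin n → ℝ) → (∀ i → 0# ≤ f i) → 0# ≤ sum f
  sum-nonneg {zero} f 0≤f = ≤-refl
  sum-nonneg {suc n}  f 0≤f = +-nonneg (0≤f Fin.zero) (sum-nonneg (f ∘ Fin.suc) (0≤f ∘ Fin.suc))

  partialSum-mono : ∀ {f g} → (∀ n → f n ≤ g n) → ∀ N → partialSum f N ≤ partialSum g N
  partialSum-mono f≤g zero  = ≤-refl
  partialSum-mono f≤g (suc N) = +-mono-≤ (f≤g 0) (partialSum-mono (f≤g ∘ suc) N)

  partialSum-increasing : ∀ f → (∀ n → 0# ≤ f n) → ∀ N → partialSum f N ≤ partialSum f (suc N)
  partialSum-increasing f 0≤f N = ≤-diff (0≤f N) (partialSum-suc f N)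

  -- Both f + a and a have nonnegative terms and bounded partial sums, so their series converge by
  -- monotonicity; f is the difference.
  dominated-convergence : ∀ f a B → (∀ n → ∣ f n ∣ ≤ a n) → (∀ N → partialSum a N ≤ B) → ∃[ l ] partialSum f ⟶ l
  dominated-convergence f a B ∣f∣≤a a≤B = proj₁ l₁ + - proj₁ l₂ ,
    ⟶-cong (λ N → trans (+-congʳ (partialSum-+ N)) (solve 2 (λ x y → x :+ y :- y := x) refl (partialSum f N) (partialSum a N))) refl
      (⟶-+ (proj₂ l₁) (⟶-neg (proj₂ l₂)))
    where
    partialSum-+ : ∀ N → partialSum (λ n → f n + a n) N ≈ partialSum f N + partialSum a N
    partialSum-+ N = ∑-distrib-+ {N} (f ∘ toℕ) (a ∘ toℕ)
    0≤a : ∀ n → 0# ≤ a n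
    0≤a n = ≤-trans (abs-nonneg (f n)) (∣f∣≤a n)
    l₁ = monotone-convergence (partialSum (λ n → f n + a n)) (B + B)
      (partialSum-increasing _ (λ n → ≤-trans (diff-nonneg (≤-trans (-x≤∣x∣ (f n)) (∣f∣≤a n)))
        (≤-reflexive (solve 2 (λ f a → a :- :- f := f :+ a) refl (f n) (a n)))))
      (λ N → ≤-trans (≤-reflexive (partialSum-+ N))
        (+-mono-≤ (≤-trans (partialSum-mono (λ n → ≤-trans (x≤∣x∣ (f n)) (∣f∣≤a n)) N) (a≤B N)) (a≤B N)))
    l₂ = monotone-convergence (partialSum a) B (partialSum-increasing a 0≤a) a≤B

-- The complex numbers as a commutative ring.

module ComplexRing (R : CompleteOrderedField) where
  open CompleteOrderedField R hiding (zero)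
  open Complex R using (ℂ; ℂ-rawRing; re; im; ofℝ)
  open RingLinearAlgebra commutativeRing using (sum)
  open IntegerCoefficients commutativeRing using (module Solver)
  open Solver using (solve; _:=_; _:+_; _:*_; :-_; _:-_; con)

  ℂ-commutativeRing : CommutativeRing 0ℓ 0ℓ
  ℂ-commutativeRing = record
    { RawRing ℂ-rawRing
    ; isCommutativeRing = record
      { isRing = record
        { +-isAbelianGroup = AbelianGroup.isAbelianGroup (DirectProduct.abelianGroup +-abelianGroup +-abelianGroup)
        ; *-cong = λ (p , q) (p′ , q′) →
            +-cong (*-cong p p′) (-‿cong (*-cong q q′)) , +-cong (*-cong p q′) (*-cong q p′)
        ; *-assoc = λ (a , b) (c , d) (e , f) →
            solve 6 (λ a b c d e f → (a :* c :- b :* d) :* e :- (a :* d :+ b :* c) :* f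
                                  := a :* (c :* e :- d :* f) :- b :* (c :* f :+ d :* e)) refl a b c d e f ,
            solve 6 (λ a b c d e f → (a :* c :- b :* d) :* f :+ (a :* d :+ b :* c) :* e
                                  := a :* (c :* f :+ d :* e) :+ b :* (c :* e :- d :* f)) refl a b c d e f
        ; *-identity =
            (λ (a , b) → solve 2 (λ a b → con 1ℤ :* a :- con 0ℤ :* b := a) refl a b ,
                         solve 2 (λ a b → con 1ℤ :* b :+ con 0ℤ :* a := b) refl a b) ,
            (λ (a , b) → solve 2 (λ a b → a :* con 1ℤ :- b :* con 0ℤ := a) refl a b ,
                         solve 2 (λ a b → a :* con 0ℤ :+ b :* con 1ℤ := b) refl a b)
        ; distrib =
            (λ (a , b) (c , d) (e , f) →
              solve 6 (λ a b c d e f → a :* (c :+ e) :- b :* (d :+ f)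
                                    := a :* c :- b :* d :+ (a :* e :- b :* f)) refl a b c d e f ,
              solve 6 (λ a b c d e f → a :* (d :+ f) :+ b :* (c :+ e)
                                    := a :* d :+ b :* c :+ (a :* f :+ b :* e)) refl a b c d e f) ,
            (λ (a , b) (c , d) (e , f) →
              solve 6 (λ a b c d e f → (c :+ e) :* a :- (d :+ f) :* b
                                    := c :* a :- d :* b :+ (e :* a :- f :* b)) refl a b c d e f ,
              solve 6 (λ a b c d e f → (c :+ e) :* b :+ (d :+ f) :* a
                                    := c :* b :+ d :* a :+ (e :* b :+ f :* a)) refl a b c d e f)
        }
      ; *-comm = λ (a , b) (c , d) →
          solve 4 (λ a b c d → a :* c :- b :* d := c :* a :- d :* b) refl a b c d ,
          solve 4 (λ a b c d → a :* d :+ b :* c := c :* b :+ d :* a) refl a b c d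
      }
    }

  private
    module ℂ = CommutativeRing ℂ-commutativeRing
    module ℂᴿ = RingLinearAlgebra ℂ-commutativeRing

  sum-components : ∀ {n} (f : Fin n → ℂ) → ℂᴿ.sum f ℂ.≈ (sum (re ∘ f) , sum (im ∘ f))
  sum-components {zero}  f = refl , refl
  sum-components {suc n} f = ℂ.+-congˡ {x = f Fin.zero} (sum-components (f ∘ Fin.suc))

  ofℝ-* : ∀ x y → ofℝ x ℂ.* ofℝ y ℂ.≈ ofℝ (x * y)
  ofℝ-* x y = solve 2 (λ x y → x :* y :- con 0ℤ :* con 0ℤ := x :* y) refl x y ,
              solve 2 (λ x y → x :* con 0ℤ :+ con 0ℤ :* y := con 0ℤ) refl x y

  ofℝ-+ : ∀ x y → ofℝ x ℂ.+ ofℝ y ℂ.≈ ofℝ (x + y)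
  ofℝ-+ x y = refl , +-identityˡ 0#

-- Convergence of the exponential series and the addition formulas for cosine and sine.

module Exponential (em : ExcludedMiddle 0ℓ) (R : CompleteOrderedField) where
  open OrderedField em R
  open Complex R using (ℂ; re; im; ofℝ)
  open ComplexRing R
  open CauchyProduct commutativeRing hiding (partialSum; partialSum-suc)
  open PartialOrderReasoning poset
  private
    module ℂ = CommutativeRing ℂ-commutativeRing
    module ℂˢ = CauchyProduct ℂ-commutativeRing
    module ℂ× = Mult ℂ.semiring

  inv : ℕ → ℝ
  inv n = fromℕ (suc n) ⁻¹

  inv-inverse : ∀ n → fromℕ (suc n) * inv n ≈ 1#
  inv-inverse n = *-inverseʳ (fromℕ (suc n)) (pos⇒≉0 (fromℕ-suc-pos n))

  inv-pos : ∀ n → 0# < inv n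
  inv-pos n = ⁻¹-pos (fromℕ-suc-pos n)

  ofℝ-fromℕ : ∀ n → n ℂ×.× ℂ.1# ℂ.≈ ofℝ (fromℕ n)
  ofℝ-fromℕ zero = refl , refl
  ofℝ-fromℕ (suc n) = ℂ.trans (ℂ.+-congˡ {x = ℂ.1#} (ofℝ-fromℕ n)) (ofℝ-+ 1# (fromℕ n))

  ofℝ-cong : ∀ {x y} → x ≈ y → ofℝ x ℂ.≈ ofℝ y
  ofℝ-cong x≈y = x≈y , refl

  open ExponentialTerms inv inv-inverse

  module ℂᴱ = ℂˢ.ExponentialTerms (λ n → ofℝ (inv n))
    (λ n → ℂ.trans (ℂ.*-congʳ {ofℝ (inv n)} (ofℝ-fromℕ (suc n))) (ℂ.trans (ofℝ-* (fromℕ (suc n)) (inv n)) (ofℝ-cong (inv-inverse n))))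

  -- The sum norm is submultiplicative and equals x on nonnegative reals x, which is all that
  -- majorisation by a real series asks for; it avoids square roots.
  ‖_‖ : ℂ → ℝ
  ‖ z ‖ = ∣ re z ∣ + ∣ im z ∣

  norm-nonneg : ∀ z → 0# ≤ ‖ z ‖
  norm-nonneg z = +-nonneg (abs-nonneg (re z)) (abs-nonneg (im z))

  norm-cong : ∀ {z w} → z ℂ.≈ w → ‖ z ‖ ≈ ‖ w ‖
  norm-cong (p , q) = +-cong (abs-cong p) (abs-cong q)

  norm-+ : ∀ z w → ‖ z ℂ.+ w ‖ ≤ ‖ z ‖ + ‖ w ‖
  norm-+ (a , b) (c , d) = begin
    ∣ a + c ∣ + ∣ b + d ∣ ≤⟨ +-mono-≤ (abs-+ a c) (abs-+ b d) ⟩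
    ∣ a ∣ + ∣ c ∣ + (∣ b ∣ + ∣ d ∣) ≈⟨ solve 4 (λ a b c d → a :+ c :+ (b :+ d) := a :+ b :+ (c :+ d)) refl (∣ a ∣) (∣ b ∣) (∣ c ∣) (∣ d ∣) ⟩
    ∣ a ∣ + ∣ b ∣ + (∣ c ∣ + ∣ d ∣) ∎

  norm-* : ∀ z w → ‖ z ℂ.* w ‖ ≤ ‖ z ‖ * ‖ w ‖
  norm-* (a , b) (c , d) = begin
    ∣ a * c + - (b * d) ∣ + ∣ a * d + b * c ∣
      ≤⟨ +-mono-≤ (abs-+ (a * c) (- (b * d))) (abs-+ (a * d) (b * c)) ⟩
    ∣ a * c ∣ + ∣ - (b * d) ∣ + (∣ a * d ∣ + ∣ b * c ∣)
      ≈⟨ +-cong (+-cong (abs-* a c) (trans (abs-neg (b * d)) (abs-* b d))) (+-cong (abs-* a d) (abs-* b c)) ⟩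
    ∣ a ∣ * ∣ c ∣ + ∣ b ∣ * ∣ d ∣ + (∣ a ∣ * ∣ d ∣ + ∣ b ∣ * ∣ c ∣)
      ≈⟨ solve 4 (λ a b c d → a :* c :+ b :* d :+ (a :* d :+ b :* c) := (a :+ b) :* (c :+ d)) refl (∣ a ∣) (∣ b ∣) (∣ c ∣) (∣ d ∣) ⟩
    (∣ a ∣ + ∣ b ∣) * (∣ c ∣ + ∣ d ∣) ∎

  norm-ofℝ : ∀ {x} → 0# ≤ x → ‖ ofℝ x ‖ ≈ x
  norm-ofℝ 0≤x = trans (+-cong (abs-of-nonneg 0≤x) (abs-of-nonneg ≤-refl)) (+-identityʳ _)

  re≤norm : ∀ z → ∣ re z ∣ ≤ ‖ z ‖
  re≤norm z = ≤-diff (abs-nonneg (im z)) refl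

  im≤norm : ∀ z → ∣ im z ∣ ≤ ‖ z ‖
  im≤norm z = ≤-diff (abs-nonneg (re z)) (+-comm _ _)

  term-nonneg : ∀ {x} → 0# ≤ x → ∀ n → 0# ≤ term x n
  term-nonneg 0≤x zero = <⇒≤ 0<1
  term-nonneg 0≤x (suc n) = *-nonNeg (<⇒≤ (inv-pos n)) (*-nonNeg 0≤x (term-nonneg 0≤x n))

  norm-term : ∀ {z x} → ‖ z ‖ ≤ x → ∀ n → ‖ ℂᴱ.term z n ‖ ≤ term x n
  norm-term ‖z‖≤x zero = ≤-reflexive (norm-ofℝ (<⇒≤ 0<1))
  norm-term {z} {x} ‖z‖≤x (suc n) = begin
    ‖ ofℝ (inv n) ℂ.* (z ℂ.* ℂᴱ.term z n) ‖ ≤⟨ norm-* (ofℝ (inv n)) (z ℂ.* ℂᴱ.term z n) ⟩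
    ‖ ofℝ (inv n) ‖ * ‖ z ℂ.* ℂᴱ.term z n ‖ ≤⟨ *-monoˡ-≤ (norm-nonneg (ofℝ (inv n))) (norm-* z (ℂᴱ.term z n)) ⟩
    ‖ ofℝ (inv n) ‖ * (‖ z ‖ * ‖ ℂᴱ.term z n ‖) ≈⟨ *-congʳ (norm-ofℝ (<⇒≤ (inv-pos n))) ⟩
    inv n * (‖ z ‖ * ‖ ℂᴱ.term z n ‖) ≤⟨ *-monoˡ-≤ (<⇒≤ (inv-pos n)) (*-mono-≤ (norm-nonneg z) ‖z‖≤x (norm-nonneg (ℂᴱ.term z n)) (norm-term ‖z‖≤x n)) ⟩
    inv n * (x * term x n) ∎

  norm-tail : ∀ {f : ℕ → ℂ} {f̂ : ℕ → ℝ} → (∀ n → ‖ f n ‖ ≤ f̂ n) → ∀ {N M} → N ℕ.≤ M →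
              ‖ ℂˢ.partialSum f M ℂ.+ ℂ.- ℂˢ.partialSum f N ‖ ≤ partialSum f̂ M + - partialSum f̂ N
  norm-tail {f} {f̂} f≤f̂ {N} N≤M = go (ℕ.≤⇒≤′ N≤M)
    where
    go : ∀ {M} → N ℕ.≤′ M → ‖ ℂˢ.partialSum f M ℂ.+ ℂ.- ℂˢ.partialSum f N ‖ ≤ partialSum f̂ M + - partialSum f̂ N
    go ℕ.≤′-refl = ≤-reflexive (trans (norm-cong (ℂ.-‿inverseʳ (ℂˢ.partialSum f N)))
      (trans (norm-ofℝ ≤-refl) (sym (-‿inverseʳ (partialSum f̂ N)))))
    go {suc M} (ℕ.≤′-step N≤M) = begin
      ‖ ℂˢ.partialSum f (suc M) ℂ.+ ℂ.- ℂˢ.partialSum f N ‖ ≈⟨ norm-cong (ℂˢ.partialSum-tail f M N) ⟩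
      ‖ f M ℂ.+ (ℂˢ.partialSum f M ℂ.+ ℂ.- ℂˢ.partialSum f N) ‖ ≤⟨ norm-+ (f M) (ℂˢ.partialSum f M ℂ.+ ℂ.- ℂˢ.partialSum f N) ⟩
      ‖ f M ‖ + ‖ ℂˢ.partialSum f M ℂ.+ ℂ.- ℂˢ.partialSum f N ‖ ≤⟨ +-mono-≤ (f≤f̂ M) (go N≤M) ⟩
      f̂ M + (partialSum f̂ M + - partialSum f̂ N) ≈⟨ partialSum-tail f̂ M N ⟨
      partialSum f̂ (suc M) + - partialSum f̂ N ∎

  -- The defect is the sum of f i * g j over i < N, j < M, i + j ≥ N, and the right-hand side is the
  -- same sum for the majorants.
  norm-defect : ∀ f g f̂ ĝ → (∀ n → ‖ f n ‖ ≤ f̂ n) → (∀ n → ‖ g n ‖ ≤ ĝ n) → ∀ N M → N ℕ.≤ M →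
                ‖ ℂˢ.partialSum f N ℂ.* ℂˢ.partialSum g M ℂ.+ ℂ.- ℂˢ.triangle f g N ‖ ≤
                partialSum f̂ N * partialSum ĝ M + - triangle f̂ ĝ N
  norm-defect f g f̂ ĝ f≤f̂ g≤ĝ zero M N≤M = ≤-reflexive
    (trans (norm-cong {ℂ.0# ℂ.* G ℂ.+ ℂ.- ℂ.0#} {ℂ.0#} (ℂ.trans (ℂ.+-congʳ {ℂ.- ℂ.0#} (ℂ.zeroˡ G)) (ℂ.-‿inverseʳ ℂ.0#)))
      (trans (norm-ofℝ ≤-refl) (sym (trans (+-congʳ (zeroˡ (partialSum ĝ M))) (-‿inverseʳ 0#)))))
    where G = ℂˢ.partialSum g M
  norm-defect f g f̂ ĝ f≤f̂ g≤ĝ (suc N) M N<M = begin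
    ‖ ℂˢ.partialSum f (suc N) ℂ.* G ℂ.+ ℂ.- ℂˢ.triangle f g (suc N) ‖ ≈⟨ norm-cong (ℂˢ.defect-step f g N G) ⟩
    ‖ f 0 ℂ.* δ ℂ.+ rest ‖ ≤⟨ norm-+ (f 0 ℂ.* δ) rest ⟩
    ‖ f 0 ℂ.* δ ‖ + ‖ rest ‖ ≤⟨ +-mono-≤ (norm-* (f 0) δ) (norm-defect (f ∘ suc) g (f̂ ∘ suc) ĝ (f≤f̂ ∘ suc) g≤ĝ N M (ℕ.<⇒≤ N<M)) ⟩
    ‖ f 0 ‖ * ‖ δ ‖ + (partialSum (f̂ ∘ suc) N * Ĝ + - triangle (f̂ ∘ suc) ĝ N)
      ≤⟨ +-mono-≤ (*-mono-≤ (norm-nonneg (f 0)) (f≤f̂ 0) (norm-nonneg δ) (norm-tail g≤ĝ N<M)) ≤-refl ⟩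
    f̂ 0 * (Ĝ + - partialSum ĝ (suc N)) + (partialSum (f̂ ∘ suc) N * Ĝ + - triangle (f̂ ∘ suc) ĝ N)
      ≈⟨ defect-step f̂ ĝ N Ĝ ⟨
    partialSum f̂ (suc N) * Ĝ + - triangle f̂ ĝ (suc N) ∎
    where
    G = ℂˢ.partialSum g M
    Ĝ = partialSum ĝ M
    δ = G ℂ.+ ℂ.- ℂˢ.partialSum g (suc N)
    rest = ℂˢ.partialSum (f ∘ suc) N ℂ.* G ℂ.+ ℂ.- ℂˢ.triangle (f ∘ suc) g N

  triangle-nonneg : ∀ f g → (∀ n → 0# ≤ f n) → (∀ n → 0# ≤ g n) → ∀ N → 0# ≤ triangle f g N
  triangle-nonneg f g 0≤f 0≤g zero = ≤-refl
  triangle-nonneg f g 0≤f 0≤g (suc N) =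
    +-nonneg (*-nonNeg (0≤f 0) (sum-nonneg {suc N} (g ∘ toℕ) (0≤g ∘ toℕ))) (triangle-nonneg (f ∘ suc) g (0≤f ∘ suc) 0≤g N)

  -- From i < N and j < M follows i + j < N + M, and all terms are nonnegative.
  square≤triangle : ∀ f g → (∀ n → 0# ≤ f n) → (∀ n → 0# ≤ g n) → ∀ N M →
                    partialSum f N * partialSum g M ≤ triangle f g (N ℕ.+ M)
  square≤triangle f g 0≤f 0≤g zero M = ≤-trans (≤-reflexive (zeroˡ _)) (triangle-nonneg f g 0≤f 0≤g M)
  square≤triangle f g 0≤f 0≤g (suc N) M = ≤-trans (≤-reflexive (distribʳ _ _ _))
    (+-mono-≤ (*-monoˡ-≤ (0≤f 0) (increasing⇒mono (partialSum-increasing g 0≤g) (ℕ.≤-trans (ℕ.m≤n+m M N) (ℕ.n≤1+n _))))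
      (square≤triangle (f ∘ suc) g (0≤f ∘ suc) 0≤g N M))

  -- From the index J on, consecutive terms at least halve, so expSum + 2 term no longer increases.
  expSum-tail : ∀ x J → 0# ≤ x → x + x ≤ fromℕ (suc J) → ∀ k →
                expSum x (k ℕ.+ J) + (term x (k ℕ.+ J) + term x (k ℕ.+ J)) ≤ expSum x J + (term x J + term x J)
  expSum-tail x J 0≤x 2x≤J zero = ≤-refl
  expSum-tail x J 0≤x 2x≤J (suc k) = ≤-trans (begin
    expSum x (suc N) + (inv N * (x * t) + inv N * (x * t)) ≈⟨ +-cong (partialSum-suc (term x) N) (solve 3 (λ i x t → i :* (x :* t) :+ i :* (x :* t) := (i :* t) :* (x :+ x)) refl (inv N) x t) ⟩
    expSum x N + t + inv N * t * (x + x) ≤⟨ +-monoʳ-≤ _ (*-monoˡ-≤ (*-nonNeg (<⇒≤ (inv-pos N)) (term-nonneg 0≤x N)) (≤-trans 2x≤J (fromℕ-mono-≤ (ℕ.s≤s (ℕ.m≤n+m J k))))) ⟩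
    expSum x N + t + inv N * t * fromℕ (suc N) ≈⟨ +-congˡ (solve 3 (λ i t f → i :* t :* f := f :* i :* t) refl (inv N) t (fromℕ (suc N))) ⟩
    expSum x N + t + fromℕ (suc N) * inv N * t ≈⟨ +-congˡ (trans (*-congʳ (inv-inverse N)) (*-identityˡ t)) ⟩
    expSum x N + t + t ≈⟨ +-assoc _ _ _ ⟩
    expSum x N + (t + t) ∎) (expSum-tail x J 0≤x 2x≤J k)
    where
    N = k ℕ.+ J
    t = term x N

  expSum-bounded : ∀ {x} → 0# ≤ x → ∃[ B ] (∀ N → expSum x N ≤ B)
  expSum-bounded {x} 0≤x = expSum x J + (term x J + term x J) , λ N → begin
    expSum x N ≤⟨ increasing⇒mono (partialSum-increasing (term x) (term-nonneg 0≤x)) (ℕ.m≤m+n N J) ⟩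
    expSum x (N ℕ.+ J) ≤⟨ ≤-diff (+-nonneg (term-nonneg 0≤x (N ℕ.+ J)) (term-nonneg 0≤x (N ℕ.+ J))) refl ⟩
    expSum x (N ℕ.+ J) + (term x (N ℕ.+ J) + term x (N ℕ.+ J)) ≤⟨ expSum-tail x J 0≤x (≤-trans 2x≤J (fromℕ-mono-≤ (ℕ.n≤1+n J))) N ⟩
    expSum x J + (term x J + term x J) ∎
    where
    J = proj₁ (archimedean (x + x))
    2x≤J = proj₂ (archimedean (x + x))

  expSum-converges : ∀ {x} → 0# ≤ x → ∃[ l ] expSum x ⟶ l
  expSum-converges {x} 0≤x = monotone-convergence (expSum x) (proj₁ bounded)
    (partialSum-increasing (term x) (term-nonneg 0≤x)) (proj₂ bounded)
    where bounded = expSum-bounded 0≤x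

  -i : ℝ → ℂ
  -i t = 0# , - t

  norm--i : ∀ t → ‖ -i t ‖ ≤ ∣ t ∣
  norm--i t = ≤-reflexive (trans (+-cong (abs-of-nonneg ≤-refl) (abs-neg t)) (+-identityˡ _))

  cosSum sinSum : ℝ → ℕ → ℝ
  cosSum t N = re (ℂᴱ.expSum (-i t) N)
  sinSum t N = im (ℂᴱ.expSum (-i t) N)

  private
    converges : (part : ℂ → ℝ) → (∀ z → ∣ part z ∣ ≤ ‖ z ‖) →
                (∀ f N → part (ℂˢ.partialSum f N) ≈ partialSum (part ∘ f) N) →
                ∀ t → ∃[ l ] (λ N → part (ℂᴱ.expSum (-i t) N)) ⟶ l
    converges part part≤norm part-sum t =
      let B , bound = expSum-bounded (abs-nonneg t)
          l , lim = dominated-convergence (part ∘ ℂᴱ.term (-i t)) (term ∣ t ∣) B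
            (λ n → ≤-trans (part≤norm (ℂᴱ.term (-i t) n)) (norm-term (norm--i t) n)) bound
      in l , ⟶-cong (λ N → sym (part-sum (ℂᴱ.term (-i t)) N)) refl lim

  abstract
    -- With the sign convention e^(-it) = cosine t + i sine t, so sine t is minus the usual sine.
    cosine sine : ℝ → ℝ
    cosine t = proj₁ (converges re re≤norm (λ f N → proj₁ (sum-components {N} (f ∘ toℕ))) t)
    sine t = proj₁ (converges im im≤norm (λ f N → proj₂ (sum-components {N} (f ∘ toℕ))) t)

    cosSum⟶cosine : ∀ t → cosSum t ⟶ cosine t
    cosSum⟶cosine t = proj₂ (converges re re≤norm (λ f N → proj₁ (sum-components {N} (f ∘ toℕ))) t)

    sinSum⟶sine : ∀ t → sinSum t ⟶ sine t
    sinSum⟶sine t = proj₂ (converges im im≤norm (λ f N → proj₂ (sum-components {N} (f ∘ toℕ))) t)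

  expSumℂ-cong : ∀ {z w} → z ℂ.≈ w → ∀ N → ℂᴱ.expSum z N ℂ.≈ ℂᴱ.expSum w N
  expSumℂ-cong {z} {w} z≈w N = ℂˢ.partialSum-cong {ℂᴱ.term z} {ℂᴱ.term w} (ℂᴱ.term-cong z≈w) N

  cosine-cong : ∀ {s t} → s ≈ t → cosine s ≈ cosine t
  cosine-cong {s} {t} s≈t = ⟶-unique (cosSum⟶cosine s)
    (⟶-cong (λ N → proj₁ (expSumℂ-cong { -i t} { -i s} (refl , -‿cong (sym s≈t)) N)) refl (cosSum⟶cosine t))

  sine-cong : ∀ {s t} → s ≈ t → sine s ≈ sine t
  sine-cong {s} {t} s≈t = ⟶-unique (sinSum⟶sine s)
    (⟶-cong (λ N → proj₂ (expSumℂ-cong { -i t} { -i s} (refl , -‿cong (sym s≈t)) N)) refl (sinSum⟶sine t))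

  module _ (s t : ℝ) where
    private
      x = ∣ s ∣
      y = ∣ t ∣
      0≤x = abs-nonneg s
      0≤y = abs-nonneg t
      0≤x+y = +-nonneg 0≤x 0≤y

      defect : ℕ → ℂ
      defect N = ℂᴱ.expSum (-i s) N ℂ.* ℂᴱ.expSum (-i t) N ℂ.+ ℂ.- ℂᴱ.expSum (-i (s + t)) N

      bound : ℕ → ℝ
      bound N = expSum (x + y) (N ℕ.+ N) + - expSum (x + y) N

      -i-+ : -i s ℂ.+ -i t ℂ.≈ -i (s + t)
      -i-+ = +-identityˡ 0# , -‿+-comm s t

      -- The complex defect is at most the real one; there the product of partial sums is at most
      -- the triangle of side 2N, and triangles are exactly partial sums for x + y. What remains is
      -- a Cauchy difference of a convergent series.
      defect-bound : ∀ N → ‖ defect N ‖ ≤ bound N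
      defect-bound N = begin
        ‖ defect N ‖
          ≈⟨ norm-cong (ℂ.+-congˡ {ℂᴱ.expSum (-i s) N ℂ.* ℂᴱ.expSum (-i t) N} (ℂ.-‿cong
               (ℂ.trans (ℂ.sym (expSumℂ-cong -i-+ N)) (ℂᴱ.expSum-+ (-i s) (-i t) N)))) ⟩
        ‖ ℂᴱ.expSum (-i s) N ℂ.* ℂᴱ.expSum (-i t) N ℂ.+ ℂ.- ℂˢ.triangle (ℂᴱ.term (-i s)) (ℂᴱ.term (-i t)) N ‖
          ≤⟨ norm-defect (ℂᴱ.term (-i s)) (ℂᴱ.term (-i t)) (term x) (term y) (norm-term (norm--i s)) (norm-term (norm--i t)) N N ℕ.≤-refl ⟩
        expSum x N * expSum y N + - triangle (term x) (term y) N
          ≤⟨ +-mono-≤ (square≤triangle (term x) (term y) (term-nonneg 0≤x) (term-nonneg 0≤y) N N) ≤-refl ⟩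
        triangle (term x) (term y) (N ℕ.+ N) + - triangle (term x) (term y) N
          ≈⟨ +-cong (expSum-+ x y (N ℕ.+ N)) (-‿cong (expSum-+ x y N)) ⟨
        bound N ∎

      bound⟶0 : bound ⟶ 0#
      bound⟶0 =
        let l , lim = expSum-converges 0≤x+y
        in ⟶-cong (λ _ → refl) (-‿inverseʳ l)
             (⟶-+ (⟶-subsequence (λ N → N ℕ.+ N) (λ N → ℕ.m≤m+n N N) lim) (⟶-neg lim))

      defect⟶0 : (part : ℂ → ℝ) → (∀ z → ∣ part z ∣ ≤ ‖ z ‖) → (λ N → part (defect N)) ⟶ 0#
      defect⟶0 part part≤norm = ⟶-squeeze (λ N → ≤-trans
        (≤-reflexive (abs-cong (trans (+-congˡ -0#≈0#) (+-identityʳ _)))) (≤-trans (part≤norm (defect N)) (defect-bound N))) bound⟶0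

    cosine-+ : cosine (s + t) ≈ cosine s * cosine t + - (sine s * sine t)
    cosine-+ = ⟶-unique (cosSum⟶cosine (s + t)) (⟶-cong
      (λ N → solve 3 (λ a b c → a :- b :- (a :- b :- c) := c) refl
        (cosSum s N * cosSum t N) (sinSum s N * sinSum t N) (cosSum (s + t) N))
      (trans (+-congˡ -0#≈0#) (+-identityʳ _))
      (⟶-+ (⟶-+ (⟶-* (cosSum⟶cosine s) (cosSum⟶cosine t)) (⟶-neg (⟶-* (sinSum⟶sine s) (sinSum⟶sine t))))
            (⟶-neg (defect⟶0 re re≤norm))))

    sine-+ : sine (s + t) ≈ cosine s * sine t + sine s * cosine t
    sine-+ = ⟶-unique (sinSum⟶sine (s + t)) (⟶-cong
      (λ N → solve 3 (λ a b c → a :+ b :- (a :+ b :- c) := c) refl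
        (cosSum s N * sinSum t N) (sinSum s N * cosSum t N) (sinSum (s + t) N))
      (trans (+-congˡ -0#≈0#) (+-identityʳ _))
      (⟶-+ (⟶-+ (⟶-* (cosSum⟶cosine s) (sinSum⟶sine t)) (⟶-* (sinSum⟶sine s) (cosSum⟶cosine t)))
            (⟶-neg (defect⟶0 im im≤norm))))

  private
    conj : ℂ → ℂ
    conj (a , b) = a , - b

    conj-* : ∀ z w → conj z ℂ.* conj w ℂ.≈ conj (z ℂ.* w)
    conj-* (a , b) (c , d) =
      solve 4 (λ a b c d → a :* c :- :- b :* :- d := a :* c :- b :* d) refl a b c d ,
      solve 4 (λ a b c d → a :* :- d :+ :- b :* c := :- (a :* d :+ b :* c)) refl a b c d

    conj-term : ∀ z n → ℂᴱ.term (conj z) n ℂ.≈ conj (ℂᴱ.term z n)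
    conj-term z zero = refl , sym -0#≈0#
    conj-term z (suc n) = ℂ.trans
      (ℂ.*-cong {ofℝ (inv n)} {conj (ofℝ (inv n))} (refl , sym -0#≈0#)
        (ℂ.trans (ℂ.*-congˡ {conj z} (conj-term z n)) (conj-* z (ℂᴱ.term z n))))
      (conj-* (ofℝ (inv n)) (z ℂ.* ℂᴱ.term z n))

    conj-partialSum : ∀ f N → ℂˢ.partialSum (conj ∘ f) N ℂ.≈ conj (ℂˢ.partialSum f N)
    conj-partialSum f zero = refl , sym -0#≈0#
    conj-partialSum f (suc N) = ℂ.trans (ℂ.+-congˡ {conj (f 0)} (conj-partialSum (f ∘ suc) N))
      (refl , -‿+-comm (im (f 0)) (im (ℂˢ.partialSum (f ∘ suc) N)))

    expSum-conj : ∀ t N → ℂᴱ.expSum (-i (- t)) N ℂ.≈ conj (ℂᴱ.expSum (-i t) N)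
    expSum-conj t N = ℂ.trans (ℂˢ.partialSum-cong {ℂᴱ.term (-i (- t))} (conj-term (-i t)) N) (conj-partialSum (ℂᴱ.term (-i t)) N)

  cosine-neg : ∀ t → cosine (- t) ≈ cosine t
  cosine-neg t = ⟶-unique (cosSum⟶cosine (- t)) (⟶-cong (λ N → sym (proj₁ (expSum-conj t N))) refl (cosSum⟶cosine t))

  sine-neg : ∀ t → sine (- t) ≈ - sine t
  sine-neg t = ⟶-unique (sinSum⟶sine (- t)) (⟶-cong (λ N → sym (proj₂ (expSum-conj t N))) refl (⟶-neg (sinSum⟶sine t)))

  -- From e^t - 1 - t ≤ t² on [0 , 1]; it leaves no zero of the sine in (0 , 1).
  sine-near : ∀ {t} → 0# ≤ t → t ≤ 1# → sine t + t ≤ t * t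
  sine-near {t} 0≤t t≤1 = ⟶-≤ 2 tail-bound (⟶-+ (sinSum⟶sine t) (⟶-const t))
    where
    norm-i≤t : ‖ -i t ‖ ≤ t
    norm-i≤t = ≤-trans (norm--i t) (≤-reflexive (abs-of-nonneg 0≤t))
    inv0≈1 : inv 0 ≈ 1#
    inv0≈1 = *-cancelˡ (fromℕ 1) (pos⇒≉0 (fromℕ-suc-pos 0)) (trans (inv-inverse 0) (sym (trans (*-identityʳ _) (+-identityʳ 1#))))
    sinSum-2 : sinSum t 2 ≈ - t
    sinSum-2 = trans (solve 2 (λ i t → con 0ℤ :+ (i :* (con 0ℤ :* con 0ℤ :+ :- t :* con 1ℤ) :+ con 0ℤ :* (con 0ℤ :* con 1ℤ :- :- t :* con 0ℤ) :+ con 0ℤ) := i :* :- t) refl (inv 0) t)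
      (trans (*-congʳ inv0≈1) (*-identityˡ _))
    2t²≤ : term t 2 + term t 2 ≈ t * t
    2t²≤ = trans (solve 3 (λ i j t → j :* (t :* (i :* (t :* con 1ℤ))) :+ j :* (t :* (i :* (t :* con 1ℤ))) := (con (+ 2) :* j) :* (i :* (t :* t))) refl (inv 0) (inv 1) t)
      (trans (*-cong (trans (*-congʳ (+-congˡ (sym (+-identityʳ 1#)))) (inv-inverse 1)) (*-congʳ inv0≈1)) (trans (*-identityˡ _) (*-identityˡ _)))
    -- The condition of `expSum-tail` at index 2. It bounds the tail of e^t beyond 1 + t by twice
    -- its first term t² / 2.
    2t≤3 : t + t ≤ fromℕ 3
    2t≤3 = ≤-trans (+-mono-≤ t≤1 (≤-trans t≤1 (≤-reflexive (sym (+-identityʳ 1#))))) (fromℕ-mono-≤ (ℕ.n≤1+n 2))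
    tail-bound : ∀ m → 2 ℕ.≤ m → sinSum t m + t ≤ t * t
    tail-bound m 2≤m = begin
      sinSum t m + t ≈⟨ +-congˡ (trans (sym (-‿involutive t)) (-‿cong (sym sinSum-2))) ⟩
      im (ℂᴱ.expSum (-i t) m ℂ.+ ℂ.- ℂᴱ.expSum (-i t) 2) ≤⟨ x≤∣x∣ _ ⟩
      ∣ sinSum t m + - sinSum t 2 ∣ ≤⟨ im≤norm (ℂᴱ.expSum (-i t) m ℂ.+ ℂ.- ℂᴱ.expSum (-i t) 2) ⟩
      ‖ ℂᴱ.expSum (-i t) m ℂ.+ ℂ.- ℂᴱ.expSum (-i t) 2 ‖ ≤⟨ norm-tail (norm-term norm-i≤t) 2≤m ⟩
      expSum t m + - expSum t 2 ≤⟨ +-mono-≤ (increasing⇒mono (partialSum-increasing (term t) (term-nonneg 0≤t)) (ℕ.m≤m+n m 2)) ≤-refl ⟩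
      expSum t (m ℕ.+ 2) + - expSum t 2 ≤⟨ +-mono-≤ (≤-trans (≤-diff (+-nonneg (term-nonneg 0≤t (m ℕ.+ 2)) (term-nonneg 0≤t (m ℕ.+ 2))) refl) (expSum-tail t 2 0≤t 2t≤3 m)) ≤-refl ⟩
      expSum t 2 + (term t 2 + term t 2) + - expSum t 2 ≈⟨ solve 2 (λ a b → a :+ b :- a := b) refl (expSum t 2) (term t 2 + term t 2) ⟩
      term t 2 + term t 2 ≈⟨ 2t²≤ ⟩
      t * t ∎

  sine≉0 : ∀ {t} → 0# < t → t < 1# → ¬ (sine t ≈ 0#)
  sine≉0 {t} 0<t t<1 sin≈0 = <⇒≱ t<1 (*-cancelˡ-≤ 0<t (begin
    t * 1#       ≈⟨ *-identityʳ t ⟩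
    t            ≈⟨ +-identityˡ t ⟨
    0# + t       ≈⟨ +-congʳ sin≈0 ⟨
    sine t + t   ≤⟨ sine-near (<⇒≤ 0<t) (<⇒≤ t<1) ⟩
    t * t        ∎))

-- Zeros of the sine and its half period.

module Periods (em : ExcludedMiddle 0ℓ) (R : CompleteOrderedField) where
  open OrderedField em R
  open Exponential em R using (cosine; sine; cosine-cong; sine-cong; cosine-+; sine-+; cosine-neg; sine-neg; sine≉0)
  open PartialOrderReasoning poset

  sine-0 : sine 0# ≈ 0#
  sine-0 = *-cancelˡ (1# + 1#) (pos⇒≉0 0<2) (begin-equality
    (1# + 1#) * sine 0# ≈⟨ solve 1 (λ s → con (+ 2) :* s := s :+ s) refl (sine 0#) ⟩
    sine 0# + sine 0# ≈⟨ +-congˡ (trans (sine-cong (sym -0#≈0#)) (sine-neg 0#)) ⟩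
    sine 0# + - sine 0# ≈⟨ -‿inverseʳ _ ⟩
    0# ≈⟨ zeroʳ _ ⟨
    (1# + 1#) * 0# ∎)

  -- cos 0 is idempotent, and it is nonzero because otherwise the addition formula makes the sine vanish.
  cosine-0 : cosine 0# ≈ 1#
  cosine-0 = *-cancelˡ (cosine 0#) cos0≉0 (begin-equality
    cosine 0# * cosine 0# ≈⟨ solve 1 (λ c → c :* c := c :* c :- con 0ℤ :* con 0ℤ) refl (cosine 0#) ⟩
    cosine 0# * cosine 0# + - (0# * 0#) ≈⟨ +-congˡ (-‿cong (*-cong sine-0 sine-0)) ⟨
    cosine 0# * cosine 0# + - (sine 0# * sine 0#) ≈⟨ cosine-+ 0# 0# ⟨
    cosine (0# + 0#) ≈⟨ cosine-cong (+-identityˡ 0#) ⟩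
    cosine 0# ≈⟨ *-identityʳ _ ⟨
    cosine 0# * 1# ∎)
    where
    h = ½ * 1#
    cos0≉0 : ¬ (cosine 0# ≈ 0#)
    cos0≉0 cos0≈0 = sine≉0 (half-pos 0<1) (<-diff (half-pos 0<1) (sym (½+½ 1#))) (begin-equality
      sine h ≈⟨ sine-cong (+-identityˡ h) ⟨
      sine (0# + h) ≈⟨ sine-+ 0# h ⟩
      cosine 0# * sine h + sine 0# * cosine h ≈⟨ +-cong (*-congʳ cos0≈0) (*-congʳ sine-0) ⟩
      0# * sine h + 0# * cosine h ≈⟨ trans (+-cong (zeroˡ _) (zeroˡ _)) (+-identityˡ 0#) ⟩
      0# ∎)

  cosine²+sine² : ∀ t → cosine t * cosine t + sine t * sine t ≈ 1#
  cosine²+sine² t = begin-equality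
    cosine t * cosine t + sine t * sine t ≈⟨ solve 2 (λ c s → c :* c :+ s :* s := c :* c :- s :* :- s) refl (cosine t) (sine t) ⟩
    cosine t * cosine t + - (sine t * - sine t) ≈⟨ +-cong (*-congˡ (cosine-neg t)) (-‿cong (*-congˡ (sine-neg t))) ⟨
    cosine t * cosine (- t) + - (sine t * sine (- t)) ≈⟨ cosine-+ t (- t) ⟨
    cosine (t + - t) ≈⟨ cosine-cong (-‿inverseʳ t) ⟩
    cosine 0# ≈⟨ cosine-0 ⟩
    1# ∎

  private
    difference-of-squares : ∀ x → (x + - 1#) * (x + - - 1#) ≈ x * x + - 1#
    difference-of-squares x = solve 1 (λ x → (x :- con 1ℤ) :* (x :- :- con 1ℤ) := x :* x :- con 1ℤ) refl x

    cancel : ∀ a b → a + b + - a ≈ b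
    cancel a b = solve 2 (λ a b → a :+ b :- a := b) refl a b

    uncancel : ∀ a b → a ≈ b + (a + - b)
    uncancel a b = solve 2 (λ a b → a := b :+ (a :- b)) refl a b

  square≈1 : ∀ {x} → x * x ≈ 1# → x ≈ 1# ⊎ x ≈ - 1#
  square≈1 {x} xx≈1 with em {x + - 1# ≈ 0#}
  ... | yes x-1≈0 = inj₁ (x-y≈0⇒x≈y x-1≈0)
  ... | no x-1≉0  = inj₂ (x-y≈0⇒x≈y (*≈0 (trans (difference-of-squares x) (trans (+-congʳ xx≈1) (-‿inverseʳ 1#))) x-1≉0))
  cosine-at-zero : ∀ {t} → sine t ≈ 0# → cosine t * cosine t ≈ 1#
  cosine-at-zero {t} st≈0 = trans (sym (trans (+-congˡ (trans (*-congˡ st≈0) (zeroʳ _))) (+-identityʳ _))) (cosine²+sine² t)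

  zero-+ : ∀ {s t} → sine s ≈ 0# → sine t ≈ 0# → sine (s + t) ≈ 0#
  zero-+ {s} {t} ss≈0 st≈0 = trans (sine-+ s t)
    (trans (+-cong (trans (*-congˡ st≈0) (zeroʳ _)) (trans (*-congʳ ss≈0) (zeroˡ _))) (+-identityˡ 0#))

  zero-neg : ∀ {t} → sine t ≈ 0# → sine (- t) ≈ 0#
  zero-neg {t} st≈0 = trans (sine-neg t) (trans (-‿cong st≈0) -0#≈0#)

  private
    -- Completeness is stated for suprema, so the least positive zero is sought as the negative of
    -- the greatest negative one.
    NegativeZero : ℝ → Set
    NegativeZero x = x < 0# × sine x ≈ 0#

  -- The zeros of the sine are at distance at least 1 from each other, so a supremum of zeros is attained.
  least-zero : ∀ {t} → 0# < t → sine t ≈ 0# →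
               ∃[ g ] 0# < g × sine g ≈ 0# × (∀ z → 0# < z → sine z ≈ 0# → g ≤ z)
  least-zero {t} 0<t st≈0 = - x , neg-pos (proj₁ Nx) , zero-neg (proj₂ Nx) , λ z 0<z sz≈0 →
    ≤-trans (neg-mono-≤ (x-greatest (- z) (neg-neg 0<z , zero-neg sz≈0))) (≤-reflexive (-‿involutive z))
    where
    neg-pos : ∀ {x} → x < 0# → 0# < - x
    neg-pos {x} x<0 = <-≤-trans (diff-pos x<0) (≤-reflexive (+-identityˡ _))
    neg-neg : ∀ {x} → 0# < x → - x < 0#
    neg-neg {x} 0<x = <-diff 0<x (sym (-‿inverseˡ x))
    sup = supremum NegativeZero (- t , neg-neg 0<t , zero-neg st≈0) (0# , λ x Nx → <⇒≤ (proj₁ Nx))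
    s = proj₁ sup
    near = supremum-approx NegativeZero s (proj₂ (proj₂ sup)) 0<1
    x = proj₁ near
    Nx = proj₁ (proj₂ near)
    x-greatest : ∀ y → NegativeZero y → y ≤ x
    x-greatest y Ny = by-contradiction λ y≰x →
      sine≉0 (diff-pos (≰⇒> y≰x)) (begin-strict
        y + - x ≤⟨ +-monoˡ-≤ (- x) (proj₁ (proj₂ sup) y Ny) ⟩
        s + - x ≈⟨ solve 2 (λ s x → s :- x := (s :- con 1ℤ) :+ (con 1ℤ :- x)) refl s x ⟩
        s + - 1# + (1# + - x) <⟨ +-mono-<-≤ (proj₂ (proj₂ near)) ≤-refl ⟩
        x + (1# + - x) ≈⟨ solve 1 (λ x → x :+ (con 1ℤ :- x) := con 1ℤ) refl x ⟩
        1# ∎) (zero-+ (proj₂ Ny) (zero-neg (proj₂ Nx)))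

  sgn : Parity → ℝ
  sgn 0ℙ = 1#
  sgn 1ℙ = - 1#

  sgn-⁻¹ : ∀ p → sgn (p Parity.⁻¹) ≈ - sgn p
  sgn-⁻¹ 0ℙ = refl
  sgn-⁻¹ 1ℙ = sym (-‿involutive 1#)

  -- Says that `g` is π: its natural multiples are exactly the nonnegative zeros of the sine, and
  -- the cosine alternates between 1 and -1 along them.
  HalfPeriod : ℝ → Set
  HalfPeriod g = 0# < g
               × (∀ t → 0# ≤ t → sine t ≈ 0# → ∃[ n ] t ≈ fromℕ n * g)
               × (∀ n → sine (fromℕ n * g) ≈ 0# × cosine (fromℕ n * g) ≈ sgn (parity n))

  -- The zero `t` has two purposes. It gives a positive zero, hence a least one g; and since t is a
  -- multiple of g, `cosine g ≈ 1#` would force `cosine t ≈ 1#`, so that cosine g = -1.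
  halfPeriod : ∀ {t} → 0# < t → sine t ≈ 0# → ¬ (cosine t ≈ 1#) → ∃ HalfPeriod
  halfPeriod {t} 0<t st≈0 ct≉1 = g , 0<g , multiple , λ n → zero-multiple n , cosine-multiple n
    where
    least = least-zero 0<t st≈0
    g = proj₁ least
    0<g = proj₁ (proj₂ least)
    sg≈0 = proj₁ (proj₂ (proj₂ least))
    g-least = proj₂ (proj₂ (proj₂ least))

    sucg : ∀ n → fromℕ (suc n) * g ≈ g + fromℕ n * g
    sucg n = trans (distribʳ g 1# (fromℕ n)) (+-congʳ (*-identityˡ g))

    zero-multiple : ∀ n → sine (fromℕ n * g) ≈ 0#
    zero-multiple zero  = trans (sine-cong (zeroˡ g)) sine-0
    zero-multiple (suc n) = trans (sine-cong (sucg n)) (zero-+ sg≈0 (zero-multiple n))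

    cosine-suc : ∀ n → cosine (fromℕ (suc n) * g) ≈ cosine g * cosine (fromℕ n * g)
    cosine-suc n = trans (cosine-cong (sucg n)) (trans (cosine-+ g (fromℕ n * g))
      (trans (+-congˡ (trans (-‿cong (trans (*-congʳ sg≈0) (zeroˡ _))) -0#≈0#)) (+-identityʳ _)))

    -- Descent: a positive zero is at least g, so g can be subtracted from it, and `n` bounds how
    -- often.
    bounded-multiple : ∀ n t → 0# ≤ t → t ≤ fromℕ n * g → sine t ≈ 0# → ∃[ n ] t ≈ fromℕ n * g
    bounded-multiple zero t 0≤t t≤ st≈0 = 0 , ≤-antisym t≤ (≤-trans (≤-reflexive (zeroˡ g)) 0≤t)
    bounded-multiple (suc n) t 0≤t t≤ st≈0 = by-cases (λ t≈0 → 0 , trans t≈0 (sym (zeroˡ g))) λ t≉0 →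
      let k , t-g≈kg = bounded-multiple n (t + - g)
            (diff-nonneg (g-least t (nonneg∧≉0⇒pos 0≤t t≉0) st≈0))
            (≤-trans (+-monoˡ-≤ (- g) (≤-trans t≤ (≤-reflexive (sucg n)))) (≤-reflexive (cancel g (fromℕ n * g))))
            (zero-+ st≈0 (zero-neg sg≈0))
      in suc k , trans (uncancel t g) (trans (+-congˡ t-g≈kg) (sym (sucg k)))

    multiple : ∀ t → 0# ≤ t → sine t ≈ 0# → ∃[ n ] t ≈ fromℕ n * g
    multiple t 0≤t st≈0 =
      let n , tg⁻¹≤n = archimedean (t * g ⁻¹)
      in bounded-multiple n t 0≤t (begin
        t ≈⟨ *-identityʳ t ⟨
        t * 1# ≈⟨ *-congˡ (*-inverseʳ g (pos⇒≉0 0<g)) ⟨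
        t * (g * g ⁻¹) ≈⟨ solve 3 (λ t g h → t :* (g :* h) := g :* (t :* h)) refl t g (g ⁻¹) ⟩
        g * (t * g ⁻¹) ≤⟨ *-monoˡ-≤ (<⇒≤ 0<g) tg⁻¹≤n ⟩
        g * fromℕ n ≈⟨ *-comm _ _ ⟩
        fromℕ n * g ∎) st≈0

    cg≈1⇒c[ng]≈1 : cosine g ≈ 1# → ∀ n → cosine (fromℕ n * g) ≈ 1#
    cg≈1⇒c[ng]≈1 cg≈1 zero  = trans (cosine-cong (zeroˡ g)) cosine-0
    cg≈1⇒c[ng]≈1 cg≈1 (suc n) = trans (cosine-suc n) (trans (*-cong cg≈1 (cg≈1⇒c[ng]≈1 cg≈1 n)) (*-identityˡ 1#))

    cg≉1 : ¬ (cosine g ≈ 1#)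
    cg≉1 cg≈1 = let n , t≈ng = multiple t (<⇒≤ 0<t) st≈0
                in ct≉1 (trans (cosine-cong t≈ng) (cg≈1⇒c[ng]≈1 cg≈1 n))

    cg≈-1 : cosine g ≈ - 1#
    cg≈-1 = fromInj₂ (λ cg≈1 → contradiction cg≈1 cg≉1) (square≈1 (cosine-at-zero sg≈0))

    cosine-multiple : ∀ n → cosine (fromℕ n * g) ≈ sgn (parity n)
    cosine-multiple zero  = trans (cosine-cong (zeroˡ g)) cosine-0
    cosine-multiple (suc n) = begin-equality
      cosine (fromℕ (suc n) * g) ≈⟨ cosine-suc n ⟩
      cosine g * cosine (fromℕ n * g) ≈⟨ *-cong cg≈-1 (cosine-multiple n) ⟩
      - 1# * sgn (parity n) ≈⟨ trans (sym (-‿distribˡ-* _ _)) (-‿cong (*-identityˡ _)) ⟩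
      - sgn (parity n) ≡⟨ ≡.cong (λ p → - sgn p) (Parity.suc-homo-⁻¹ n) ⟨
      - sgn (parity (suc n) Parity.⁻¹) ≈⟨ trans (-‿cong (sgn-⁻¹ (parity (suc n)))) (-‿involutive _) ⟩
      sgn (parity (suc n)) ∎

-- Real roots from Rayleigh quotients and the spectral decomposition of a vector.

module SpectralTheory (em : ExcludedMiddle 0ℓ) (R : CompleteOrderedField) where
  open OrderedField em R
  open PartialOrderReasoning poset

  +-nonneg≈0 : ∀ {x y} → 0# ≤ x → 0# ≤ y → x + y ≈ 0# → x ≈ 0#
  +-nonneg≈0 0≤x 0≤y x+y≈0 = ≤-antisym (≤-diff 0≤y (sym x+y≈0)) 0≤x

  sum-nonneg≈0 : ∀ {n} (f : Fin n → ℝ) → (∀ i → 0# ≤ f i) → sum f ≈ 0# → ∀ i → f i ≈ 0#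
  sum-nonneg≈0 f 0≤f sum≈0 Fin.zero    = +-nonneg≈0 (0≤f Fin.zero) (sum-nonneg (f ∘ Fin.suc) (0≤f ∘ Fin.suc)) sum≈0
  sum-nonneg≈0 f 0≤f sum≈0 (Fin.suc i) = sum-nonneg≈0 (f ∘ Fin.suc) (0≤f ∘ Fin.suc)
    (+-nonneg≈0 (sum-nonneg (f ∘ Fin.suc) (0≤f ∘ Fin.suc)) (0≤f Fin.zero) (trans (+-comm _ _) sum≈0)) i

  norm² : ∀ {n} → Vector ℝ n → ℝ
  norm² x = dot x x

  norm²-nonneg : ∀ {n} (x : Vector ℝ n) → 0# ≤ norm² x
  norm²-nonneg x = sum-nonneg (λ u → x u * x u) (λ u → square-nonneg (x u))

  norm²≈0 : ∀ {n} (x : Vector ℝ n) → norm² x ≈ 0# → x ≈ᵥ 𝟎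
  norm²≈0 x |x|≈0 u = square≈0 (sum-nonneg≈0 (λ u → x u * x u) (λ u → square-nonneg (x u)) |x|≈0 u)

  norm²≉0 : ∀ {n} {x : Vector ℝ n} → ¬ (x ≈ᵥ 𝟎) → ¬ (norm² x ≈ 0#)
  norm²≉0 {x = x} x≉0 |x|≈0 = x≉0 (norm²≈0 x |x|≈0)

  norm²-· : ∀ {n} c (x : Vector ℝ n) → norm² (c · x) ≈ c * c * norm² x
  norm²-· c x = trans (dot-·ˡ c x (c · x)) (trans (*-congˡ (dot-·ʳ c x x)) (sym (*-assoc _ _ _)))

  norm²-+ : ∀ {n} (x y : Vector ℝ n) → norm² (x +ᵥ y) ≈ norm² x + (dot x y + dot x y) + norm² y
  norm²-+ x y = trans (dot-+ˡ x y (x +ᵥ y)) (trans (+-cong (dot-+ʳ x x y) (trans (dot-+ʳ y x y) (+-congʳ (dot-comm y x))))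
    (solve 3 (λ a b c → a :+ b :+ (b :+ c) := a :+ (b :+ b) :+ c) refl (norm² x) (dot x y) (norm² y)))

  norm²-+-≤ : ∀ {n} (x y : Vector ℝ n) → norm² (x +ᵥ y) ≤ (1# + 1#) * (norm² x + norm² y)
  norm²-+-≤ x y = ≤-diff (norm²-nonneg (x +ᵥ - 1# · y)) (begin-equality
    (1# + 1#) * (norm² x + norm² y)
      ≈⟨ solve 3 (λ a b c → con (+ 2) :* (a :+ c) := a :+ (b :+ b) :+ c :+ (a :+ (:- con 1ℤ :* b :+ :- con 1ℤ :* b) :+ :- con 1ℤ :* :- con 1ℤ :* c)) refl (norm² x) (dot x y) (norm² y) ⟩
    norm² x + (dot x y + dot x y) + norm² y + (norm² x + (- 1# * dot x y + - 1# * dot x y) + - 1# * - 1# * norm² y)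
      ≈⟨ +-cong (norm²-+ x y) (trans (norm²-+ x (- 1# · y)) (+-cong (+-congˡ (+-cong (dot-·ʳ (- 1#) x y) (dot-·ʳ (- 1#) x y))) (norm²-· (- 1#) y))) ⟨
    norm² (x +ᵥ y) + norm² (x +ᵥ - 1# · y) ∎)

  -dot≤ : ∀ {n} (x y : Vector ℝ n) → - dot x y ≤ norm² x + norm² y
  -dot≤ x y = *-cancelˡ-≤ 0<2 (≤-diff (+-nonneg (norm²-nonneg (x +ᵥ y)) (+-nonneg (norm²-nonneg x) (norm²-nonneg y))) (trans
    (solve 3 (λ a b c → con (+ 2) :* (a :+ c) := con (+ 2) :* :- b :+ (a :+ (b :+ b) :+ c :+ (a :+ c))) refl (norm² x) (dot x y) (norm² y))
    (+-congˡ (+-congʳ (sym (norm²-+ x y))))))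

  dot≤ : ∀ {n} (x y : Vector ℝ n) → dot x y ≤ norm² x + norm² y
  dot≤ x y = begin
    dot x y ≈⟨ solve 1 (λ d → d := :- (:- con 1ℤ :* d)) refl (dot x y) ⟩
    - (- 1# * dot x y) ≈⟨ -‿cong (dot-·ˡ (- 1#) x y) ⟨
    - dot (- 1# · x) y ≤⟨ -dot≤ (- 1# · x) y ⟩
    norm² (- 1# · x) + norm² y ≈⟨ +-congʳ (trans (norm²-· (- 1#) x) (solve 1 (λ a → :- con 1ℤ :* :- con 1ℤ :* a := a) refl (norm² x))) ⟩
    norm² x + norm² y ∎

  Bounded : ∀ {m n} → (Vector ℝ n → Vector ℝ m) → Set
  Bounded f = ∃[ B ] 0# ≤ B × (∀ x → norm² (f x) ≤ B * norm² x)

  -- From (a + t)² ≤ 2 (a² + t²), one coordinate at a time. The constant is crude, but only the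
  -- existence of a bound matters.
  row-bounded : ∀ {n} (r : Vector ℝ n) → ∃[ B ] 0# ≤ B × (∀ x → dot r x * dot r x ≤ B * norm² x)
  row-bounded {zero} r = 0# , ≤-refl , λ x → ≤-reflexive refl
  row-bounded {suc n}  r =
    let B , 0≤B , bound = row-bounded (r ∘ Fin.suc)
        r₀ = r Fin.zero
        0≤r₀² = square-nonneg r₀
    in (1# + 1#) * (r₀ * r₀ + B) , *-nonNeg (<⇒≤ 0<2) (+-nonneg 0≤r₀² 0≤B) , λ x →
      let x₀ = x Fin.zero
          t = dot (r ∘ Fin.suc) (x ∘ Fin.suc)
          X = norm² (x ∘ Fin.suc)
      in begin
        (r₀ * x₀ + t) * (r₀ * x₀ + t)
          ≤⟨ ≤-diff (square-nonneg (r₀ * x₀ + - t)) (solve 2 (λ a t → con (+ 2) :* (a :* a :+ t :* t) := (a :+ t) :* (a :+ t) :+ (a :- t) :* (a :- t)) refl (r₀ * x₀) t) ⟩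
        (1# + 1#) * (r₀ * x₀ * (r₀ * x₀) + t * t)
          ≤⟨ *-monoˡ-≤ (<⇒≤ 0<2) (+-monoʳ-≤ _ (bound (x ∘ Fin.suc))) ⟩
        (1# + 1#) * (r₀ * x₀ * (r₀ * x₀) + B * X)
          ≤⟨ *-monoˡ-≤ (<⇒≤ 0<2) (≤-diff (+-nonneg (*-nonNeg 0≤r₀² (norm²-nonneg (x ∘ Fin.suc))) (*-nonNeg 0≤B (square-nonneg x₀)))
               (solve 4 (λ r x B X → (r :* r :+ B) :* (x :* x :+ X) := r :* x :* (r :* x) :+ B :* X :+ (r :* r :* X :+ B :* (x :* x))) refl r₀ x₀ B X)) ⟩
        (1# + 1#) * ((r₀ * r₀ + B) * norm² x)
          ≈⟨ *-assoc _ _ _ ⟨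
        (1# + 1#) * (r₀ * r₀ + B) * norm² x ∎

  matrix-bounded : ∀ {m n} (M : Fin m → Vector ℝ n) → Bounded (λ x u → dot (M u) x)
  matrix-bounded {zero} M = 0# , ≤-refl , λ x → ≤-reflexive (sym (zeroˡ _))
  matrix-bounded {suc m}  M =
    let B , 0≤B , bound = row-bounded (M Fin.zero)
        C , 0≤C , bound′ = matrix-bounded (M ∘ Fin.suc)
    in B + C , +-nonneg 0≤B 0≤C , λ x → ≤-trans (+-mono-≤ (bound x) (bound′ x)) (≤-reflexive (sym (distribʳ _ _ _)))

  eval-bounded : ∀ {n d} (K : Matrix ℝ n) b (p : Vec ℝ d) → Bounded (eval K b p)
  eval-bounded K b [] = b * b , square-nonneg b , λ x → ≤-reflexive (norm²-· b x)
  eval-bounded K b (c ∷ cs) =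
    let B , 0≤B , bound = eval-bounded K b cs
        C , 0≤C , bound′ = matrix-bounded K
    in (1# + 1#) * (c * c + C * B) , *-nonNeg (<⇒≤ 0<2) (+-nonneg (square-nonneg c) (*-nonNeg 0≤C 0≤B)) , λ x → begin
      norm² (c · x +ᵥ K *ᵥ eval K b cs x) ≤⟨ norm²-+-≤ (c · x) (K *ᵥ eval K b cs x) ⟩
      (1# + 1#) * (norm² (c · x) + norm² (K *ᵥ eval K b cs x)) ≤⟨ *-monoˡ-≤ (<⇒≤ 0<2) (+-mono-≤ (≤-reflexive (norm²-· c x))
                                                                          (≤-trans (bound′ (eval K b cs x)) (*-monoˡ-≤ 0≤C (bound x)))) ⟩
      (1# + 1#) * (c * c * norm² x + C * (B * norm² x)) ≈⟨ solve 4 (λ c C B X → con (+ 2) :* (c :* c :* X :+ C :* (B :* X)) := con (+ 2) :* (c :* c :+ C :* B) :* X) refl c C B (norm² x) ⟩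
      (1# + 1#) * (c * c + C * B) * norm² x ∎

  module _ {n : ℕ} (K : Matrix ℝ n) (K-sa : SelfAdjoint K) where

    shift-selfAdjoint : ∀ t x y → dot (shift K t x) y ≈ dot x (shift K t y)
    shift-selfAdjoint t x y = begin-equality
      dot (shift K t x) y ≈⟨ dot-cong {x = shift K t x} (λ u → +-congˡ (-‿distribˡ-* t (x u))) (λ _ → refl) ⟩
      dot (K *ᵥ x +ᵥ - t · x) y ≈⟨ dot-+ˡ (K *ᵥ x) (- t · x) y ⟩
      dot (K *ᵥ x) y + dot (- t · x) y ≈⟨ +-cong (K-sa x y) (trans (dot-·ˡ (- t) x y) (sym (dot-·ʳ (- t) x y))) ⟩
      dot x (K *ᵥ y) + dot x (- t · y) ≈⟨ dot-+ʳ x (K *ᵥ y) (- t · y) ⟨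
      dot x (K *ᵥ y +ᵥ - t · y) ≈⟨ dot-congʳ x (λ u → +-congˡ (sym (-‿distribˡ-* t (y u)))) ⟩
      dot x (shift K t y) ∎

    dot-shift : ∀ t x → dot x (shift K t x) ≈ dot x (K *ᵥ x) + - (t * norm² x)
    dot-shift t x = begin-equality
      dot x (shift K t x) ≈⟨ dot-congʳ x (λ u → +-congˡ (-‿distribˡ-* t (x u))) ⟩
      dot x (K *ᵥ x +ᵥ - t · x) ≈⟨ dot-+ʳ x (K *ᵥ x) (- t · x) ⟩
      dot x (K *ᵥ x) + dot x (- t · x) ≈⟨ +-congˡ (trans (dot-·ʳ (- t) x x) (sym (-‿distribˡ-* t (norm² x)))) ⟩
      dot x (K *ᵥ x) + - (t * norm² x) ∎

    shift≈0⇒eigen : ∀ {θ x} → shift K θ x ≈ᵥ 𝟎 → K *ᵥ x ≈ᵥ θ · x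
    shift≈0⇒eigen shift≈0 u = x-y≈0⇒x≈y (shift≈0 u)

    shift-eigen : ∀ t {θ x} → K *ᵥ x ≈ᵥ θ · x → shift K t x ≈ᵥ (θ + - t) · x
    shift-eigen t {θ} {x} Kx≈θx u = trans (+-congʳ (Kx≈θx u)) (solve 3 (λ θ t x → θ :* x :- t :* x := (θ :- t) :* x) refl θ t (x u))

    -- The supremum t of the Rayleigh quotient on W = ker p(K): there t - K is positive semidefinite, but not
    -- bounded below by a positive multiple of the identity.
    module Rayleigh {d} (p : Vec ℝ d) {y : Vector ℝ n} (y∈W : eval K 1# p y ≈ᵥ 𝟎) (y≉0 : ¬ (y ≈ᵥ 𝟎)) where
      _∈W : Vector ℝ n → Set
      x ∈W = eval K 1# p x ≈ᵥ 𝟎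

      closed-shift : ∀ s t {x} → x ∈W → (x +ᵥ s · shift K t x) ∈W
      closed-shift s t {x} px≈0 u = begin-equality
        eval K 1# p (x +ᵥ s · shift K t x) u
          ≈⟨ trans (eval-+ K 1# p x (s · shift K t x) u) (+-congˡ (trans (eval-· K 1# p s (shift K t x) u) (*-congˡ (eval-shift K 1# p t x u)))) ⟩
        eval K 1# p x u + s * shift K t (eval K 1# p x) u
          ≈⟨ +-cong (px≈0 u) (*-congˡ (trans (shift-cong K t px≈0 u) (+-congʳ (*ᵥ-zero K 𝟎 (λ _ → refl) u)))) ⟩
        0# + s * (0# + - (t * 0#))
          ≈⟨ solve 2 (λ s t → con 0ℤ :+ s :* (con 0ℤ :- t :* con 0ℤ) := con 0ℤ) refl s t ⟩
        0# ∎

      private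
        B = proj₁ (matrix-bounded K)
        0≤B = proj₁ (proj₂ (matrix-bounded K))
        K≤B : ∀ x → norm² (K *ᵥ x) ≤ B * norm² x
        K≤B = proj₂ (proj₂ (matrix-bounded K))

        norm²+K≤ : ∀ x → norm² x + norm² (K *ᵥ x) ≤ (1# + B) * norm² x
        norm²+K≤ x = ≤-trans (+-monoʳ-≤ _ (K≤B x)) (≤-reflexive (solve 2 (λ B X → X :+ B :* X := (con 1ℤ :+ B) :* X) refl B (norm² x)))

        form-bound : ∀ s x → - dot x (K *ᵥ x) + s * norm² x ≤ (∣ s ∣ + (1# + B)) * norm² x
        form-bound s x = begin
          - dot x (K *ᵥ x) + s * norm² x ≤⟨ +-mono-≤ (≤-trans (-dot≤ x (K *ᵥ x)) (norm²+K≤ x)) (*-monoʳ-≤ (norm²-nonneg x) (x≤∣x∣ s)) ⟩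
          (1# + B) * norm² x + ∣ s ∣ * norm² x ≈⟨ trans (+-comm _ _) (sym (distribʳ (norm² x) (∣ s ∣) (1# + B))) ⟩
          (∣ s ∣ + (1# + B)) * norm² x ∎

        -- The numbers below the Rayleigh quotient of some w in W, stated without division; their
        -- supremum is that of the quotients.
        Quotient : ℝ → Set
        Quotient s = ∃[ w ] w ∈W × 0# < norm² w × s * norm² w ≤ dot w (K *ᵥ w)

        pos-norm² : ∀ {w : Vector ℝ n} → ¬ (w ≈ᵥ 𝟎) → 0# < norm² w
        pos-norm² {w} w≉0 = nonneg∧≉0⇒pos (norm²-nonneg w) (norm²≉0 {x = w} w≉0)

        quotient-of : ∀ w → 0# < norm² w → dot w (K *ᵥ w) * norm² w ⁻¹ * norm² w ≈ dot w (K *ᵥ w)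
        quotient-of w 0<w = trans (*-assoc _ _ _) (trans (*-congˡ (trans (*-comm _ _) (*-inverseʳ (norm² w) (pos⇒≉0 0<w)))) (*-identityʳ _))

        member : ∀ {w} → w ∈W → 0# < norm² w → Quotient (dot w (K *ᵥ w) * norm² w ⁻¹)
        member {w} w∈W 0<w = w , w∈W , 0<w , ≤-reflexive (quotient-of w 0<w)

        upper : ∀ s → Quotient s → s ≤ 1# + B
        upper s (w , w∈W , 0<w , sw≤) = *-cancelˡ-≤ 0<w (begin
          norm² w * s ≈⟨ *-comm _ _ ⟩
          s * norm² w ≤⟨ sw≤ ⟩
          dot w (K *ᵥ w) ≤⟨ ≤-trans (dot≤ w (K *ᵥ w)) (norm²+K≤ w) ⟩
          (1# + B) * norm² w ≈⟨ *-comm _ _ ⟩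
          norm² w * (1# + B) ∎)

        sup = supremum Quotient (_ , member y∈W (pos-norm² {y} y≉0)) (1# + B , upper)

      top : ℝ
      top = proj₁ sup

      form≤top : ∀ {w} → w ∈W → dot w (K *ᵥ w) ≤ top * norm² w
      form≤top {w} w∈W = by-cases
        (λ |w|≈0 → ≤-reflexive (trans (dot-zeroˡ (norm²≈0 w |w|≈0)) (sym (trans (*-congˡ |w|≈0) (zeroʳ _)))))
        (λ |w|≉0 → let 0<w = nonneg∧≉0⇒pos (norm²-nonneg w) |w|≉0 in begin
          dot w (K *ᵥ w) ≈⟨ quotient-of w 0<w ⟨
          dot w (K *ᵥ w) * norm² w ⁻¹ * norm² w ≈⟨ *-comm _ _ ⟩
          norm² w * (dot w (K *ᵥ w) * norm² w ⁻¹) ≤⟨ *-monoˡ-≤ (norm²-nonneg w) (proj₁ (proj₂ sup) _ (member w∈W 0<w)) ⟩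
          norm² w * top ≈⟨ *-comm _ _ ⟩
          top * norm² w ∎)
        where
        dot-zeroˡ : w ≈ᵥ 𝟎 → dot w (K *ᵥ w) ≈ 0#
        dot-zeroˡ w≈0 = trans (dot-comm w (K *ᵥ w)) (dot-zeroʳ (K *ᵥ w) w w≈0)

      top-sharp : ∀ {δ} → 0# < δ → ¬ (∀ {w} → w ∈W → dot w (K *ᵥ w) ≤ (top + - δ) * norm² w)
      top-sharp {δ} 0<δ form≤ = <⇒≱ (<-diff 0<δ (solve 2 (λ t d → t := t :- d :+ d) refl top δ))
        (proj₂ (proj₂ sup) (top + - δ) λ { s (w , w∈W , 0<w , sw≤) → *-cancelˡ-≤ 0<w
          (≤-trans (≤-reflexive (*-comm _ _)) (≤-trans sw≤ (≤-trans (form≤ w∈W) (≤-reflexive (*-comm _ _))))) })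

      gap : Vector ℝ n → ℝ
      gap x = - dot x (shift K top x)

      gap≈ : ∀ x → gap x ≈ - dot x (K *ᵥ x) + top * norm² x
      gap≈ x = trans (-‿cong (dot-shift top x)) (solve 2 (λ a b → :- (a :- b) := :- a :+ b) refl (dot x (K *ᵥ x)) (top * norm² x))

      gap-nonneg : ∀ {w} → w ∈W → 0# ≤ gap w
      gap-nonneg {w} w∈W = ≤-trans (diff-nonneg (form≤top w∈W)) (≤-reflexive (trans (+-comm _ _) (sym (gap≈ w))))

      private
        -- By `form-bound`, `gap x` is at most C |x|². The summand `1#` keeps C positive, so that
        -- its inverse can be the step length s.
        C = ∣ top ∣ + (1# + B)
        0<C : 0# < C
        0<C = <-≤-trans 0<1 (≤-diff (+-nonneg (abs-nonneg top) 0≤B) (solve 2 (λ t B → t :+ (con 1ℤ :+ B) := con 1ℤ :+ (t :+ B)) refl (∣ top ∣) B))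
        s = C ⁻¹
        0≤s = <⇒≤ (⁻¹-pos 0<C)
        Cs≈1 : C * s ≈ 1#
        Cs≈1 = *-inverseʳ C (pos⇒≉0 0<C)

        gap-step : ∀ w → gap (w +ᵥ s · shift K top w) ≈
                         gap w + - (s * norm² (shift K top w) + s * norm² (shift K top w)) + s * s * gap (shift K top w)
        gap-step w = begin-equality
          - dot (w +ᵥ s · Nw) (shift K top (w +ᵥ s · Nw))
            ≈⟨ -‿cong (dot-congʳ (w +ᵥ s · Nw) (λ u → trans (shift-+ K top w (s · Nw) u) (+-congˡ (shift-· K top s Nw u)))) ⟩
          - dot (w +ᵥ s · Nw) (Nw +ᵥ s · NNw)
            ≈⟨ -‿cong (trans (dot-+ˡ w (s · Nw) (Nw +ᵥ s · NNw)) (+-cong (trans (dot-+ʳ w Nw (s · NNw)) (+-congˡ (dot-·ʳ s w NNw)))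
                 (trans (dot-·ˡ s Nw (Nw +ᵥ s · NNw)) (*-congˡ (trans (dot-+ʳ Nw Nw (s · NNw)) (+-congˡ (dot-·ʳ s Nw NNw))))))) ⟩
          - (dot w Nw + s * dot w NNw + s * (norm² Nw + s * dot Nw NNw))
            ≈⟨ -‿cong (+-congʳ (+-congˡ (*-congˡ (sym (shift-selfAdjoint top w Nw))))) ⟩
          - (dot w Nw + s * norm² Nw + s * (norm² Nw + s * dot Nw NNw))
            ≈⟨ solve 4 (λ s a b c → :- (a :+ s :* b :+ s :* (b :+ s :* c)) := :- a :- (s :* b :+ s :* b) :+ s :* s :* :- c) refl s (dot w Nw) (norm² Nw) (dot Nw NNw) ⟩
          gap w + - (s * norm² Nw + s * norm² Nw) + s * s * gap Nw ∎
          where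
          Nw = shift K top w
          NNw = shift K top Nw

      -- |(K - t) w|² ≤ C ⟨w , (t - K) w⟩, by testing the form at w + C⁻¹ (K - t) w.
      shift≤gap : ∃[ C ] 0# < C × (∀ {w} → w ∈W → norm² (shift K top w) ≤ C * gap w)
      shift≤gap = C , 0<C , λ {w} w∈W → let Nw = shift K top w in begin
        norm² Nw ≈⟨ trans (sym (*-identityˡ _)) (trans (*-congʳ (sym Cs≈1)) (*-assoc _ _ _)) ⟩
        C * (s * norm² Nw) ≤⟨ *-monoˡ-≤ (<⇒≤ 0<C) (≤-diff
          (gap-nonneg (closed-shift s top {w} w∈W)) refl) ⟩
        C * (s * norm² Nw + gap (w +ᵥ s · Nw)) ≤⟨ *-monoˡ-≤ (<⇒≤ 0<C) (+-monoʳ-≤ _ (≤-trans (≤-reflexive (gap-step w))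
          (+-monoʳ-≤ _ (*-monoˡ-≤ (*-nonNeg 0≤s 0≤s) (≤-trans (≤-reflexive (gap≈ Nw)) (form-bound top Nw)))))) ⟩
        C * (s * norm² Nw + (gap w + - (s * norm² Nw + s * norm² Nw) + s * s * (C * norm² Nw)))
          ≈⟨ *-congˡ (solve 4 (λ s a g C → s :* a :+ (g :- (s :* a :+ s :* a) :+ s :* s :* (C :* a)) := g :+ (C :* s :- con 1ℤ) :* (s :* a)) refl s (norm² Nw) (gap w) C) ⟩
        C * (gap w + (C * s + - 1#) * (s * norm² Nw))
          ≈⟨ *-congˡ (trans (+-congˡ (trans (*-congʳ (x≈y⇒x-y≈0 Cs≈1)) (zeroˡ _))) (+-identityʳ _)) ⟩
        C * gap w ∎

    -- The root is the supremum t of the Rayleigh quotient on ker p(K). If p(t) were nonzero, then p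
    -- = p(t) + (X - t) q would make K - t invertible on this kernel, with inverse - q(K) / p(t).
    -- Then |w|² is bounded by a multiple of |(K - t) w|², hence by D times `gap w`, and t - 1/D
    -- would still bound all Rayleigh quotients.
    real-root : ∀ {d} (p : Vec ℝ (suc d)) y → ¬ (y ≈ᵥ 𝟎) → eval K 1# p y ≈ᵥ 𝟎 → ∃[ t ] evalₛ 1# p t ≈ 0#
    real-root p y y≉0 py≈0 = top , by-contradiction λ p[t]≉0 → impossible p[t]≉0
      where
      open Rayleigh p {y} py≈0 y≉0
      module _ (p[t]≉0 : ¬ (evalₛ 1# p top ≈ 0#)) where
        q = quotient 1# p top
        c = evalₛ 1# p top ⁻¹
        B = proj₁ (eval-bounded K 1# q)
        0≤B = proj₁ (proj₂ (eval-bounded K 1# q))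
        C = proj₁ shift≤gap
        D = 1# + c * c * (B * C)
        0<D : 0# < D
        0<D = +-pos 0<1 (*-nonNeg (square-nonneg c) (*-nonNeg 0≤B (<⇒≤ (proj₁ (proj₂ shift≤gap)))))

        inverse : ∀ {w} → eval K 1# p w ≈ᵥ 𝟎 → w ≈ᵥ - c · eval K 1# q (shift K top w)
        inverse {w} pw≈0 u = sym (begin-equality
          - c * eval K 1# q (shift K top w) u
            ≈⟨ *-congˡ (eval-shift K 1# q top w u) ⟩
          - c * shift K top (eval K 1# q w) u
            ≈⟨ solve 4 (λ c a P w → :- c :* a := :- c :* (P :* w :+ a) :+ P :* c :* w) refl c _ (evalₛ 1# p top) (w u) ⟩
          - c * (evalₛ 1# p top * w u + shift K top (eval K 1# q w) u) + evalₛ 1# p top * c * w u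
            ≈⟨ +-cong (*-congˡ (trans (sym (eval-quotient K 1# p top w u)) (pw≈0 u))) (*-congʳ (*-inverseʳ _ p[t]≉0)) ⟩
          - c * 0# + 1# * w u
            ≈⟨ trans (+-cong (zeroʳ _) (*-identityˡ _)) (+-identityˡ _) ⟩
          w u ∎)

        norm²≤gap : ∀ {w} → eval K 1# p w ≈ᵥ 𝟎 → norm² w ≤ D * gap w
        norm²≤gap {w} pw≈0 = begin
          norm² w ≈⟨ dot-cong (inverse pw≈0) (inverse pw≈0) ⟩
          norm² (- c · eval K 1# q (shift K top w)) ≈⟨ norm²-· (- c) (eval K 1# q (shift K top w)) ⟩
          - c * - c * norm² (eval K 1# q (shift K top w)) ≤⟨ *-monoˡ-≤ (square-nonneg (- c)) (≤-trans (proj₂ (proj₂ (eval-bounded K 1# q)) (shift K top w))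
                                                             (*-monoˡ-≤ 0≤B (proj₂ (proj₂ shift≤gap) pw≈0))) ⟩
          - c * - c * (B * (C * gap w)) ≤⟨ ≤-diff (gap-nonneg pw≈0) (solve 4 (λ c B C g → (con 1ℤ :+ c :* c :* (B :* C)) :* g := :- c :* :- c :* (B :* (C :* g)) :+ g) refl c B C (gap w)) ⟩
          D * gap w ∎

        impossible : ⊥
        impossible = top-sharp (⁻¹-pos 0<D) λ {w} pw≈0 → *-cancelˡ-≤ 0<D (begin
          D * dot w (K *ᵥ w)
            ≤⟨ ≤-diff (diff-nonneg (norm²≤gap pw≈0)) refl ⟩
          D * dot w (K *ᵥ w) + (D * gap w + - norm² w)
            ≈⟨ +-congˡ (+-congʳ (*-congˡ (gap≈ w))) ⟩
          D * dot w (K *ᵥ w) + (D * (- dot w (K *ᵥ w) + top * norm² w) + - norm² w)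
            ≈⟨ solve 4 (λ D d t X → D :* d :+ (D :* (:- d :+ t :* X) :- X) := D :* (t :* X) :- con 1ℤ :* X) refl D (dot w (K *ᵥ w)) top (norm² w) ⟩
          D * (top * norm² w) + - (1# * norm² w)
            ≈⟨ +-congˡ (-‿cong (*-congʳ (*-inverseʳ D (pos⇒≉0 0<D)))) ⟨
          D * (top * norm² w) + - (D * D ⁻¹ * norm² w)
            ≈⟨ solve 4 (λ D t E X → D :* (t :* X) :- D :* E :* X := D :* ((t :- E) :* X)) refl D top (D ⁻¹) (norm² w) ⟩
          D * ((top + - (D ⁻¹)) * norm² w) ∎)

    Minimal : ℕ → Vector ℝ n → Set
    Minimal d y = ∀ {j} → j ℕ.< d → (p : Vec ℝ j) → ¬ (eval K 1# p y ≈ᵥ 𝟎)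

    -- Eigenvalues may repeat and components may vanish. Only the sum matters, and in this form a
    -- decomposition for H is also one for every power of H.
    record Decomposition (d : ℕ) (y : Vector ℝ n) : Set where
      field
        eigenvalue  : Fin d → ℝ
        component   : Fin d → Vector ℝ n
        isEigen     : ∀ i → K *ᵥ component i ≈ᵥ eigenvalue i · component i
        decomposes  : ∀ u → y u ≈ sum (λ i → component i u)

    private
      eval-[] : ∀ x → eval K 1# [] x ≈ᵥ x
      eval-[] x u = *-identityˡ (x u)

      -- (t - s)⁻¹, but 0 instead of a junk value at t = s
      weight : ℝ → ℝ → ℝ
      weight s t with em {t + - s ≈ 0#}
      ... | yes _ = 0#
      ... | no _  = (t + - s) ⁻¹

      -- The second factor vanishes if s = t, the first one otherwise.
      weight-spec : ∀ s t → (1# + - (weight s t * (t + - s))) * (t + - s) ≈ 0#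
      weight-spec s t with em {t + - s ≈ 0#}
      ... | yes t-s≈0 = trans (*-congˡ t-s≈0) (zeroʳ _)
      ... | no t-s≉0  = trans (*-congʳ (x≈y⇒x-y≈0 (trans (sym (*-inverseʳ _ t-s≉0)) (*-comm _ _)))) (zeroˡ _)

      weight-term : ∀ s t x → x + - (weight s t * ((t + - s) * x)) ≈ (1# + - (weight s t * (t + - s))) * x
      weight-term s t x = solve 3 (λ w d x → x :- w :* (d :* x) := (con 1ℤ :- w :* d) :* x) refl (weight s t) (t + - s) x

      sum-neg : ∀ {m} (f : Fin m → ℝ) → - sum f ≈ sum (λ i → - f i)
      sum-neg {zero} f = -0#≈0#
      sum-neg {suc m} f = trans (sym (-‿+-comm _ _)) (+-congˡ (sum-neg (f ∘ Fin.suc)))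

      shift-sum : ∀ t {m} (x : Fin m → Vector ℝ n) → shift K t (λ u → sum (λ i → x i u)) ≈ᵥ λ u → sum (λ i → shift K t (x i) u)
      shift-sum t {m} x u = begin-equality
        (K *ᵥ (λ v → sum (λ i → x i v))) u + - (t * sum (λ i → x i u))
          ≈⟨ +-cong (*ᵥ-sum K x u) (trans (-‿cong (*-distribˡ-sum t (λ i → x i u))) (sum-neg (λ i → t * x i u))) ⟩
        sum (λ i → (K *ᵥ x i) u) + sum (λ i → - (t * x i u))
          ≈⟨ ∑-distrib-+ {m} (λ i → (K *ᵥ x i) u) (λ i → - (t * x i u)) ⟨
        sum (λ i → shift K t (x i) u) ∎

    -- If (K - t) y = Σ xᵢ with K xᵢ = θᵢ xᵢ, then z = y - Σ_{θᵢ ≠ t} xᵢ / (θᵢ - t) satisfies (K - t)² z = 0,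
    -- hence (K - t) z = 0 by self-adjointness.
    extend : ∀ {d} t y → Decomposition d (shift K t y) → Decomposition (suc d) y
    extend {d} t y dec = record
      { eigenvalue = t Vector.∷ θ
      ; component  = z Vector.∷ λ i → w i · x i
      ; isEigen    = λ { Fin.zero → shift≈0⇒eigen {t} {z} (norm²≈0 (shift K t z) |s|²≈0)
                       ; (Fin.suc i) u → trans (*ᵥ-· K (w i) (x i) u) (trans (*-congˡ (isEigen i u))
                           (solve 3 (λ w θ x → w :* (θ :* x) := θ :* (w :* x)) refl (w i) (θ i) (x i u))) }
      ; decomposes = λ u → solve 2 (λ y s → y := y :- s :+ s) refl (y u) (sum (λ i → w i * x i u))
      }
      where
      open Decomposition dec renaming (eigenvalue to θ; component to x)
      w : Fin d → ℝ
      w i = weight t (θ i)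
      e : Fin d → ℝ
      e i = 1# + - (w i * (θ i + - t))
      z : Vector ℝ n
      z u = y u + - sum (λ i → w i * x i u)

      shift-z : shift K t z ≈ᵥ λ u → sum (λ i → e i * x i u)
      shift-z u = begin-equality
        shift K t z u
          ≈⟨ shift-cong K t (λ v → +-congˡ (trans (sum-neg (λ i → w i * x i v)) (sum-cong-≋ (λ i → -‿distribˡ-* (w i) (x i v))))) u ⟩
        shift K t (y +ᵥ (λ v → sum (λ i → - w i * x i v))) u
          ≈⟨ shift-+ K t y (λ v → sum (λ i → - w i * x i v)) u ⟩
        shift K t y u + shift K t (λ v → sum (λ i → - w i * x i v)) u
          ≈⟨ +-cong (decomposes u) (shift-sum t (λ i → - w i · x i) u) ⟩
        sum (λ i → x i u) + sum (λ i → shift K t (- w i · x i) u)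
          ≈⟨ ∑-distrib-+ (λ i → x i u) (λ i → shift K t (- w i · x i) u) ⟨
        sum (λ i → x i u + shift K t (- w i · x i) u)
          ≈⟨ sum-cong-≋ (λ i → trans (+-congˡ (trans (shift-· K t (- w i) (x i) u)
               (trans (sym (-‿distribˡ-* _ _)) (-‿cong (*-congˡ (shift-eigen t (isEigen i) u))))))
               (weight-term t (θ i) (x i u))) ⟩
        sum (λ i → e i * x i u) ∎

      shift²-z : shift K t (shift K t z) ≈ᵥ 𝟎
      shift²-z u = begin-equality
        shift K t (shift K t z) u ≈⟨ shift-cong K t shift-z u ⟩
        shift K t (λ v → sum (λ i → e i * x i v)) u ≈⟨ shift-sum t (λ i → e i · x i) u ⟩
        sum (λ i → shift K t (e i · x i) u) ≈⟨ sum-zero {d} _ (λ i → trans (shift-· K t (e i) (x i) u)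
          (trans (*-congˡ (shift-eigen t (isEigen i) u)) (trans (sym (*-assoc _ _ _)) (trans (*-congʳ (weight-spec t (θ i))) (zeroˡ _))))) ⟩
        0# ∎

      |s|²≈0 : norm² (shift K t z) ≈ 0#
      |s|²≈0 = trans (shift-selfAdjoint t z (shift K t z)) (dot-zeroʳ z (shift K t (shift K t z)) shift²-z)

    module _ {d} (p : Vec ℝ (suc d)) {y} (py≈0 : eval K 1# p y ≈ᵥ 𝟎) {t} (p[t]≈0 : evalₛ 1# p t ≈ 0#) where

      quotient-kills : shift K t (eval K 1# (quotient 1# p t) y) ≈ᵥ 𝟎
      quotient-kills u = begin-equality
        shift K t (eval K 1# (quotient 1# p t) y) u
          ≈⟨ trans (+-congʳ (trans (*-congʳ p[t]≈0) (zeroˡ _))) (+-identityˡ _) ⟨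
        evalₛ 1# p t * y u + shift K t (eval K 1# (quotient 1# p t) y) u
          ≈⟨ eval-quotient K 1# p t y u ⟨
        eval K 1# p y u
          ≈⟨ py≈0 u ⟩
        0# ∎

      root⇒eigenvector : Minimal (suc d) y → ∃[ x ] K *ᵥ x ≈ᵥ t · x × ¬ (dot x y ≈ 0#)
      root⇒eigenvector y-min = x , Kx≈tx , λ xy≈0 → norm²≉0 {x = x} (y-min ℕ.≤-refl q) (begin-equality
        dot x x ≈⟨ eval-selfAdjoint K K-sa 1# q y x ⟩
        dot y (eval K 1# q x) ≈⟨ dot-congʳ y (eval-eigen K 1# q t x Kx≈tx) ⟩
        dot y (evalₛ 1# q t · x) ≈⟨ dot-·ʳ (evalₛ 1# q t) y x ⟩
        evalₛ 1# q t * dot y x ≈⟨ *-congˡ (trans (dot-comm y x) xy≈0) ⟩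
        evalₛ 1# q t * 0# ≈⟨ zeroʳ _ ⟩
        0# ∎)
        where
        q = quotient 1# p t
        x = eval K 1# q y
        Kx≈tx : K *ᵥ x ≈ᵥ t · x
        Kx≈tx = shift≈0⇒eigen {t} {x} quotient-kills

    record Spectrum {d} (p : Vec ℝ d) (y : Vector ℝ n) : Set where
      field
        decomposition : Decomposition d y
      open Decomposition decomposition public
      field
        isRoot : ∀ i → evalₛ 1# p (eigenvalue i) ≈ 0#
        trace  : sum eigenvalue ≈ - subleading p

    -- Induction on the degree: for a root t of p, the quotient q is minimal for (K - t) y, and
    -- `extend` lifts the decomposition of that vector to one of y with the additional eigenvalue t.
    -- The trace follows Vieta's formula along the way.
    spectrum : ∀ {d} (p : Vec ℝ d) y → Minimal d y → eval K 1# p y ≈ᵥ 𝟎 → Spectrum p y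
    spectrum [] y y-min py≈0 = record
      { decomposition = record
        { eigenvalue = λ ()
        ; component  = λ ()
        ; isEigen    = λ ()
        ; decomposes = λ u → trans (sym (eval-[] y u)) (py≈0 u)
        }
      ; isRoot = λ ()
      ; trace  = sym -0#≈0#
      }
    spectrum {suc d} p@(_ ∷ _) y y-min py≈0 = record
      { decomposition = extend t y decomposition
      ; isRoot = λ { Fin.zero → p[t]≈0
                   ; (Fin.suc i) → trans (quotient-eval 1# p (eigenvalue i) t)
                       (trans (+-cong p[t]≈0 (trans (*-congˡ (isRoot i)) (zeroʳ _))) (+-identityˡ 0#)) }
      ; trace = trans (+-congˡ (trans trace (-‿cong (subleading-quotient p t p[t]≈0))))
          (solve 2 (λ t s → t :- (s :+ t) := :- s) refl t (subleading p))
      }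
      where
      -- Minimality against the constant polynomial 1 says that y is nonzero.
      root = real-root p y (λ y≈0 → y-min (ℕ.s≤s ℕ.z≤n) [] (λ u → trans (eval-[] y u) (y≈0 u))) py≈0
      t = proj₁ root
      p[t]≈0 = proj₂ root
      q = quotient 1# p t
      open Spectrum (spectrum q (shift K t y)
        (λ j<d r rs≈0 → y-min (ℕ.s≤s j<d) (timesLinear t r) (λ u → trans (eval-timesLinear K r t y u) (rs≈0 u)))
        (λ u → trans (eval-shift K 1# q t y u) (quotient-kills p py≈0 p[t]≈0 u)))

-- Rational reals, Gaussian elimination and rational minimal polynomials.

module Rationality (em : ExcludedMiddle 0ℓ) (R : CompleteOrderedField) where
  open OrderedField em R
  open SpectralTheory em R using (Minimal)
  open PartialOrderReasoning poset

  fromℤ≈ι : ∀ i → fromℤ i ≈ ι i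
  fromℤ≈ι (+ n)    = refl
  fromℤ≈ι -[1+ n ] = refl

  least-witness : (P : ℕ → Set) → ∃ P → ∃[ d ] P d × (∀ {j} → j ℕ.< d → ¬ P j)
  least-witness P (d , Pd) = ℕ.<-rec (λ d → P d → ∃[ d ] P d × (∀ {j} → j ℕ.< d → ¬ P j))
    (λ d rec Pd → by-cases (λ (j , j<d , Pj) → rec j<d Pj) (λ none → d , Pd , λ {j} j<d Pj → none (j , j<d , Pj))) d Pd

  -- Fractions that need not be reduced, so that sums and products can be formed without passing
  -- through the normal form of `ℚ`.
  Fraction : ℝ → Set
  Fraction x = ∃[ p ] ∃[ d ] x * ι (+ suc d) ≈ ι p

  private
    ι-pos≉0 : ∀ d → ¬ (ι (+ suc d) ≈ 0#)
    ι-pos≉0 d = pos⇒≉0 (fromℕ-suc-pos d)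

  rational⇒fraction : ∀ {x} → IsRational x → Fraction x
  rational⇒fraction {x} (ℚ.mkℚ p d c , x≈q) = p , d , (begin-equality
    x * ι (+ suc d) ≈⟨ *-congʳ x≈q ⟩
    fromℤ p * ι (+ suc d) ⁻¹ * ι (+ suc d) ≈⟨ trans (*-assoc _ _ _) (*-congˡ (trans (*-comm _ _) (*-inverseʳ _ (ι-pos≉0 d)))) ⟩
    fromℤ p * 1# ≈⟨ trans (*-identityʳ _) (fromℤ≈ι p) ⟩
    ι p ∎)

  fraction⇒rational : ∀ {x} → Fraction x → IsRational x
  fraction⇒rational {x} (p , d , xd≈p) = q , *-cancelˡ (ι (↧ q)) Q≉0 (*-cancelˡ (ι (+ suc d)) (ι-pos≉0 d) (begin-equality
    D * (Q * x) ≈⟨ solve 3 (λ D Q x → D :* (Q :* x) := x :* D :* Q) refl D Q x ⟩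
    x * D * Q ≈⟨ *-congʳ xd≈p ⟩
    ι p * Q ≈⟨ ι-* p (↧ q) ⟨
    ι (p ℤ.* ↧ q) ≡⟨ ≡.cong ι cross ⟩
    ι (↥ q ℤ.* + suc d) ≈⟨ ι-* (↥ q) (+ suc d) ⟩
    ι (↥ q) * D ≈⟨ trans (*-comm _ _) (*-congˡ (sym (trans (*-congˡ (*-congʳ (fromℤ≈ι (↥ q))))
                                          (trans (solve 3 (λ Q n E → Q :* (n :* E) := Q :* E :* n) refl Q (ι (↥ q)) (Q ⁻¹))
                                            (trans (*-congʳ (*-inverseʳ Q Q≉0)) (*-identityˡ _)))))) ⟩
    D * (Q * fromℚ q) ∎))
    where
    q = p ℚ./ suc d
    D = ι (+ suc d)
    Q = ι (↧ q)
    Q≉0 = ι-pos≉0 (ℚ.denominator-1 q)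
    g = ℤ.gcd p (+ suc d)
    cross : p ℤ.* ↧ q ≡ ↥ q ℤ.* + suc d
    cross = ≡.trans (≡.cong (ℤ._* ↧ q) (≡.sym (ℚ.↥-/ p (suc d))))
      (≡.trans (ℤ.*-assoc (↥ q) g (↧ q)) (≡.cong (↥ q ℤ.*_) (≡.trans (ℤ.*-comm g (↧ q)) (ℚ.↧-/ p (suc d)))))

  rational-cong : ∀ {x y} → x ≈ y → IsRational x → IsRational y
  rational-cong x≈y (q , x≈q) = q , trans (sym x≈y) x≈q

  ι-rational : ∀ i → IsRational (ι i)
  ι-rational i = fraction⇒rational (i , 0 , trans (*-congˡ (+-identityʳ 1#)) (*-identityʳ _))

  0-rational : IsRational 0#
  0-rational = ι-rational 0ℤ

  1-rational : IsRational 1#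
  1-rational = rational-cong (+-identityʳ 1#) (ι-rational 1ℤ)

  +-rational : ∀ {x y} → IsRational x → IsRational y → IsRational (x + y)
  +-rational {x} {y} x∈ℚ y∈ℚ =
    let p , d , xd≈p = rational⇒fraction x∈ℚ
        q , e , ye≈q = rational⇒fraction y∈ℚ
        D = ι (+ suc d)
        E = ι (+ suc e)
    -- The number `e + d * suc e` is the predecessor of `suc d * suc e`, by computation.
    in fraction⇒rational (p ℤ.* + suc e ℤ.+ q ℤ.* + suc d , e ℕ.+ d ℕ.* suc e , (begin-equality
      (x + y) * ι (+ suc d ℤ.* + suc e) ≈⟨ *-congˡ (ι-* (+ suc d) (+ suc e)) ⟩
      (x + y) * (D * E) ≈⟨ solve 4 (λ x y D E → (x :+ y) :* (D :* E) := x :* D :* E :+ y :* E :* D) refl x y D E ⟩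
      x * D * E + y * E * D ≈⟨ +-cong (*-congʳ xd≈p) (*-congʳ ye≈q) ⟩
      ι p * E + ι q * D ≈⟨ trans (ι-+ (p ℤ.* + suc e) (q ℤ.* + suc d)) (+-cong (ι-* p (+ suc e)) (ι-* q (+ suc d))) ⟨
      ι (p ℤ.* + suc e ℤ.+ q ℤ.* + suc d) ∎))

  *-rational : ∀ {x y} → IsRational x → IsRational y → IsRational (x * y)
  *-rational {x} {y} x∈ℚ y∈ℚ =
    let p , d , xd≈p = rational⇒fraction x∈ℚ
        q , e , ye≈q = rational⇒fraction y∈ℚ
        D = ι (+ suc d)
        E = ι (+ suc e)
    in fraction⇒rational (p ℤ.* q , e ℕ.+ d ℕ.* suc e , (begin-equality
      x * y * ι (+ suc d ℤ.* + suc e) ≈⟨ *-congˡ (ι-* (+ suc d) (+ suc e)) ⟩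
      x * y * (D * E) ≈⟨ solve 4 (λ x y D E → x :* y :* (D :* E) := x :* D :* (y :* E)) refl x y D E ⟩
      x * D * (y * E) ≈⟨ *-cong xd≈p ye≈q ⟩
      ι p * ι q ≈⟨ ι-* p q ⟨
      ι (p ℤ.* q) ∎))

  neg-rational : ∀ {x} → IsRational x → IsRational (- x)
  neg-rational {x} x∈ℚ = rational-cong (trans (sym (-‿distribˡ-* 1# x)) (-‿cong (*-identityˡ x)))
    (*-rational (rational-cong (-‿cong (+-identityʳ 1#)) (ι-rational -[1+ 0 ])) x∈ℚ)

  ⁻¹-rational : ∀ {x} → ¬ (x ≈ 0#) → IsRational x → IsRational (x ⁻¹)
  ⁻¹-rational {x} x≉0 x∈ℚ = fraction⇒rational (invert (rational⇒fraction x∈ℚ))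
    where
    swap : ∀ {D P} → x * D ≈ P → x ⁻¹ * P ≈ D
    swap {D} xD≈P = trans (*-congˡ (sym xD≈P)) (⁻¹-cancelˡ D x≉0)
    invert : Fraction x → Fraction (x ⁻¹)
    invert (+ zero , d , xd≈p)  = ⊥-elim (x≉0 (*≈0 (trans (*-comm _ _) xd≈p) (ι-pos≉0 d)))
    invert (+ suc n , d , xd≈p)   = + suc d , n , swap xd≈p
    invert (-[1+ n ] , d , xd≈p) = -[1+ d ] , n , trans (sym (-‿involutive _)) (-‿cong (trans (-‿distribʳ-* _ _) (swap xd≈p)))

  nonneg-fraction : ∀ {x} → 0# ≤ x → IsRational x → ∃[ a ] ∃[ d ] x * fromℕ (suc d) ≈ fromℕ a
  nonneg-fraction {x} 0≤x x∈ℚ = go (rational⇒fraction x∈ℚ)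
    where
    go : Fraction x → ∃[ a ] ∃[ d ] x * fromℕ (suc d) ≈ fromℕ a
    go (+ a , d , eq)      = a , d , eq
    go (-[1+ n ] , d , eq) = ⊥-elim (<⇒≱ (fromℕ-suc-pos n) (begin
      fromℕ (suc n) ≈⟨ -‿involutive _ ⟨
      - - fromℕ (suc n) ≤⟨ neg-mono-≤ (≤-trans (*-nonNeg 0≤x (fromℕ-nonneg (suc d))) (≤-reflexive eq)) ⟩
      - 0# ≈⟨ -0#≈0# ⟩
      0# ∎))

  sum-rational : ∀ {n} (f : Fin n → ℝ) → (∀ i → IsRational (f i)) → IsRational (sum f)
  sum-rational {zero} f f∈ℚ = 0-rational
  sum-rational {suc n}  f f∈ℚ = +-rational (f∈ℚ Fin.zero) (sum-rational (f ∘ Fin.suc) (f∈ℚ ∘ Fin.suc))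

  dot-rational : ∀ {n} (x y : Vector ℝ n) → (∀ i → IsRational (x i)) → (∀ i → IsRational (y i)) → IsRational (dot x y)
  dot-rational x y x∈ℚ y∈ℚ = sum-rational _ (λ i → *-rational (x∈ℚ i) (y∈ℚ i))

  basis-rational : ∀ {n} (v u : Fin n) → IsRational (basis v u)
  basis-rational v u with v Fin.≟ u
  ... | yes _ = 1-rational
  ... | no _  = 0-rational

  RationalMatrix : ∀ {n} → Matrix ℝ n → Set
  RationalMatrix M = ∀ u v → IsRational (M u v)

  ^ₘ-rational : ∀ {n} (M : Matrix ℝ n) → RationalMatrix M → ∀ k → RationalMatrix (M ^ₘ k)
  ^ₘ-rational M M∈ℚ zero  u v = basis-rational u v
  ^ₘ-rational M M∈ℚ (suc k) u v = sum-rational _ (λ w → *-rational (M∈ℚ u w) (^ₘ-rational M M∈ℚ k w v))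

  RationalSolution : ∀ {k d} → (Fin k → Vector ℝ d) → Set
  RationalSolution rows = ∃[ c ] (∀ i → IsRational (c i)) × ¬ (c ≈ᵥ 𝟎) × (∀ i → dot (rows i) c ≈ 0#)

  Injective : ∀ {k d} → (Fin k → Vector ℝ d) → Set
  Injective rows = ∀ c → (∀ i → dot (rows i) c ≈ 0#) → c ≈ᵥ 𝟎

  private
    module Pivot {d} (r : Vector ℝ (suc d)) (h≉0 : ¬ (r Fin.zero ≈ 0#)) where
      h = r Fin.zero

      ratio : Vector ℝ (suc d) → ℝ
      ratio s = s Fin.zero * h ⁻¹

      reduce : Vector ℝ (suc d) → Vector ℝ d
      reduce s = (s ∘ Fin.suc) +ᵥ - ratio s · (r ∘ Fin.suc)

      dot-reduce : ∀ s c → dot (reduce s) c ≈ dot (s ∘ Fin.suc) c + - (ratio s * dot (r ∘ Fin.suc) c)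
      dot-reduce s c = trans (dot-+ˡ (s ∘ Fin.suc) (- ratio s · (r ∘ Fin.suc)) c)
        (+-congˡ (trans (dot-·ˡ (- ratio s) (r ∘ Fin.suc) c) (sym (-‿distribˡ-* _ _))))

      back : Vector ℝ d → Vector ℝ (suc d)
      back c = - (h ⁻¹ * dot (r ∘ Fin.suc) c) Vector.∷ c

      back-pivot : ∀ c → dot r (back c) ≈ 0#
      back-pivot c = begin-equality
        h * - (h ⁻¹ * t) + t ≈⟨ solve 3 (λ h e t → h :* :- (e :* t) :+ t := t :- h :* e :* t) refl h (h ⁻¹) t ⟩
        t + - (h * h ⁻¹ * t) ≈⟨ x≈y⇒x-y≈0 (sym (trans (*-congʳ (*-inverseʳ h h≉0)) (*-identityˡ t))) ⟩
        0# ∎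
        where t = dot (r ∘ Fin.suc) c

      back-row : ∀ s c → dot (reduce s) c ≈ 0# → dot s (back c) ≈ 0#
      back-row s c reduced≈0 = begin-equality
        s Fin.zero * - (h ⁻¹ * t) + dot (s ∘ Fin.suc) c ≈⟨ solve 4 (λ s e t u → s :* :- (e :* t) :+ u := u :- s :* e :* t) refl (s Fin.zero) (h ⁻¹) t (dot (s ∘ Fin.suc) c) ⟩
        dot (s ∘ Fin.suc) c + - (ratio s * t) ≈⟨ dot-reduce s c ⟨
        dot (reduce s) c ≈⟨ reduced≈0 ⟩
        0# ∎
        where t = dot (r ∘ Fin.suc) c

      reduce-row : ∀ s c → dot r c ≈ 0# → dot s c ≈ 0# → dot (reduce s) (c ∘ Fin.suc) ≈ 0#
      reduce-row s c rc≈0 sc≈0 = begin-equality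
        dot (reduce s) (c ∘ Fin.suc)
          ≈⟨ dot-reduce s (c ∘ Fin.suc) ⟩
        u + - (ratio s * t)
          ≈⟨ trans (+-congʳ (-‿cong (zeroʳ _))) (trans (+-congʳ -0#≈0#) (+-identityˡ _)) ⟨
        -- The solver treats `h ⁻¹` as an atom, so the relation h h⁻¹ = 1 is supplied as a vanishing
        -- summand.
        - (s₀ * c₀ * 0#) + (u + - (ratio s * t))
          ≈⟨ +-congʳ (-‿cong (*-congˡ (x≈y⇒x-y≈0 (*-inverseʳ h h≉0)))) ⟨
        - (s₀ * c₀ * (h * h ⁻¹ + - 1#)) + (u + - (ratio s * t))
          ≈⟨ solve 6 (λ s c h e t u → :- (s :* c :* (h :* e :- con 1ℤ)) :+ (u :- s :* e :* t) := s :* c :+ u :- s :* e :* (h :* c :+ t)) refl s₀ c₀ h (h ⁻¹) t u ⟩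
        dot s c + - (ratio s * dot r c)
          ≈⟨ +-cong sc≈0 (trans (-‿cong (trans (*-congˡ rc≈0) (zeroʳ _))) -0#≈0#) ⟩
        0# + 0#
          ≈⟨ +-identityˡ 0# ⟩
        0# ∎
        where
        s₀ = s Fin.zero
        c₀ = c Fin.zero
        t = dot (r ∘ Fin.suc) (c ∘ Fin.suc)
        u = dot (s ∘ Fin.suc) (c ∘ Fin.suc)

      head≈0 : ∀ c → dot r c ≈ 0# → c ∘ Fin.suc ≈ᵥ 𝟎 → c Fin.zero ≈ 0#
      head≈0 c rc≈0 tail≈0 = *≈0 (trans (sym (trans (+-congˡ (dot-zeroʳ (r ∘ Fin.suc) (c ∘ Fin.suc) tail≈0)) (+-identityʳ _))) rc≈0) h≉0

    punch-cases : ∀ {k} (P : Fin (suc k) → Set) j → P j → (∀ i → P (punchIn j i)) → ∀ i → P i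
    punch-cases P j Pj Pin i with j Fin.≟ i
    ... | yes ≡.refl = Pj
    ... | no j≢i     = ≡.subst P (Fin.punchIn-punchOut j≢i) (Pin (punchOut j≢i))

  -- Gaussian elimination on the first unknown. With rational entries all pivots are rational, so
  -- the dichotomy sets a rational solution against injectivity on all real vectors. The bound
  -- `d ≤ k` counts pivots and excludes the second case when there are more unknowns than equations.
  elimination : ∀ {d k} (rows : Fin k → Vector ℝ d) → (∀ i j → IsRational (rows i j)) →
                RationalSolution rows ⊎ (d ℕ.≤ k × Injective rows)
  elimination {zero} rows rows∈ℚ = inj₂ (ℕ.z≤n , λ c _ ())
  elimination {suc d} {zero} rows rows∈ℚ =
    inj₁ ((λ _ → 1#) , (λ _ → 1-rational) , (λ c≈0 → 1≉0 (c≈0 Fin.zero)) , λ ())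
  elimination {suc d} {suc k} rows rows∈ℚ = by-cases pivoted unpivoted
    where
    Goal = RationalSolution rows ⊎ (suc d ℕ.≤ suc k × Injective rows)

    pivoted : ∃[ j ] ¬ (rows j Fin.zero ≈ 0#) → Goal
    pivoted (j , h≉0) = Sum.map lift-solution lift-injective (elimination {d} {k} (λ i → reduce (rows (punchIn j i))) reduced∈ℚ)
      where
      open Pivot (rows j) h≉0
      reduced∈ℚ : ∀ i u → IsRational (reduce (rows (punchIn j i)) u)
      reduced∈ℚ i u = +-rational (rows∈ℚ (punchIn j i) (Fin.suc u))
        (*-rational (neg-rational (*-rational (rows∈ℚ (punchIn j i) Fin.zero) (⁻¹-rational h≉0 (rows∈ℚ j Fin.zero)))) (rows∈ℚ j (Fin.suc u)))

      lift-solution : RationalSolution (λ i → reduce (rows (punchIn j i))) → RationalSolution rows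
      lift-solution (c , c∈ℚ , c≉0 , solves) = back c ,
        (λ { Fin.zero → neg-rational (*-rational (⁻¹-rational h≉0 (rows∈ℚ j Fin.zero)) (dot-rational _ c (λ i → rows∈ℚ j (Fin.suc i)) c∈ℚ))
           ; (Fin.suc i) → c∈ℚ i }) ,
        (λ back≈0 → c≉0 (back≈0 ∘ Fin.suc)) ,
        punch-cases (λ i → dot (rows i) (back c) ≈ 0#) j (back-pivot c) (λ i → back-row (rows (punchIn j i)) c (solves i))

      lift-injective : d ℕ.≤ k × Injective (λ i → reduce (rows (punchIn j i))) → suc d ℕ.≤ suc k × Injective rows
      lift-injective (d≤k , inj) = ℕ.s≤s d≤k , λ c solves →
        let tail≈0 = inj (c ∘ Fin.suc) (λ i → reduce-row (rows (punchIn j i)) c (solves j) (solves (punchIn j i)))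
        in λ { Fin.zero → head≈0 c (solves j) tail≈0 ; (Fin.suc i) → tail≈0 i }

    unpivoted : ¬ (∃[ j ] ¬ (rows j Fin.zero ≈ 0#)) → Goal
    unpivoted none = inj₁ ((1# Vector.∷ 𝟎) ,
      (λ { Fin.zero → 1-rational ; (Fin.suc i) → 0-rational }) ,
      (λ c≈0 → 1≉0 (c≈0 Fin.zero)) ,
      λ i → trans (+-cong (trans (*-identityʳ _) (by-contradiction λ h≉0 → none (i , h≉0))) (dot-zeroʳ (rows i ∘ Fin.suc) 𝟎 (λ _ → refl))) (+-identityˡ 0#))

  -- The real eigenvector x shows that the rational system (K - θ) w = 0 is not injective over ℝ, so
  -- elimination must return a rational solution.
  rational-eigenvector : ∀ {n} (K : Matrix ℝ n) → RationalMatrix K → ∀ {θ} → IsRational θ →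
    ∀ x → ¬ (x ≈ᵥ 𝟎) → K *ᵥ x ≈ᵥ θ · x →
    ∃[ w ] (∀ u → IsRational (w u)) × ¬ (w ≈ᵥ 𝟎) × K *ᵥ w ≈ᵥ θ · w
  rational-eigenvector K K∈ℚ {θ} θ∈ℚ x x≉0 Kx≈θx =
    [ (λ (w , w∈ℚ , w≉0 , solves) → w , w∈ℚ , w≉0 , λ u → x-y≈0⇒x≈y (trans (sym (dot-row u w)) (solves u)))
    , (λ (_ , inj) → ⊥-elim (x≉0 (inj x (λ u → trans (dot-row u x) (x≈y⇒x-y≈0 (Kx≈θx u))))))
    ]′ (elimination rows (λ u v → +-rational (K∈ℚ u v) (*-rational (neg-rational θ∈ℚ) (basis-rational u v))))
    where
    rows = λ u → K u +ᵥ - θ · basis u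
    dot-row : ∀ u y → dot (rows u) y ≈ (K *ᵥ y) u + - (θ * y u)
    dot-row u y = trans (dot-+ˡ (K u) (- θ · basis u) y) (+-congˡ (trans (dot-·ˡ (- θ) (basis u) y)
      (trans (*-congˡ (trans (dot-comm (basis u) y) (dot-basis y u))) (sym (-‿distribˡ-* θ (y u))))))

  module _ {n : ℕ} (K : Matrix ℝ n) (K-sa : SelfAdjoint K) (K∈ℚ : RationalMatrix K) where

    krylov : ∀ {d} → Vector ℝ n → Fin d → Vector ℝ n
    krylov y Fin.zero    = y
    krylov y (Fin.suc i) = krylov (K *ᵥ y) i

    krylov-rational : ∀ {d} y → (∀ u → IsRational (y u)) → ∀ (i : Fin d) u → IsRational (krylov y i u)
    krylov-rational y y∈ℚ Fin.zero    u = y∈ℚ u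
    krylov-rational y y∈ℚ (Fin.suc i) u = krylov-rational (K *ᵥ y) (λ v → dot-rational (K v) y (K∈ℚ v) y∈ℚ) i u

    coefficients : ∀ {j} → Vec ℝ j → Vector ℝ (suc j)
    coefficients []       _           = 1#
    coefficients (c ∷ cs) Fin.zero    = c
    coefficients (c ∷ cs) (Fin.suc i) = coefficients cs i

    coefficients≉0 : ∀ {j} (p : Vec ℝ j) → ¬ (coefficients p ≈ᵥ 𝟎)
    coefficients≉0 []       c≈0 = 1≉0 (c≈0 Fin.zero)
    coefficients≉0 (c ∷ cs) c≈0 = coefficients≉0 cs (c≈0 ∘ Fin.suc)

    dot-coefficients : ∀ {j} (p : Vec ℝ j) y u → dot (λ i → krylov y i u) (coefficients p) ≈ eval K 1# p y u
    dot-coefficients []       y u = trans (+-identityʳ _) (*-comm _ _)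
    dot-coefficients (c ∷ cs) y u = +-cong (*-comm _ _)
      (trans (dot-coefficients cs (K *ᵥ y) u) (eval-*ᵥ K 1# cs y u))

    -- Cuts off the trailing zeros of c: Σ cᵢ Kⁱ = b p(K) with p monic and b the last nonzero entry.
    -- The identity is demanded for all y because the induction replaces y by K y.
    MonicRelation : ∀ {d} → Vector ℝ d → Set
    MonicRelation {d} c = ∃[ j ] j ℕ.< d × ∃[ p ] All IsRational {j} p × ∃[ b ] IsRational b × ¬ (b ≈ 0#) ×
                          (∀ y u → dot (λ i → krylov y i u) c ≈ b * eval K 1# p y u)

    private
      extend-relation : ∀ {d j} (c : Vector ℝ (suc d)) (p : Vec ℝ j) {b} (b≉0 : ¬ (b ≈ 0#)) →
        (∀ y u → dot (λ i → krylov y i u) (c ∘ Fin.suc) ≈ b * eval K 1# p y u) →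
        ∀ y u → dot (λ i → krylov y i u) c ≈ b * eval K 1# ((b ⁻¹ * c Fin.zero) ∷ p) y u
      extend-relation c p {b} b≉0 relation y u = begin-equality
        y u * c₀ + dot (λ i → krylov (K *ᵥ y) i u) (c ∘ Fin.suc)
          ≈⟨ +-cong (*-comm _ _) (trans (relation (K *ᵥ y) u) (*-congˡ (eval-*ᵥ K 1# p y u))) ⟩
        c₀ * y u + b * (K *ᵥ eval K 1# p y) u
          ≈⟨ +-congʳ (trans (sym (*-identityˡ _)) (*-congʳ (sym (*-inverseʳ b b≉0)))) ⟩
        b * b ⁻¹ * (c₀ * y u) + b * (K *ᵥ eval K 1# p y) u
          ≈⟨ solve 5 (λ b e c y z → b :* e :* (c :* y) :+ b :* z := b :* (e :* c :* y :+ z)) refl b (b ⁻¹) c₀ (y u) _ ⟩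
        b * eval K 1# ((b ⁻¹ * c₀) ∷ p) y u ∎
        where c₀ = c Fin.zero

    monic : ∀ {d} (c : Vector ℝ d) → (∀ i → IsRational (c i)) → ¬ (c ≈ᵥ 𝟎) → MonicRelation c
    monic {zero} c c∈ℚ c≉0 = ⊥-elim (c≉0 λ ())
    monic {suc d} c c∈ℚ c≉0 = by-cases constant higher
      where
      c₀ = c Fin.zero
      constant : c ∘ Fin.suc ≈ᵥ 𝟎 → MonicRelation c
      constant tail≈0 = 0 , ℕ.s≤s ℕ.z≤n , [] , [] , c₀ , c∈ℚ Fin.zero ,
        (λ c₀≈0 → c≉0 λ { Fin.zero → c₀≈0 ; (Fin.suc i) → tail≈0 i }) , λ y u →
        trans (+-cong (*-comm _ _) (dot-zeroʳ _ (c ∘ Fin.suc) tail≈0)) (trans (+-identityʳ _) (*-congˡ (sym (*-identityˡ _))))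
      higher : ¬ (c ∘ Fin.suc ≈ᵥ 𝟎) → MonicRelation c
      higher tail≉0 =
        let j , j<d , p , p∈ℚ , b , b∈ℚ , b≉0 , relation = monic (c ∘ Fin.suc) (c∈ℚ ∘ Fin.suc) tail≉0
        in suc j , ℕ.s≤s j<d , (b ⁻¹ * c₀) ∷ p , *-rational (⁻¹-rational b≉0 b∈ℚ) (c∈ℚ Fin.zero) ∷ p∈ℚ , b , b∈ℚ , b≉0 ,
           extend-relation c p b≉0 relation

    MinimalPolynomial : Vector ℝ n → Set
    MinimalPolynomial y = ∃[ d ] ∃[ p ] All IsRational {d} p × eval K 1# p y ≈ᵥ 𝟎 × Minimal K K-sa d y

    -- Elimination over ℚ also decides independence over ℝ, so the rational minimal polynomial of y is
    -- minimal among the real polynomials annihilating y.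
    minimalPolynomial : ∀ y → (∀ u → IsRational (y u)) → MinimalPolynomial y
    minimalPolynomial y y∈ℚ = package (least-witness Kills exists)
      where
      Kills : ℕ → Set
      Kills d = ∃[ p ] All IsRational {d} p × eval K 1# p y ≈ᵥ 𝟎

      kills-of : ∀ {d} → RationalSolution (λ u (i : Fin d) → krylov y i u) → ∃[ j ] j ℕ.< d × Kills j
      kills-of (c , c∈ℚ , c≉0 , solves) =
        let j , j<d , p , p∈ℚ , b , _ , b≉0 , relation = monic c c∈ℚ c≉0
        in j , j<d , p , p∈ℚ , λ u → *≈0 (trans (sym (relation y u)) (solves u)) b≉0

      system : ∀ d → RationalSolution (λ u (i : Fin d) → krylov y i u) ⊎ (d ℕ.≤ n × Injective (λ u (i : Fin d) → krylov y i u))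
      system d = elimination (λ u i → krylov y i u) (λ u i → krylov-rational y y∈ℚ i u)

      exists : ∃ Kills
      -- With n + 1 unknowns and n equations, the injective alternative would give n + 1 ≤ n.
      exists = [ forget , (λ { (n<n , _) → ⊥-elim (ℕ.1+n≰n n<n) }) ]′ (system (suc n))
        where
        forget : RationalSolution (λ u (i : Fin (suc n)) → krylov y i u) → ∃ Kills
        forget sol = proj₁ (kills-of {suc n} sol) , proj₂ (proj₂ (kills-of {suc n} sol))

      minimal : ∀ {d} → (∀ {j} → j ℕ.< d → ¬ Kills j) → Minimal K K-sa d y
      minimal {d} none {j} j<d p py≈0 = [ smaller , independent ]′ (system (suc j))
        where
        smaller : RationalSolution (λ u (i : Fin (suc j)) → krylov y i u) → ⊥
        smaller sol = none (ℕ.<-≤-trans (proj₁ (proj₂ (kills-of {suc j} sol))) j<d) (proj₂ (proj₂ (kills-of {suc j} sol)))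
        independent : suc j ℕ.≤ n × Injective (λ u (i : Fin (suc j)) → krylov y i u) → ⊥
        independent (_ , inj) = coefficients≉0 p (inj (coefficients p) (λ u → trans (dot-coefficients p y u) (py≈0 u)))

      package : ∃[ d ] Kills d × (∀ {j} → j ℕ.< d → ¬ Kills j) → MinimalPolynomial y
      package (d , (p , p∈ℚ , py≈0) , none) = d , p , p∈ℚ , py≈0 , minimal none

-- Columns of exp(-i τ K) from decompositions into eigenvectors.

module MatrixExponential (em : ExcludedMiddle 0ℓ) (R : CompleteOrderedField) where
  open OrderedField em R
  open ComplexRing R
  open Exponential em R
  open SpectralTheory em R using (Decomposition; module Decomposition)
  open Complex R using (ℂ; re; im; ofℝ; 𝕚; ℂ-rawRing; IsExp; expPartialSum)
  private
    module ℂ = CommutativeRing ℂ-commutativeRing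
    module ℂᴸ = LinearAlgebra ℂ-rawRing
    module ℂᴿ = RingLinearAlgebra ℂ-commutativeRing
    module ℂ-Reasoning = SetoidReasoning ℂ.setoid

  sum-ofℝ : ∀ {n} (f : Fin n → ℝ) → ℂᴿ.sum (λ i → ofℝ (f i)) ℂ.≈ ofℝ (sum f)
  sum-ofℝ {n} f = ℂ.trans (sum-components (λ i → ofℝ (f i))) (refl , sum-zero {n} (λ _ → 0#) (λ _ → refl))

  basis-ofℝ : ∀ {n} (v u : Fin n) → ℂᴸ.basis v u ℂ.≈ ofℝ (basis v u)
  basis-ofℝ v u with v Fin.≟ u
  ... | yes _ = refl , refl
  ... | no _  = refl , refl

  *-ofℝ : ∀ z x → z ℂ.* ofℝ x ℂ.≈ (re z * x , im z * x)
  *-ofℝ (a , b) x = solve 3 (λ a b x → a :* x :- b :* con 0ℤ := a :* x) refl a b x ,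
                    solve 3 (λ a b x → a :* con 0ℤ :+ b :* x := b :* x) refl a b x

  factorial-inverse : ∀ j → fromℕ (suc j !) ⁻¹ ≈ inv j * fromℕ (j !) ⁻¹
  factorial-inverse j = *-cancelˡ (fromℕ (suc j !)) (n!≉0 (suc j)) (trans (*-inverseʳ _ (n!≉0 (suc j)))
    (sym (trans (*-congʳ (×1-homo-* (suc j) (j !)))
      (trans (solve 4 (λ a b c d → a :* b :* (c :* d) := a :* c :* (b :* d)) refl (fromℕ (suc j)) (fromℕ (j !)) (inv j) (fromℕ (j !) ⁻¹))
        (trans (*-cong (inv-inverse j) (*-inverseʳ _ (n!≉0 j))) (*-identityˡ 1#))))))
    where
    n!≉0 : ∀ n → ¬ (fromℕ (n !) ≈ 0#)
    n!≉0 n = pos⇒≉0 (fromℕ-pos (ℕ.1≤n! n))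

  term-power : ∀ z j → ofℝ (fromℕ (j !) ⁻¹) ℂ.* z ℂᴿ.^ j ℂ.≈ ℂᴱ.term z j
  term-power = ℂᴱ.term-unique (λ j → ofℝ (fromℕ (j !) ⁻¹))
    (ofℝ-cong (*-cancelˡ (fromℕ 1) (pos⇒≉0 (fromℕ-suc-pos 0)) (trans (inv-inverse 0) (sym (trans (*-identityʳ _) (+-identityʳ 1#))))))
    (λ j → ℂ.trans (ofℝ-cong (factorial-inverse j)) (ℂ.sym (ofℝ-* (inv j) (fromℕ (j !) ⁻¹))))

  module _ {n : ℕ} (K : Matrix ℝ n) (K-sa : SelfAdjoint K) (τ : ℝ) where

    generator : Matrix ℂ n
    generator = (ℂ.- (𝕚 ℂ.* ofℝ τ)) ℂᴸ.·ₘ (λ u v → ofℝ (K u v))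

    generator-eigen : ∀ {θ x} → K *ᵥ x ≈ᵥ θ · x →
                      generator ℂᴸ.*ᵥ (ofℝ ∘ x) ℂᴸ.≈ᵥ -i (τ * θ) ℂᴸ.· (ofℝ ∘ x)
    generator-eigen {θ} {x} Kx≈θx u = begin
      ℂᴿ.sum (λ w → z ℂ.* ofℝ (K u w) ℂ.* ofℝ (x w)) ≈⟨ ℂᴿ.sum-cong-≋ (λ w → ℂ.trans (ℂ.*-assoc z (ofℝ (K u w)) (ofℝ (x w))) (ℂ.*-congˡ {z} (ofℝ-* (K u w) (x w)))) ⟩
      ℂᴿ.sum (λ w → z ℂ.* ofℝ (K u w * x w)) ≈⟨ ℂᴿ.*-distribˡ-sum z (λ w → ofℝ (K u w * x w)) ⟨
      z ℂ.* ℂᴿ.sum (λ w → ofℝ (K u w * x w)) ≈⟨ ℂ.*-congˡ {z} (ℂ.trans (sum-ofℝ (λ w → K u w * x w)) (ofℝ-cong (Kx≈θx u))) ⟩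
      z ℂ.* ofℝ (θ * x u) ≈⟨ identity θ (x u) ⟩
      -i (τ * θ) ℂ.* ofℝ (x u) ∎
      where
      open ℂ-Reasoning
      z = ℂ.- (𝕚 ℂ.* ofℝ τ)
      identity : ∀ θ x → z ℂ.* ofℝ (θ * x) ℂ.≈ -i (τ * θ) ℂ.* ofℝ x
      identity θ x =
        solve 3 (λ τ θ x → :- (con 0ℤ :* τ :- con 1ℤ :* con 0ℤ) :* (θ :* x) :- :- (con 0ℤ :* con 0ℤ :+ con 1ℤ :* τ) :* con 0ℤ
                        := con 0ℤ :* x :- :- (τ :* θ) :* con 0ℤ) refl τ θ x ,
        solve 3 (λ τ θ x → :- (con 0ℤ :* τ :- con 1ℤ :* con 0ℤ) :* con 0ℤ :+ :- (con 0ℤ :* con 0ℤ :+ con 1ℤ :* τ) :* (θ :* x)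
                        := con 0ℤ :* con 0ℤ :+ :- (τ :* θ) :* x) refl τ θ x

    module Column {d} (v : Fin n) (D : Decomposition K K-sa d (basis v)) where
      open Decomposition D renaming (eigenvalue to θ; component to x)

      private
        w : Fin d → ℂ
        w i = -i (τ * θ i)

      power-entry : ∀ j u → (generator ℂᴸ.^ₘ j) u v ℂ.≈ ℂᴿ.sum (λ i → w i ℂᴿ.^ j ℂ.* ofℝ (x i u))
      power-entry j u = begin
        (A^j) u v ≈⟨ ℂᴿ.column A^j v u ⟨
        (A^j ℂᴸ.*ᵥ ℂᴸ.basis v) u ≈⟨ ℂᴿ.*ᵥ-cong A^j (λ u → ℂ.trans (basis-ofℝ v u) (ℂ.trans (ofℝ-cong (decomposes u)) (ℂ.sym (sum-ofℝ (λ i → x i u))))) u ⟩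
        (A^j ℂᴸ.*ᵥ (λ u → ℂᴿ.sum (λ i → ofℝ (x i u)))) u ≈⟨ ℂᴿ.*ᵥ-sum A^j (λ i u → ofℝ (x i u)) u ⟩
        ℂᴿ.sum (λ i → (A^j ℂᴸ.*ᵥ (ofℝ ∘ x i)) u) ≈⟨ ℂᴿ.sum-cong-≋ (λ i → ℂᴿ.^ₘ-eigen generator (w i) (ofℝ ∘ x i) (generator-eigen (isEigen i)) j u) ⟩
        ℂᴿ.sum (λ i → w i ℂᴿ.^ j ℂ.* ofℝ (x i u)) ∎
        where
        open ℂ-Reasoning
        A^j = generator ℂᴸ.^ₘ j

      -- On an eigenvector the matrix series reduces to the scalar one, so after exchanging the two
      -- sums each component carries its own partial sum of e^(-i τ θᵢ).
      expPartialSum-entry : ∀ m u → expPartialSum generator m u v ℂ.≈ ℂᴿ.sum (λ i → ℂᴱ.expSum (w i) m ℂ.* ofℝ (x i u))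
      expPartialSum-entry m u = begin
        ℂᴿ.sum {m} (λ j → c j ℂ.* (generator ℂᴸ.^ₘ toℕ j) u v)
          ≈⟨ ℂᴿ.sum-cong-≋ {m} (λ j → ℂ.trans (ℂ.*-congˡ {c j} (power-entry (toℕ j) u)) (ℂᴿ.*-distribˡ-sum (c j) (λ i → w i ℂᴿ.^ toℕ j ℂ.* ofℝ (x i u)))) ⟩
        ℂᴿ.sum {m} (λ j → ℂᴿ.sum (λ i → c j ℂ.* (w i ℂᴿ.^ toℕ j ℂ.* ofℝ (x i u))))
          ≈⟨ ℂᴿ.sum-cong-≋ {m} (λ j → ℂᴿ.sum-cong-≋ (λ i → ℂ.trans (ℂ.sym (ℂ.*-assoc (c j) (w i ℂᴿ.^ toℕ j) (ofℝ (x i u))))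
               (ℂ.*-congʳ {ofℝ (x i u)} (term-power (w i) (toℕ j))))) ⟩
        ℂᴿ.sum {m} (λ j → ℂᴿ.sum (λ i → ℂᴱ.term (w i) (toℕ j) ℂ.* ofℝ (x i u)))
          ≈⟨ ℂᴿ.∑-comm {m} (λ j i → ℂᴱ.term (w i) (toℕ j) ℂ.* ofℝ (x i u)) ⟩
        ℂᴿ.sum (λ i → ℂᴿ.sum {m} (λ j → ℂᴱ.term (w i) (toℕ j) ℂ.* ofℝ (x i u)))
          ≈⟨ ℂᴿ.sum-cong-≋ (λ i → ℂᴿ.*-distribʳ-sum {m} (ofℝ (x i u)) (λ j → ℂᴱ.term (w i) (toℕ j))) ⟨
        ℂᴿ.sum (λ i → ℂᴱ.expSum (w i) m ℂ.* ofℝ (x i u)) ∎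
        where
        open ℂ-Reasoning
        c : Fin m → ℂ
        c j = ofℝ (fromℕ (toℕ j !) ⁻¹)

      cosineColumn sineColumn : Vector ℝ n
      cosineColumn u = sum (λ i → x i u * cosine (τ * θ i))
      sineColumn   u = sum (λ i → x i u * sine (τ * θ i))

      re-column⟶ : ∀ u → (λ m → re (expPartialSum generator m u v)) ⟶ cosineColumn u
      re-column⟶ u = ⟶-cong
        (λ m → sym (trans (proj₁ (expPartialSum-entry m u)) (trans (proj₁ (sum-components (λ i → ℂᴱ.expSum (w i) m ℂ.* ofℝ (x i u))))
          (sum-cong-≋ (λ i → trans (proj₁ (*-ofℝ (ℂᴱ.expSum (w i) m) (x i u))) (*-comm _ _))))))
        refl (⟶-sum (λ i m → x i u * cosSum (τ * θ i) m) (λ i → x i u * cosine (τ * θ i))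
          (λ i → ⟶-*ˡ (x i u) (cosSum⟶cosine (τ * θ i))))

      im-column⟶ : ∀ u → (λ m → im (expPartialSum generator m u v)) ⟶ sineColumn u
      im-column⟶ u = ⟶-cong
        (λ m → sym (trans (proj₂ (expPartialSum-entry m u)) (trans (proj₂ (sum-components (λ i → ℂᴱ.expSum (w i) m ℂ.* ofℝ (x i u))))
          (sum-cong-≋ (λ i → trans (proj₂ (*-ofℝ (ℂᴱ.expSum (w i) m) (x i u))) (*-comm _ _))))))
        refl (⟶-sum (λ i m → x i u * sinSum (τ * θ i) m) (λ i → x i u * sine (τ * θ i))
          (λ i → ⟶-*ˡ (x i u) (sinSum⟶sine (τ * θ i))))

    open Column

    -- exp(-i τ K) e_a = γ e_b, read off in real and imaginary parts from a spectral decomposition of e_a.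
    Transfer : ∀ {d} a → Decomposition K K-sa d (basis a) → ℂ → Fin n → Set
    Transfer a D γ b = (∀ u → cosineColumn a D u ≈ re γ * basis b u) × (∀ u → sineColumn a D u ≈ im γ * basis b u)

    γ-basis : ∀ γ (b u : Fin n) → γ ℂ.* ℂᴸ.basis b u ℂ.≈ (re γ * basis b u , im γ * basis b u)
    γ-basis γ b u = ℂ.trans (ℂ.*-congˡ {γ} (basis-ofℝ b u)) (*-ofℝ γ (basis b u))

    exp⇒transfer : ∀ a b {γ U} → IsExp generator U → U ℂᴸ.*ᵥ ℂᴸ.basis a ℂᴸ.≈ᵥ γ ℂᴸ.· ℂᴸ.basis b →
                   ∀ {d} (D : Decomposition K K-sa d (basis a)) → Transfer a D γ b
    exp⇒transfer a b {γ} {U} U-exp Ua≈γb D =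
      (λ u → trans (⟶-unique (re-column⟶ a D u) (ConvergesTo⇒⟶ (proj₁ (U-exp u a)))) (proj₁ (entry u))) ,
      (λ u → trans (⟶-unique (im-column⟶ a D u) (ConvergesTo⇒⟶ (proj₂ (U-exp u a)))) (proj₂ (entry u)))
      where
      entry : ∀ u → U u a ℂ.≈ (re γ * basis b u , im γ * basis b u)
      entry u = ℂ.trans (ℂ.sym (ℂᴿ.column U a u)) (ℂ.trans (Ua≈γb u) (γ-basis γ b u))

    -- The witness has to be the whole exponential, so every basis vector needs a decomposition. The
    -- one used for column a may differ from `D`; uniqueness of limits reconciles the two.
    transfer⇒exp : (∀ v → ∃[ d ] Decomposition K K-sa d (basis v)) → ∀ a b {γ d} (D : Decomposition K K-sa d (basis a)) →
                   Transfer a D γ b → ∃[ U ] IsExp generator U × U ℂᴸ.*ᵥ ℂᴸ.basis a ℂᴸ.≈ᵥ γ ℂᴸ.· ℂᴸ.basis b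
    transfer⇒exp dec a b {γ} D (re-transfer , im-transfer) = U ,
      (λ u v → ⟶⇒ConvergesTo (re-column⟶ v (proj₂ (dec v)) u) , ⟶⇒ConvergesTo (im-column⟶ v (proj₂ (dec v)) u)) ,
      λ u → ℂ.trans (ℂᴿ.column U a u) (ℂ.trans
        (trans (⟶-unique (re-column⟶ a (proj₂ (dec a)) u) (re-column⟶ a D u)) (re-transfer u) ,
         trans (⟶-unique (im-column⟶ a (proj₂ (dec a)) u) (im-column⟶ a D u)) (im-transfer u))
        (ℂ.sym (γ-basis γ b u)))
      where
      U : Matrix ℂ n
      U u v = cosineColumn v (proj₂ (dec v)) u , sineColumn v (proj₂ (dec v)) u

-- Removing the common power of two from finitely many naturals.

module OddParts where

  even⇒double : ∀ n → parity n ≡ 0ℙ → ∃[ h ] n ≡ 2 ℕ.* h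
  even⇒double zero        _    = 0 , ≡.refl
  even⇒double (suc (suc n)) even =
    let h , n≡2h = even⇒double n even in suc h , ≡.trans (≡.cong (2 ℕ.+_) n≡2h) (≡.sym (ℕ.*-suc 2 h))

  -- The exponent is positive because r^0 = 1 is odd for every r.
  parity-^ : ∀ r q → parity (r ℕ.^ suc q) ≡ parity r
  parity-^ r zero  = ≡.cong parity (ℕ.*-identityʳ r)
  parity-^ r (suc q) = ≡.trans (Parity.*-homo-* r (r ℕ.^ suc q)) (≡.trans (≡.cong (parity r Parity.*_) (parity-^ r q)) (Parity.*-idem (parity r)))

  HasOddParts : ∀ {d} → (Fin d → ℕ) → Set
  HasOddParts {d} a = ∃[ s ] Σ[ r ∈ (Fin d → ℕ) ] 0 ℕ.< s × (∀ j → a j ≡ s ℕ.* r j) × ∃[ j ] parity (r j) ≡ 1ℙ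

  -- As long as all entries are even, all are halved; the positive entry `a i` strictly decreases,
  -- so this stops.
  odd-parts : ∀ {d} (a : Fin d → ℕ) i → 0 ℕ.< a i → HasOddParts a
  odd-parts {d} a i = ℕ.<-rec (λ m → ∀ a → a i ≡ m → 0 ℕ.< m → HasOddParts a) step (a i) a ≡.refl
    where
    ≢1ℙ⇒≡0ℙ : ∀ {p} → ¬ (p ≡ 1ℙ) → p ≡ 0ℙ
    ≢1ℙ⇒≡0ℙ {0ℙ} _   = ≡.refl
    ≢1ℙ⇒≡0ℙ {1ℙ} p≢1 = contradiction ≡.refl p≢1

    step : ∀ m → (∀ {m′} → m′ ℕ.< m → ∀ a → a i ≡ m′ → 0 ℕ.< m′ → HasOddParts a) → ∀ a → a i ≡ m → 0 ℕ.< m → HasOddParts a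
    step m rec a ≡.refl 0<m with Fin.any? (λ j → parity (a j) Parity.≟ 1ℙ)
    ... | yes odd = 1 , a , ℕ.s≤s ℕ.z≤n , (λ j → ≡.sym (ℕ.*-identityˡ (a j))) , odd
    ... | no none =
      let s , r , 0<s , h≡sr , odd = rec h<a h ≡.refl 0<h
      in 2 ℕ.* s , r , ℕ.*-mono-< (ℕ.s≤s (ℕ.z≤n {1})) 0<s ,
         (λ j → ≡.trans (a≡2h j) (≡.trans (≡.cong (2 ℕ.*_) (h≡sr j)) (≡.sym (ℕ.*-assoc 2 s (r j))))) , odd
      where
      halves : ∀ j → ∃[ h ] a j ≡ 2 ℕ.* h
      halves j = even⇒double (a j) (≢1ℙ⇒≡0ℙ (λ odd → none (j , odd)))
      h : Fin d → ℕ
      h j = proj₁ (halves j)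
      a≡2h : ∀ j → a j ≡ 2 ℕ.* h j
      a≡2h j = proj₂ (halves j)
      0<h : 0 ℕ.< h i
      0<h = ℕ.n≢0⇒n>0 (λ h≡0 → ℕ.<⇒≢ 0<m (≡.sym (≡.trans (a≡2h i) (≡.cong (2 ℕ.*_) h≡0))))
      h<a : h i ℕ.< a i
      h<a = ≡.subst (h i ℕ.<_) (≡.sym (a≡2h i)) (ℕ.m<m+n (h i) (ℕ.≤-trans 0<h (ℕ.m≤m+n (h i) 0)))

-- Arithmetic consequences of a transfer, and the change of exponent.

module PerfectStateTransfer (em : ExcludedMiddle 0ℓ) (R : CompleteOrderedField) {n : ℕ} where
  open OrderedField em R
  open Exponential em R using (cosine; sine; cosine-cong; sine-cong)
  open Periods em R
  open SpectralTheory em R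
  open Rationality em R
  open MatrixExponential em R
  open Complex R using (ℂ; re; im)
  open OddParts
  open Exp commutativeSemiring using (^-distrib-*; ^-congˡ)
  open PartialOrderReasoning poset

  -- For symmetric K this is membership of θ in the support of `basis a`: the projection of
  -- `basis a` is nonzero exactly when some eigenvector has a nonzero a-entry. In this form it
  -- passes to powers with the same x.
  Supported : Matrix ℝ n → Fin n → ℝ → Set
  Supported K a θ = ∃[ x ] K *ᵥ x ≈ᵥ θ · x × ¬ (x a ≈ 0#)

  supported-cong : ∀ {K a θ θ′} → θ ≈ θ′ → Supported K a θ → Supported K a θ′
  supported-cong θ≈θ′ (x , Kx≈θx , xa≉0) = x , (λ u → trans (Kx≈θx u) (*-congʳ θ≈θ′)) , xa≉0

  record SpectralData (K : Matrix ℝ n) (K-sa : SelfAdjoint K) (v : Fin n) : Set where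
    field
      size          : ℕ
      decomposition : Decomposition K K-sa size (basis v)
    open Decomposition decomposition public
    field
      supported     : ∀ i → Supported K v (eigenvalue i)

  spectralData : ∀ K (K-sa : SelfAdjoint K) → RationalMatrix K → ∀ v →
                 Σ[ S ∈ SpectralData K K-sa v ] IsRational (sum (SpectralData.eigenvalue S))
  spectralData K K-sa K∈ℚ v = package (minimalPolynomial K K-sa K∈ℚ (basis v) (basis-rational v))
    where
    root-supported : ∀ {d} (p : Vec ℝ d) → eval K 1# p (basis v) ≈ᵥ 𝟎 → Minimal K K-sa d (basis v) →
                     (S : Spectrum K K-sa p (basis v)) → ∀ i → Supported K v (Spectrum.eigenvalue S i)
    root-supported p@(_ ∷ _) pv≈0 v-min S i =
      let x , Kx≈θx , xv≉0 = root⇒eigenvector K K-sa p {basis v} pv≈0 (Spectrum.isRoot S i) v-min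
      in x , Kx≈θx , λ x[v]≈0 → xv≉0 (trans (dot-basis x v) x[v]≈0)

    subleading-rational : ∀ {d} (p : Vec ℝ d) → All IsRational p → IsRational (subleading p)
    subleading-rational []            []             = 0-rational
    subleading-rational (c ∷ [])      (c∈ℚ ∷ _)      = c∈ℚ
    subleading-rational (c ∷ c′ ∷ cs) (_ ∷ cs∈ℚ)     = subleading-rational (c′ ∷ cs) cs∈ℚ

    package : MinimalPolynomial K K-sa K∈ℚ (basis v) → Σ[ S ∈ SpectralData K K-sa v ] IsRational (sum (SpectralData.eigenvalue S))
    package (d , p , p∈ℚ , pv≈0 , v-min) =
      record
        { size          = d
        ; decomposition = Spectrum.decomposition S
        ; supported     = root-supported p pv≈0 v-min S
        } ,
      rational-cong (sym (Spectrum.trace S)) (neg-rational (subleading-rational p p∈ℚ))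
      where S = spectrum K K-sa p (basis v) v-min pv≈0

  module Forward (K : Matrix ℝ n) (K-sa : SelfAdjoint K) (a b : Fin n) (b≢a : b ≢ a)
                 (support-nonneg : ∀ θ → Supported K a θ → 0# ≤ θ) (0-supported : Supported K a 0#)
                 (S : SpectralData K K-sa a) (τ : ℝ) (0<τ : 0# < τ) (γ : ℂ)
                 (transfer : Transfer K K-sa τ a (SpectralData.decomposition S) γ b) where
    open SpectralData S renaming (eigenvalue to θ; component to x; size to d)

    -- The transfer equation paired with an eigenvector y: components with θᵢ different from μ are
    -- orthogonal to y, so f(τ θᵢ) may be replaced by f(τ μ) throughout, and Σ ⟨y , xᵢ⟩ is the
    -- a-entry of y.
    project : ∀ (f : ℝ → ℝ) → (∀ {s t} → s ≈ t → f s ≈ f t) → ∀ c →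
              (∀ u → sum (λ i → x i u * f (τ * θ i)) ≈ c * basis b u) →
              ∀ {μ y} → K *ᵥ y ≈ᵥ μ · y → y a * f (τ * μ) ≈ c * y b
    project f f-cong c column {μ} {y} Ky≈μy = begin-equality
      y a * F ≈⟨ *-congʳ (dot-basis y a) ⟨
      dot y (basis a) * F ≈⟨ *-congʳ (trans (dot-congʳ y decomposes) (dot-sumʳ y x)) ⟩
      sum (λ i → dot y (x i)) * F ≈⟨ *-distribʳ-sum F (λ i → dot y (x i)) ⟩
      sum (λ i → dot y (x i) * F) ≈⟨ sum-cong-≋ orthogonality ⟩
      sum (λ i → f (τ * θ i) * dot y (x i)) ≈⟨ sum-cong-≋ (λ i → dot-·ʳ (f (τ * θ i)) y (x i)) ⟨
      sum (λ i → dot y (f (τ * θ i) · x i)) ≈⟨ dot-sumʳ y (λ i → f (τ * θ i) · x i) ⟨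
      dot y (λ u → sum (λ i → f (τ * θ i) * x i u)) ≈⟨ dot-congʳ y (λ u → trans (sum-cong-≋ (λ i → *-comm (f (τ * θ i)) (x i u))) (column u)) ⟩
      dot y (c · basis b) ≈⟨ trans (dot-·ʳ c y (basis b)) (*-congˡ (dot-basis y b)) ⟩
      c * y b ∎
      where
      F = f (τ * μ)
      eigenvalues-agree : ∀ i → μ * dot y (x i) ≈ θ i * dot y (x i)
      eigenvalues-agree i = begin-equality
        μ * dot y (x i)        ≈⟨ dot-·ˡ μ y (x i) ⟨
        dot (μ · y) (x i)      ≈⟨ dot-cong {y = x i} Ky≈μy (λ _ → refl) ⟨
        dot (K *ᵥ y) (x i)     ≈⟨ K-sa y (x i) ⟩
        dot y (K *ᵥ x i)       ≈⟨ dot-congʳ y (isEigen i) ⟩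
        dot y (θ i · x i)      ≈⟨ dot-·ʳ (θ i) y (x i) ⟩
        θ i * dot y (x i)      ∎
      orthogonality : ∀ i → dot y (x i) * F ≈ f (τ * θ i) * dot y (x i)
      orthogonality i = by-cases
        (λ yx≈0 → trans (trans (*-congʳ yx≈0) (zeroˡ _)) (sym (trans (*-congˡ yx≈0) (zeroʳ _))))
        (λ yx≉0 → trans (*-comm _ _) (*-congʳ (f-cong (*-congˡ
          (*-cancelˡ (dot y (x i)) yx≉0 (trans (*-comm _ _) (trans (eigenvalues-agree i) (*-comm _ _))))))))

    -- At eigenvalue 0 the cosine is 1 and the sine is 0, so y_a = re γ y_b and 0 = im γ y_b; the
    -- first equation and y_a ≠ 0 make y_b nonzero.
    im-γ≈0 : im γ ≈ 0#
    im-γ≈0 =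
      let y , Ky≈0 , ya≉0 = 0-supported
          cos-eq = trans (sym (trans (*-congˡ (trans (cosine-cong (zeroʳ τ)) cosine-0)) (*-identityʳ _)))
                     (project cosine cosine-cong (re γ) (proj₁ transfer) {0#} {y} Ky≈0)
          sin-eq = trans (sym (trans (*-congˡ (trans (sine-cong (zeroʳ τ)) sine-0)) (zeroʳ _)))
                     (project sine sine-cong (im γ) (proj₂ transfer) {0#} {y} Ky≈0)
      in *≈0 {y b} (trans (*-comm _ _) (sym sin-eq)) (λ yb≈0 → ya≉0 (trans cos-eq (trans (*-congˡ yb≈0) (zeroʳ _))))

    zero-of-sine : ∀ {μ} → Supported K a μ → sine (τ * μ) ≈ 0#
    zero-of-sine (y , Ky≈μy , ya≉0) =
      *≈0 (trans (project sine sine-cong (im γ) (proj₂ transfer) Ky≈μy) (trans (*-congʳ im-γ≈0) (zeroˡ _))) ya≉0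

    -- If all cosines were 1, the real part of the transferred column would be `basis a`, with
    -- a-entry 1, whereas `basis b` has a-entry 0. The index found here yields the half period and a
    -- nonzero multiple of it.
    nontrivial : ∃[ i ] ¬ (cosine (τ * θ i) ≈ 1#)
    nontrivial = by-contradiction λ none →
      let all≈1 = λ i → by-contradiction λ c≉1 → none (i , c≉1)
      in 1≉0 (begin-equality
        1# ≈⟨ basis-one a ⟨
        basis a a ≈⟨ decomposes a ⟩
        sum (λ i → x i a) ≈⟨ sum-cong-≋ (λ i → trans (*-congˡ (all≈1 i)) (*-identityʳ _)) ⟨
        sum (λ i → x i a * cosine (τ * θ i)) ≈⟨ proj₁ transfer a ⟩
        re γ * basis b a ≈⟨ trans (*-congˡ (basis-zero b a b≢a)) (zeroʳ _) ⟩
        0# ∎)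

    τθ-nonneg : ∀ {μ} → Supported K a μ → 0# ≤ τ * μ
    τθ-nonneg {μ} μ-supp = *-nonNeg (<⇒≤ 0<τ) (support-nonneg μ μ-supp)

    halfPeriod-exists : ∃ HalfPeriod
    halfPeriod-exists =
      let i , c≉1 = nontrivial
      in halfPeriod (nonneg∧≉0⇒pos (τθ-nonneg (supported i)) (λ τθ≈0 → c≉1 (trans (cosine-cong τθ≈0) cosine-0)))
           (zero-of-sine (supported i)) c≉1

    multiples : ∀ {g} → HalfPeriod g → ∀ {μ} → Supported K a μ → ∃[ m ] τ * μ ≈ fromℕ m * g
    multiples (_ , multiple , _) {μ} μ-supp = multiple (τ * μ) (τθ-nonneg μ-supp) (zero-of-sine μ-supp)

    -- τ Σ θᵢ = (Σ mᵢ) g with Σ θᵢ rational and Σ mᵢ > 0, so g / τ is rational.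
    support-rational : IsRational (sum θ) → ∀ {μ} → Supported K a μ → IsRational μ
    support-rational trace-rational {μ} μ-supp =
      let m , τμ≈mg = multiples period μ-supp
      in rational-cong (quotient≈μ m τμ≈mg)
        (*-rational (*-rational (ι-rational (+ m)) trace-rational) (⁻¹-rational ρ≉0 ρ-rational))
      where
      g = proj₁ halfPeriod-exists
      period = proj₂ halfPeriod-exists
      0<g = proj₁ period
      m : Fin d → ℕ
      m i = proj₁ (multiples period (supported i))
      ρ = sum (λ i → fromℕ (m i))
      ρ-rational : IsRational ρ
      ρ-rational = sum-rational _ (λ i → ι-rational (+ m i))
      τtr≈ρg : τ * sum θ ≈ ρ * g
      τtr≈ρg = trans (*-distribˡ-sum τ θ) (trans (sum-cong-≋ (λ i → proj₂ (multiples period (supported i))))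
        (sym (*-distribʳ-sum g (λ i → fromℕ (m i)))))
      -- A vanishing sum of naturals has only zero terms, which would make every phase 1.
      ρ≉0 : ¬ (ρ ≈ 0#)
      ρ≉0 ρ≈0 = let i , c≉1 = nontrivial in c≉1 (trans (cosine-cong (trans (proj₂ (multiples period (supported i)))
        (trans (*-congʳ (sum-nonneg≈0 (λ i → fromℕ (m i)) (λ i → fromℕ-nonneg (m i)) ρ≈0 i)) (zeroˡ g)))) cosine-0)
      quotient≈μ : ∀ m → τ * μ ≈ fromℕ m * g → fromℕ m * sum θ * ρ ⁻¹ ≈ μ
      quotient≈μ m τμ≈mg = *-cancelˡ τ (pos⇒≉0 0<τ) (begin-equality
        τ * (fromℕ m * sum θ * ρ ⁻¹) ≈⟨ solve 4 (λ τ m s r → τ :* (m :* s :* r) := m :* (τ :* s) :* r) refl τ (fromℕ m) (sum θ) (ρ ⁻¹) ⟩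
        fromℕ m * (τ * sum θ) * ρ ⁻¹ ≈⟨ *-congʳ (*-congˡ τtr≈ρg) ⟩
        fromℕ m * (ρ * g) * ρ ⁻¹ ≈⟨ solve 4 (λ m p g r → m :* (p :* g) :* r := p :* r :* (m :* g)) refl (fromℕ m) ρ g (ρ ⁻¹) ⟩
        ρ * ρ ⁻¹ * (fromℕ m * g) ≈⟨ trans (*-congʳ (*-inverseʳ ρ ρ≉0)) (*-identityˡ _) ⟩
        fromℕ m * g ≈⟨ τμ≈mg ⟨
        τ * μ ∎)

  common-denominator : ∀ {d} (ν : Fin d → ℝ) → (∀ i → 0# ≤ ν i) → (∀ i → IsRational (ν i)) →
                       ∃[ D ] Σ[ a ∈ (Fin d → ℕ) ] (∀ i → ν i * fromℕ (suc D) ≈ fromℕ (a i))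
  common-denominator {zero} ν 0≤ν ν∈ℚ = 0 , (λ ()) , λ ()
  common-denominator {suc d}  ν 0≤ν ν∈ℚ =
    let D , a , νD≈a = common-denominator (ν ∘ Fin.suc) (0≤ν ∘ Fin.suc) (ν∈ℚ ∘ Fin.suc)
        a₀ , e , ν₀e≈a₀ = nonneg-fraction (0≤ν Fin.zero) (ν∈ℚ Fin.zero)
    in e ℕ.+ D ℕ.* suc e , (a₀ ℕ.* suc D) Vector.∷ (λ i → a i ℕ.* suc e) , λ
      { Fin.zero    → trans (*-congˡ (trans (×1-homo-* (suc D) (suc e)) (*-comm _ _))) (extend-denominator (ν Fin.zero) a₀ (suc e) (suc D) ν₀e≈a₀)
      ; (Fin.suc i) → trans (*-congˡ (×1-homo-* (suc D) (suc e))) (extend-denominator (ν (Fin.suc i)) (a i) (suc D) (suc e) (νD≈a i))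
      }
    where
    extend-denominator : ∀ x a D E → x * fromℕ D ≈ fromℕ a → x * (fromℕ D * fromℕ E) ≈ fromℕ (a ℕ.* E)
    extend-denominator x a D E xD≈a = trans (sym (*-assoc _ _ _)) (trans (*-congʳ xD≈a) (sym (×1-homo-* a E)))

  fromℕ-^ : ∀ r q → fromℕ (r ℕ.^ q) ≈ fromℕ r ^ q
  fromℕ-^ r zero  = +-identityʳ 1#
  fromℕ-^ r (suc q) = trans (×1-homo-* r (r ℕ.^ q)) (*-congˡ (fromℕ-^ r q))

  ^-pos : ∀ {x} → 0# < x → ∀ q → 0# < x ^ q
  ^-pos 0<x zero  = 0<1
  ^-pos 0<x (suc q) = *-pos 0<x (^-pos 0<x q)

  -- The multiples of `g` may change as long as their parities do not, since the parity alone
  -- decides the cosine.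
  Rescaling : ∀ {d} → (Fin d → ℝ) → ℝ → (Fin d → ℕ) → ℕ → Set
  Rescaling ν g m q = ∃[ τ ] 0# < τ × (∀ j → ∃[ k ] τ * ν j ^ suc q ≈ fromℕ k * g × parity k ≡ parity (m j))

  -- Writing νᵢ = σ rᵢ with naturals rᵢ, not all even, forces mᵢ ≡ rᵢ (mod 2) whatever the exponent q is.
  rescale : ∀ {d} (ν : Fin d → ℝ) → (∀ i → 0# ≤ ν i) → (∀ i → IsRational (ν i)) →
            ∀ {g} → 0# < g → ∀ τ q (m : Fin d → ℕ) → (∀ i → τ * ν i ^ suc q ≈ fromℕ (m i) * g) →
            ∀ i → parity (m i) ≡ 1ℙ → ¬ (ν i ≈ 0#) →
            ∀ q′ → Rescaling ν g m q′
  rescale {d} ν 0≤ν ν∈ℚ {g} 0<g τ q m τν≈mg i mᵢ-odd νᵢ≉0 = finish (common-denominator ν 0≤ν ν∈ℚ)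
    where
    module _ {σ : ℝ} (0<σ : 0# < σ) (r : Fin d → ℕ) (ν≈σr : ∀ j → ν j ≈ σ * fromℕ (r j)) where

      power : ∀ q j → ν j ^ q ≈ σ ^ q * fromℕ (r j ℕ.^ q)
      power q j = trans (^-congˡ q (ν≈σr j)) (trans (^-distrib-* σ (fromℕ (r j)) q) (*-congˡ (sym (fromℕ-^ (r j) q))))

      -- Multiplied by g, both sides become τ σ^(q+1) r_j^(q+1) r_k^(q+1), which is symmetric in j
      -- and k.
      cross : ∀ j k → m j ℕ.* r k ℕ.^ suc q ≡ m k ℕ.* r j ℕ.^ suc q
      cross j k = fromℕ-injective (*-cancelˡ g (pos⇒≉0 0<g) (trans (side j k) (trans (solve 4 (λ t s a b → t :* (s :* a) :* b := t :* (s :* b) :* a) refl τ (σ ^ suc q) _ _) (sym (side k j)))))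
        where
        side : ∀ j k → g * fromℕ (m j ℕ.* r k ℕ.^ suc q) ≈ τ * (σ ^ suc q * fromℕ (r j ℕ.^ suc q)) * fromℕ (r k ℕ.^ suc q)
        side j k = begin-equality
          g * fromℕ (m j ℕ.* r k ℕ.^ suc q) ≈⟨ *-congˡ (×1-homo-* (m j) (r k ℕ.^ suc q)) ⟩
          g * (fromℕ (m j) * fromℕ (r k ℕ.^ suc q)) ≈⟨ solve 3 (λ g a b → g :* (a :* b) := a :* g :* b) refl g _ _ ⟩
          fromℕ (m j) * g * fromℕ (r k ℕ.^ suc q) ≈⟨ *-congʳ (trans (sym (τν≈mg j)) (*-congˡ (power (suc q) j))) ⟩
          τ * (σ ^ suc q * fromℕ (r j ℕ.^ suc q)) * fromℕ (r k ℕ.^ suc q) ∎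

      parity-cross : ∀ j k → parity (m j) Parity.* parity (r k) ≡ parity (m k) Parity.* parity (r j)
      parity-cross j k = ≡.trans (expand j k) (≡.trans (≡.cong parity (cross j k)) (≡.sym (expand k j)))
        where
        expand : ∀ j k → parity (m j) Parity.* parity (r k) ≡ parity (m j ℕ.* r k ℕ.^ suc q)
        expand j k = ≡.sym (≡.trans (Parity.*-homo-* (m j) (r k ℕ.^ suc q)) (≡.cong (parity (m j) Parity.*_) (parity-^ (r k) q)))

      -- Modulo 2 the powers drop out of `cross`, leaving m_j r_k ≡ m_k r_j. With m_i and r_k odd,
      -- the pair i, k makes m_k odd; then the pair j, k gives m_j ≡ r_j.
      parities-agree : ∀ {k} → parity (r k) ≡ 1ℙ → ∀ j → parity (r j) ≡ parity (m j)
      parities-agree {k} rₖ-odd j = ≡.sym (≡.trans (≡.sym (Parity.*-identityʳ (parity (m j)))) (≡.trans (≡.cong (parity (m j) Parity.*_) (≡.sym rₖ-odd))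
        (≡.trans (parity-cross j k) (≡.cong (Parity._* parity (r j)) mₖ-odd))))
        where
        1*⇒1 : ∀ p q s → p Parity.* q ≡ s Parity.* parity (r i) → p ≡ 1ℙ → q ≡ 1ℙ → s ≡ 1ℙ
        1*⇒1 p q 1ℙ _  _      _      = ≡.refl
        1*⇒1 p q 0ℙ eq ≡.refl ≡.refl = ≡.sym eq
        mₖ-odd : parity (m k) ≡ 1ℙ
        mₖ-odd = 1*⇒1 (parity (m i)) (parity (r k)) (parity (m k)) (parity-cross i k) mᵢ-odd rₖ-odd

      conclude : ∀ {k} → parity (r k) ≡ 1ℙ → ∀ q′ → Rescaling ν g m q′
      -- At time g / σ^(q′+1) the phases are exactly r_j^(q′+1) g, and r_j^(q′+1) has the parity of
      -- r_j.
      conclude rₖ-odd q′ = g * S ⁻¹ , *-pos 0<g (⁻¹-pos 0<S) , λ j → r j ℕ.^ suc q′ ,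
        (begin-equality
          g * S ⁻¹ * ν j ^ suc q′ ≈⟨ *-congˡ (power (suc q′) j) ⟩
          g * S ⁻¹ * (S * fromℕ (r j ℕ.^ suc q′)) ≈⟨ solve 4 (λ g e s x → g :* e :* (s :* x) := s :* e :* (x :* g)) refl g (S ⁻¹) S _ ⟩
          S * S ⁻¹ * (fromℕ (r j ℕ.^ suc q′) * g) ≈⟨ trans (*-congʳ (*-inverseʳ S (pos⇒≉0 0<S))) (*-identityˡ _) ⟩
          fromℕ (r j ℕ.^ suc q′) * g ∎) ,
        ≡.trans (parity-^ (r j) q′) (parities-agree rₖ-odd j)
        where
        S = σ ^ suc q′
        0<S = ^-pos 0<σ (suc q′)

    finish : ∃[ D ] Σ[ a ∈ (Fin d → ℕ) ] (∀ i → ν i * fromℕ (suc D) ≈ fromℕ (a i)) → ∀ q′ → Rescaling ν g m q′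
    finish (D , a , νD≈a) = with-odd-parts (odd-parts a i (ℕ.n≢0⇒n>0 λ aᵢ≡0 →
      νᵢ≉0 (*≈0 (trans (*-comm _ _) (trans (νD≈a i) (reflexive (≡.cong fromℕ aᵢ≡0)))) D≉0)))
      where
      D≉0 = pos⇒≉0 (fromℕ-suc-pos D)
      with-odd-parts : HasOddParts a → ∀ q′ → Rescaling ν g m q′
      with-odd-parts (s , r , 0<s , a≡sr , k , rₖ-odd) =
        conclude {fromℕ s * fromℕ (suc D) ⁻¹} (*-pos (fromℕ-pos 0<s) (⁻¹-pos (fromℕ-suc-pos D))) r ν≈σr rₖ-odd
        where
        ν≈σr : ∀ j → ν j ≈ fromℕ s * fromℕ (suc D) ⁻¹ * fromℕ (r j)
        ν≈σr j = *-cancelˡ (fromℕ (suc D)) D≉0 (begin-equality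
          fromℕ (suc D) * ν j ≈⟨ trans (*-comm _ _) (νD≈a j) ⟩
          fromℕ (a j) ≈⟨ trans (reflexive (≡.cong fromℕ (a≡sr j))) (×1-homo-* s (r j)) ⟩
          fromℕ s * fromℕ (r j) ≈⟨ trans (*-congʳ (*-inverseʳ _ D≉0)) (*-identityˡ _) ⟨
          fromℕ (suc D) * fromℕ (suc D) ⁻¹ * (fromℕ s * fromℕ (r j)) ≈⟨ solve 4 (λ D E s r → D :* E :* (s :* r) := D :* (s :* E :* r)) refl (fromℕ (suc D)) (fromℕ (suc D) ⁻¹) (fromℕ s) (fromℕ (r j)) ⟩
          fromℕ (suc D) * (fromℕ s * fromℕ (suc D) ⁻¹ * fromℕ (r j)) ∎)

-- Positivity of even powers and transfer from one even power to another.

module EvenPowers (em : ExcludedMiddle 0ℓ) (R : CompleteOrderedField) {n : ℕ}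
                  (H : Matrix (CompleteOrderedField.Carrier R) n) where
  open OrderedField em R
  open Periods em R
  open Exponential em R using (cosine; sine; cosine-cong; sine-cong)
  open SpectralTheory em R
  open Rationality em R
  open MatrixExponential em R
  open PerfectStateTransfer em R {n}
  open Complex R using (PST)
  open PartialOrderReasoning poset

  ^-double : ∀ x q → x ^ (q ℕ.* 2) ≈ (x * x) ^ q
  ^-double x zero  = refl
  ^-double x (suc q) = trans (sym (*-assoc _ _ _)) (*-congˡ (^-double x q))

  module _ (H-sa : SelfAdjoint H) where

    even-power-form : ∀ q v → dot v ((H ^ₘ (q ℕ.* 2)) *ᵥ v) ≈ norm² ((H ^ₘ q) *ᵥ v)
    even-power-form q v = begin-equality
      dot v ((H ^ₘ (q ℕ.* 2)) *ᵥ v) ≡⟨ ≡.cong (λ e → dot v ((H ^ₘ e) *ᵥ v)) (≡.trans (ℕ.*-comm q 2) (≡.cong (q ℕ.+_) (ℕ.+-identityʳ q))) ⟩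
      dot v ((H ^ₘ (q ℕ.+ q)) *ᵥ v) ≈⟨ dot-congʳ v (^ₘ-+ H q q v) ⟩
      dot v ((H ^ₘ q) *ᵥ ((H ^ₘ q) *ᵥ v)) ≈⟨ ^ₘ-selfAdjoint H H-sa q v ((H ^ₘ q) *ᵥ v) ⟨
      norm² ((H ^ₘ q) *ᵥ v) ∎

    even-power-nonneg : ∀ q v → 0# ≤ dot v ((H ^ₘ (q ℕ.* 2)) *ᵥ v)
    even-power-nonneg q v = ≤-trans (norm²-nonneg ((H ^ₘ q) *ᵥ v)) (≤-reflexive (sym (even-power-form q v)))

    private
      A : Matrix ℝ n
      A = H ^ₘ 2

      iterate : ℕ → Vector ℝ n → Vector ℝ n
      iterate i x = (H ^ₘ (i ℕ.* 2)) *ᵥ x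

      iterate-suc : ∀ i x → iterate i (A *ᵥ x) ≈ᵥ iterate (suc i) x
      iterate-suc i x u = trans (sym (^ₘ-+ H (i ℕ.* 2) 2 x u)) (reflexive (≡.cong (λ e → ((H ^ₘ e) *ᵥ x) u) (ℕ.+-comm (i ℕ.* 2) 2)))

      -- Σ_{i<j} ν^(j-1-i) Aⁱ x
      geometric : ℝ → ℕ → Vector ℝ n → Vector ℝ n
      geometric ν zero  x = 𝟎
      geometric ν (suc j) x = A *ᵥ geometric ν j x +ᵥ ν ^ j · x

      telescope : ∀ ν j w → geometric ν j (shift A ν w) ≈ᵥ iterate j w -ᵥ ν ^ j · w
      telescope ν zero w u = sym (x≈y⇒x-y≈0 (trans (^ₘ-zero H w u) (sym (*-identityˡ _))))
      telescope ν (suc j) w u = begin-equality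
        (A *ᵥ geometric ν j (shift A ν w)) u + ν ^ j * shift A ν w u
          ≈⟨ +-congʳ (trans (*ᵥ-cong A (telescope ν j w) u) (*ᵥ-sub A (ν ^ j) (iterate j w) w u)) ⟩
        (A *ᵥ iterate j w) u + - (ν ^ j * (A *ᵥ w) u) + ν ^ j * ((A *ᵥ w) u + - (ν * w u))
          ≈⟨ solve 5 (λ a p b v w → a :- p :* b :+ p :* (b :- v :* w) := a :- v :* p :* w) refl _ (ν ^ j) ((A *ᵥ w) u) ν (w u) ⟩
        (A *ᵥ iterate j w) u + - (ν * ν ^ j * w u)
          ≈⟨ +-congʳ (^ₘ-+ H 2 (j ℕ.* 2) w u) ⟨
        (iterate (suc j) w -ᵥ ν ^ suc j · w) u ∎

      dot-iterate : ∀ ν i j v → dot v (iterate i (geometric ν (suc j) v)) ≈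
                    dot v (iterate (suc i) (geometric ν j v)) + ν ^ j * dot v (iterate i v)
      dot-iterate ν i j v = begin-equality
        dot v (iterate i (A *ᵥ G +ᵥ ν ^ j · v))
          ≈⟨ dot-congʳ v (λ u → trans (*ᵥ-+ (H ^ₘ (i ℕ.* 2)) (A *ᵥ G) (ν ^ j · v) u)
               (+-cong (iterate-suc i G u) (*ᵥ-· (H ^ₘ (i ℕ.* 2)) (ν ^ j) v u))) ⟩
        dot v (iterate (suc i) G +ᵥ ν ^ j · iterate i v)
          ≈⟨ trans (dot-+ʳ v (iterate (suc i) G) (ν ^ j · iterate i v)) (+-congˡ (dot-·ʳ (ν ^ j) v (iterate i v))) ⟩
        dot v (iterate (suc i) G) + ν ^ j * dot v (iterate i v) ∎
        where G = geometric ν j v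

      -- The exponent i is general because unfolding one step of `geometric` moves a factor A into
      -- `iterate`; the remaining terms ν^j ⟨v , Aⁱ v⟩ are nonnegative as A is a square.
      geometric-nonneg : ∀ {ν} → 0# < ν → ∀ i j v → 0# ≤ dot v (iterate i (geometric ν j v))
      geometric-nonneg 0<ν i zero  v = ≤-reflexive (sym (dot-zeroʳ v _ (*ᵥ-zero (H ^ₘ (i ℕ.* 2)) 𝟎 (λ _ → refl))))
      geometric-nonneg {ν} 0<ν i (suc j) v = ≤-trans
        (+-nonneg (geometric-nonneg 0<ν (suc i) j v) (*-nonNeg (<⇒≤ (^-pos 0<ν j)) (even-power-nonneg i v)))
        (≤-reflexive (sym (dot-iterate ν i j v)))

    -- A^q - ν^q = G (A - ν) with G positive definite, as A = H² is positive semidefinite and ν > 0.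
    eigen-root : ∀ {ν} → 0# < ν → ∀ q w → (H ^ₘ (suc q ℕ.* 2)) *ᵥ w ≈ᵥ ν ^ suc q · w → A *ᵥ w ≈ᵥ ν · w
    eigen-root {ν} 0<ν q w A^q·w≈ν^q·w u = x-y≈0⇒x≈y (norm²≈0 v |v|²≈0 u)
      where
      v = shift A ν w
      G = geometric ν (suc q) v
      G≈0 : G ≈ᵥ 𝟎
      G≈0 u = trans (telescope ν (suc q) w u) (x≈y⇒x-y≈0 (A^q·w≈ν^q·w u))
      form≈0 : ν ^ q * norm² v + dot v (iterate 1 (geometric ν q v)) ≈ 0#
      form≈0 = begin-equality
        ν ^ q * norm² v + dot v (iterate 1 (geometric ν q v)) ≈⟨ +-comm _ _ ⟩
        dot v (iterate 1 (geometric ν q v)) + ν ^ q * norm² v ≈⟨ +-congˡ (*-congˡ (dot-congʳ v (^ₘ-zero H v))) ⟨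
        dot v (iterate 1 (geometric ν q v)) + ν ^ q * dot v (iterate 0 v) ≈⟨ dot-iterate ν 0 q v ⟨
        dot v (iterate 0 G) ≈⟨ dot-zeroʳ v (iterate 0 G) (*ᵥ-zero (H ^ₘ 0) G G≈0) ⟩
        0# ∎
      |v|²≈0 : norm² v ≈ 0#
      |v|²≈0 = *≈0 (+-nonneg≈0 (*-nonNeg (<⇒≤ (^-pos 0<ν q)) (norm²-nonneg v)) (geometric-nonneg 0<ν 1 q v) form≈0)
        (pos⇒≉0 (^-pos 0<ν q))

    supported-power : ∀ {a θ} k → Supported H a θ → Supported (H ^ₘ k) a (θ ^ k)
    supported-power {a} {θ} k (x , Hx≈θx , xa≉0) = x , ^ₘ-eigen H θ x Hx≈θx k , xa≉0

    support-nonneg : ∀ {a} q θ → Supported (H ^ₘ (q ℕ.* 2)) a θ → 0# ≤ θ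
    support-nonneg {a} q θ (x , Kx≈θx , xa≉0) = *-cancelˡ-nonneg
      (nonneg∧≉0⇒pos (norm²-nonneg x) (norm²≉0 {x = x} (λ x≈0 → xa≉0 (x≈0 a))))
      (≤-trans (even-power-nonneg q x) (≤-reflexive
        (trans (dot-congʳ x Kx≈θx) (trans (dot-·ʳ θ x x) (*-comm _ _)))))

    -- The decomposition obtained from H serves all powers: only the eigenvalues change, and those
    -- of different components may become equal.
    powerData : ∀ {v} k → SpectralData H H-sa v → SpectralData (H ^ₘ k) (^ₘ-selfAdjoint H H-sa k) v
    powerData k S = record
      { size          = size
      ; decomposition = record
        { eigenvalue = λ i → eigenvalue i ^ k
        ; component  = component
        ; isEigen    = λ i → ^ₘ-eigen H (eigenvalue i) (component i) (isEigen i) k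
        ; decomposes = decomposes
        }
      ; supported     = λ i → supported-power k (supported i)
      }
      where open SpectralData S

    module _ (H∈ℚ : RationalMatrix H) (a b : Fin n) (b≢a : b ≢ a) (0-supported : Supported H a 0#)
             (q : ℕ) (pst : PST (H ^ₘ (suc q ℕ.* 2)) a b) where
      private
        k = suc q ℕ.* 2
        K = H ^ₘ k
        K-sa = ^ₘ-selfAdjoint H H-sa k
        K∈ℚ = ^ₘ-rational H H∈ℚ k
        τ = proj₁ pst
        0<τ = proj₁ (proj₂ pst)
        γ = proj₁ (proj₂ (proj₂ pst))
        |γ|≈1 = proj₁ (proj₂ (proj₂ (proj₂ pst)))
        U-exp = proj₁ (proj₂ (proj₂ (proj₂ (proj₂ (proj₂ pst)))))
        Ua≈γb = proj₂ (proj₂ (proj₂ (proj₂ (proj₂ (proj₂ pst)))))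

        0-supportedᴷ : Supported K a 0#
        0-supportedᴷ = supported-cong (zeroˡ _) (supported-power k 0-supported)

        S-H = proj₁ (spectralData H H-sa H∈ℚ a)
        S-K = proj₁ (spectralData K K-sa K∈ℚ a)

        transfer : (S : SpectralData K K-sa a) → Transfer K K-sa τ a (SpectralData.decomposition S) γ b
        transfer S = exp⇒transfer K K-sa τ a b U-exp Ua≈γb (SpectralData.decomposition S)

      -- At a nonzero entry of the rational eigenvector w, θ² is the quotient of (A w)_u by w_u. The
      -- case θ² = 0 is split off because `eigen-root` requires a positive eigenvalue.
      eigenvalue²-rational : ∀ {θ} → Supported H a θ → IsRational (θ * θ)
      eigenvalue²-rational {θ} θ-supp@(x , Hx≈θx , xa≉0) = by-cases
        (λ θ²≈0 → rational-cong (sym θ²≈0) 0-rational)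
        (λ θ²≉0 → ratio (nonneg∧≉0⇒pos (square-nonneg θ) θ²≉0)
          (rational-eigenvector K K∈ℚ
            (Forward.support-rational K K-sa a b b≢a (support-nonneg (suc q)) 0-supportedᴷ S-K τ 0<τ γ (transfer S-K)
              (proj₂ (spectralData K K-sa K∈ℚ a)) (supported-power k θ-supp))
            x (λ x≈0 → xa≉0 (x≈0 a)) (^ₘ-eigen H θ x Hx≈θx k)))
        where
        ratio : 0# < θ * θ → ∃[ w ] (∀ u → IsRational (w u)) × ¬ (w ≈ᵥ 𝟎) × K *ᵥ w ≈ᵥ θ ^ k · w → IsRational (θ * θ)
        ratio 0<θ² (w , w∈ℚ , w≉0 , Kw≈μw) = by-contradiction λ θ²∉ℚ → w≉0 λ u → by-contradiction λ wu≉0 →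
          θ²∉ℚ (rational-cong
            (trans (*-comm _ _) (trans
              (*-congˡ (trans (eigen-root 0<θ² q w (λ u → trans (Kw≈μw u) (*-congʳ (^-double θ (suc q)))) u) (*-comm _ _)))
              (⁻¹-cancelˡ (θ * θ) wu≉0)))
            (*-rational (dot-rational (A u) w (^ₘ-rational H H∈ℚ 2 u) w∈ℚ) (⁻¹-rational wu≉0 (w∈ℚ u))))

      all-even-powers : ∀ q′ → PST (H ^ₘ (suc q′ ℕ.* 2)) a b
      all-even-powers q′ = conclude (rescale (λ i → θ i * θ i) (λ i → square-nonneg (θ i)) (λ i → eigenvalue²-rational (supported i))
        0<g τ q m (λ i → trans (*-congˡ (sym (^-double (θ i) (suc q)))) (τθ≈mg i))
        i₀ (sgn≉1 (λ sgn≈1 → c≉1 (trans (cos≈sgn i₀) sgn≈1))) θ²≉0 q′)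
        where
        open SpectralData S-H using (size; supported) renaming (eigenvalue to θ)
        -- Here the decomposition comes from H, so that the same components describe the power k′ as
        -- well. The rationality of the trace, by contrast, was read off from the minimal polynomial
        -- belonging to K itself.
        S = powerData k S-H
        module F = Forward K K-sa a b b≢a (support-nonneg (suc q)) 0-supportedᴷ S τ 0<τ γ (transfer S)
        g = proj₁ F.halfPeriod-exists
        period = proj₂ F.halfPeriod-exists
        0<g = proj₁ period
        at-multiple = proj₂ (proj₂ period)
        m : Fin size → ℕ
        m i = proj₁ (F.multiples period (supported-power k (supported i)))
        τθ≈mg : ∀ i → τ * θ i ^ k ≈ fromℕ (m i) * g
        τθ≈mg i = proj₂ (F.multiples period (supported-power k (supported i)))
        i₀ = proj₁ F.nontrivial
        c≉1 = proj₂ F.nontrivial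
        cos≈sgn : ∀ i → cosine (τ * θ i ^ k) ≈ sgn (parity (m i))
        cos≈sgn i = trans (cosine-cong (τθ≈mg i)) (proj₂ (at-multiple (m i)))
        sin≈0 : ∀ i → sine (τ * θ i ^ k) ≈ 0#
        sin≈0 i = trans (sine-cong (τθ≈mg i)) (proj₁ (at-multiple (m i)))
        sgn≉1 : ∀ {p} → ¬ (sgn p ≈ 1#) → p ≡ 1ℙ
        sgn≉1 {0ℙ} 1≉1 = contradiction refl 1≉1
        sgn≉1 {1ℙ} _   = ≡.refl
        θ²≉0 : ¬ (θ i₀ * θ i₀ ≈ 0#)
        θ²≉0 θ²≈0 = c≉1 (trans (cosine-cong (trans (*-congˡ (trans (^-double (θ i₀) (suc q)) (trans (*-congʳ θ²≈0) (zeroˡ _)))) (zeroʳ τ))) cosine-0)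

        k′ = suc q′ ℕ.* 2
        K′-sa = ^ₘ-selfAdjoint H H-sa k′

        conclude : Rescaling (λ i → θ i * θ i) g m q′ → PST (H ^ₘ k′) a b
        conclude (τ′ , 0<τ′ , multiple) = τ′ , 0<τ′ , γ , |γ|≈1 ,
          transfer⇒exp (H ^ₘ k′) K′-sa τ′ (λ v → _ , SpectralData.decomposition (powerData k′ (proj₁ (spectralData H H-sa H∈ℚ v)))) a b
            (SpectralData.decomposition (powerData k′ S-H))
            -- Term by term, equal parities give equal cosines and both sines vanish, so the
            -- a-column is the old one and γ is kept.
            ((λ u → trans (sum-cong-≋ (λ i → *-congˡ (trans (cosine-cong (τ′θ≈ i)) (trans (proj₂ (at-multiple (l i)))
                (trans (reflexive (≡.cong sgn (proj₂ (proj₂ (multiple i))))) (sym (cos≈sgn i))))))) (proj₁ (transfer S) u)) ,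
             (λ u → trans (sum-cong-≋ (λ i → *-congˡ (trans (sine-cong (τ′θ≈ i)) (trans (proj₁ (at-multiple (l i)))
                (sym (sin≈0 i)))))) (proj₂ (transfer S) u)))
          where
          l : Fin size → ℕ
          l i = proj₁ (multiple i)
          τ′θ≈ : ∀ i → τ′ * θ i ^ k′ ≈ fromℕ (l i) * g
          τ′θ≈ i = trans (*-congˡ (^-double (θ i) (suc q′))) (proj₁ (proj₂ (multiple i)))

-- The dichotomy and the rationality of squares, for supports given by orthogonal projections.

theorem1p5 : ExcludedMiddle 0ℓ → (R : CompleteOrderedField) →
    let open Real R
        open Complex R using (PST) in
    ∀ (n : ℕ) (H : Matrix ℚ n) → Symmetric H → (a : Fin n) →
    Supp (toReal H) (basis a) 0# →
    ∀ (b : Fin n) → b ≢ a →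
    ((∀ k → PositiveEven k → ¬ PST (toReal H ^ₘ k) a b)
      ⊎ (∀ k → PositiveEven k → PST (toReal H ^ₘ k) a b))
    × ((∃[ k ] PositiveEven k × PST (toReal H ^ₘ k) a b) →
       ∀ θ → Supp (toReal H) (basis a) θ → IsRational (θ * θ))
theorem1p5 em R n H H-sym a 0∈supp b b≢a = dichotomy , squares-rational
  where
  open Real R using (toReal; Supp)
  open OrderedField em R
  open SpectralTheory em R using (norm²; norm²≉0)
  open PerfectStateTransfer em R {n} using (Supported)
  open EvenPowers em R {n} (toReal H) using (eigenvalue²-rational; all-even-powers)
  open Complex R using (PST)

  Hℝ : Matrix ℝ n
  Hℝ = toReal H

  H-sa : SelfAdjoint Hℝ
  H-sa = symmetric⇒selfAdjoint Hℝ (λ u v → reflexive (≡.cong (Real.fromℚ R) (H-sym u v)))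

  -- The eigenvector is x = E e_a. Since e_a - E e_a is orthogonal to x, its a-entry ⟨x , e_a⟩
  -- equals |x|², which is nonzero.
  supp⇒supported : ∀ {θ} → Supp Hℝ (basis a) θ → Supported Hℝ a θ
  supp⇒supported {θ} (_ , E , E-proj , Ea≉0) = x , proj₁ (E-proj (basis a)) , λ xa≈0 → norm²≉0 {x = x} Ea≉0 (trans norm²≈xa xa≈0)
    where
    x = E *ᵥ basis a
    norm²≈xa : norm² x ≈ x a
    norm²≈xa = sym (trans (sym (dot-basis x a)) (trans (dot-congʳ x (λ u → split (basis a u) (x u)))
      (trans (dot-+ʳ x (basis a -ᵥ x) x) (trans (+-congʳ (trans (dot-comm x (basis a -ᵥ x))
        (proj₂ (E-proj (basis a)) x (proj₁ (E-proj (basis a)))))) (+-identityˡ _)))))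
      where
      split : ∀ s t → s ≈ s + - t + t
      split s t = sym (trans (+-assoc _ _ _) (trans (+-congˡ (-‿inverseˡ t)) (+-identityʳ s)))

  0-supported : Supported Hℝ a 0#
  0-supported = supp⇒supported 0∈supp

  H∈ℚ : ∀ u v → IsRational (Hℝ u v)
  H∈ℚ u v = H u v , refl

  dichotomy : (∀ k → PositiveEven k → ¬ PST (Hℝ ^ₘ k) a b) ⊎ (∀ k → PositiveEven k → PST (Hℝ ^ₘ k) a b)
  dichotomy = by-cases (λ some → inj₂ (from some)) (λ none → inj₁ λ k k-even pst → none (k , k-even , pst))
    where
    from : ∃[ k ] PositiveEven k × PST (Hℝ ^ₘ k) a b → ∀ k → PositiveEven k → PST (Hℝ ^ₘ k) a b
    -- Positivity of the exponents excludes the quotient zero, so both have the form `suc q * 2`.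
    from (_ , (_ , divides (suc q) ≡.refl) , pst) _ (_ , divides (suc q′) ≡.refl) =
      all-even-powers H-sa H∈ℚ a b b≢a 0-supported q pst q′

  squares-rational : (∃[ k ] PositiveEven k × PST (Hℝ ^ₘ k) a b) → ∀ θ → Supp Hℝ (basis a) θ → IsRational (θ * θ)
  squares-rational (_ , (_ , divides (suc q) ≡.refl) , pst) θ θ∈supp =
    eigenvalue²-rational H-sa H∈ℚ a b b≢a 0-supported q pst (supp⇒supported θ∈supp)
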